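{- Let $m \geq 1$ be an integer and let $q \in (m, m+1)$ be a Pisot number. Then $q$ has no non-real Galois conjugate $q'$ with $|q'| < \frac{1}{m+1/2}$, and $q$ has at most one real Galois conjugate $q'$ with $|q'| < \frac{1}{m+1/2}$.
   Context: A Pisot number is a real algebraic integer $q>1$ all of whose other Galois conjugates have absolute value strictly less than $1$. -}

module Defs where

open import Data.Bool.Base using (if_then_else_)
open import Data.Integer.Base as ℤ using (ℤ; +_)
import Data.Integer.Properties as ℤP
open import Data.Nat.Base as ℕ using (ℕ; zero; suc)
import Data.Nat.Properties as ℕP
open import Data.Nat.Coprimality using (1-coprimeTo) renaming (sym to coprime-sym)
open import Data.Product.Base using (Σ-syntax; ∃-syntax; _×_; _,_; proj₁; proj₂)
open import Data.Rational.Base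
open import Data.Rational.Properties
open import Data.Rational.Solver using (module +-*-Solver)
open import Data.Sum.Base using (inj₁; inj₂)
open import Data.Vec.Base using (Vec; []; _∷_; map)
open import Relation.Binary.PropositionalEquality
  using (_≡_; refl; sym; trans; cong; cong₂; subst)
open import Relation.Nullary using (¬_; Dec; yes; no; does)

open +-*-Solver

Eventually : (ℕ → Set) → Set
Eventually P = ∃[ N ] ∀ n → N ℕ.≤ n → P n

IsCauchy : (ℕ → ℚ) → Set
IsCauchy x = ∀ ε → 0ℚ < ε →
  ∃[ N ] ∀ m n → N ℕ.≤ m → N ℕ.≤ n → ∣ x m - x n ∣ < ε

----------------------------------------------------------------------
-- Rational estimates, used only to see that the operations on Cauchy
-- sequences below produce Cauchy sequences.

pos-* : ∀ {p q} → 0ℚ < p → 0ℚ < q → 0ℚ < p * q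
pos-* {p} {q} 0<p 0<q =
  positive⁻¹ (p * q) {{pos*pos⇒pos p {{positive 0<p}} q {{positive 0<q}}}}

half-pos : ∀ {ε} → 0ℚ < ε → 0ℚ < ε * ½
half-pos 0<ε = pos-* 0<ε (positive⁻¹ ½)

half+half : ∀ ε → ε * ½ + ε * ½ ≡ ε
half+half = solve 1 (λ ε → ε :* con ½ :+ ε :* con ½ := ε) refl

p≤∣p∣ : ∀ p → p ≤ ∣ p ∣
p≤∣p∣ p with ≤-total 0ℚ p
... | inj₁ 0≤p = ≤-reflexive (sym (0≤p⇒∣p∣≡p 0≤p))
... | inj₂ p≤0 = ≤-trans p≤0 (0≤∣p∣ p)

∣p-q∣-sym : ∀ p q → ∣ p - q ∣ ≡ ∣ q - p ∣
∣p-q∣-sym p q = trans (sym (∣-p∣≡∣p∣ (p - q)))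
  (cong ∣_∣ (solve 2 (λ p q → :- (p :- q) := q :- p) refl p q))

p≤q+∣p-q∣ : ∀ p q → p ≤ q + ∣ p - q ∣
p≤q+∣p-q∣ p q = ≤-trans
  (≤-reflexive (solve 2 (λ p q → p := q :+ (p :- q)) refl p q))
  (+-monoʳ-≤ q (p≤∣p∣ (p - q)))

p<q+r⇒p-q<r : ∀ {p q r} → p < q + r → p - q < r
p<q+r⇒p-q<r {p} {q} {r} p<q+r =
  subst (p - q <_) (solve 2 (λ q r → q :+ r :- q := r) refl q r)
    (+-monoˡ-< (- q) p<q+r)

∣p-q∣<r : ∀ {p q r} → p < q + r → q < p + r → ∣ p - q ∣ < r
∣p-q∣<r {p} {q} {r} p<q+r q<p+r with ∣p∣≡p∨∣p∣≡-p (p - q)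
... | inj₁ eq = subst (_< r) (sym eq) (p<q+r⇒p-q<r p<q+r)
... | inj₂ eq = subst (_< r)
  (sym (trans eq (solve 2 (λ p q → :- (p :- q) := q :- p) refl p q)))
  (p<q+r⇒p-q<r q<p+r)

p⊔0-Lipschitz : ∀ p q → p ⊔ 0ℚ ≤ (q ⊔ 0ℚ) + ∣ p - q ∣
p⊔0-Lipschitz p q = ⊔-lub
  (≤-trans (p≤q+∣p-q∣ p q) (+-monoˡ-≤ ∣ p - q ∣ (p≤p⊔q q 0ℚ)))
  (≤-trans (p≤q⊔p q 0ℚ) (≤-trans (≤-reflexive (sym (+-identityʳ _)))
    (+-monoʳ-≤ (q ⊔ 0ℚ) (0≤∣p∣ (p - q)))))

*-mono-nonNeg : ∀ {p q r s} → 0ℚ ≤ r → 0ℚ ≤ q → p ≤ q → r ≤ s → p * r ≤ q * s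
*-mono-nonNeg {p} {q} {r} {s} 0≤r 0≤q p≤q r≤s = ≤-trans
  (*-monoʳ-≤-nonNeg r {{nonNegative 0≤r}} p≤q)
  (*-monoˡ-≤-nonNeg q {{nonNegative 0≤q}} r≤s)

0≤* : ∀ {p q} → 0ℚ ≤ p → 0ℚ ≤ q → 0ℚ ≤ p * q
0≤* {p} {q} 0≤p 0≤q = subst (_≤ p * q) (*-zeroˡ q)
  (*-monoʳ-≤-nonNeg q {{nonNegative 0≤q}} 0≤p)

cauchy⇒bounded : ∀ {x} → IsCauchy x →
  ∃[ B ] (0ℚ < B × Eventually (λ n → ∣ x n ∣ ≤ B))
cauchy⇒bounded {x} c with c 1ℚ (positive⁻¹ 1ℚ)
... | N , h = ∣ x N ∣ + 1ℚ
  , <-≤-trans (positive⁻¹ 1ℚ) (≤-trans (≤-reflexive (sym (+-identityˡ 1ℚ)))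
      (+-monoˡ-≤ 1ℚ (0≤∣p∣ (x N))))
  , N , λ n N≤n → ≤-trans
      (≤-reflexive (cong ∣_∣ (solve 2 (λ a b → a := b :+ (a :- b)) refl (x n) (x N))))
      (≤-trans (∣p+q∣≤∣p∣+∣q∣ (x N) (x n - x N))
        (+-monoʳ-≤ ∣ x N ∣ (<⇒≤ (h n N N≤n ℕP.≤-refl))))

cauchy-+ : ∀ x y → IsCauchy x → IsCauchy y → IsCauchy (λ n → x n + y n)
cauchy-+ x y cx cy ε 0<ε
  with cx (ε * ½) (half-pos 0<ε) | cy (ε * ½) (half-pos 0<ε)
... | M , hx | N , hy = M ℕ.⊔ N , λ m n ≤m ≤n → <-respʳ-≡ (half+half ε)
  (≤-<-trans
    (≤-trans
      (≤-reflexive (cong ∣_∣ (solve 4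
        (λ a b c d → a :+ b :- (c :+ d) := (a :- c) :+ (b :- d)) refl
        (x m) (y m) (x n) (y n))))
      (∣p+q∣≤∣p∣+∣q∣ (x m - x n) (y m - y n)))
    (+-mono-<
      (hx m n (ℕP.m⊔n≤o⇒m≤o M N ≤m) (ℕP.m⊔n≤o⇒m≤o M N ≤n))
      (hy m n (ℕP.m⊔n≤o⇒n≤o M N ≤m) (ℕP.m⊔n≤o⇒n≤o M N ≤n))))

cauchy-neg : ∀ x → IsCauchy x → IsCauchy (λ n → - x n)
cauchy-neg x cx ε 0<ε with cx ε 0<ε
... | N , h = N , λ m n ≤m ≤n → subst (_< ε)
  (trans (sym (∣-p∣≡∣p∣ (x m - x n)))
    (cong ∣_∣ (solve 2 (λ a b → :- (a :- b) := :- a :- :- b) refl (x m) (x n))))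
  (h m n ≤m ≤n)

-- For B > 0 some δ > 0 satisfies B δ = ε.
divide : ∀ {B ε} → 0ℚ < B → 0ℚ < ε → ∃[ δ ] (0ℚ < δ × B * δ ≡ ε)
divide {B} {ε} 0<B 0<ε = ε * B⁻¹
  , pos-* 0<ε (positive⁻¹ B⁻¹ {{1/pos⇒pos B {{positive 0<B}}}})
  , trans (solve 3 (λ b e i → b :* (e :* i) := b :* i :* e) refl B ε B⁻¹)
      (trans (cong (_* ε) (*-inverseʳ B {{>-nonZero 0<B}})) (*-identityˡ ε))
  where B⁻¹ = (1/ B) {{>-nonZero 0<B}}

∣ab-cd∣< : ∀ a b c d {A B α β} → 0ℚ < A → 0ℚ < B →
  ∣ a ∣ ≤ A → ∣ d ∣ ≤ B → ∣ b - d ∣ < α → ∣ a - c ∣ < β →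
  ∣ a * b - c * d ∣ < A * α + B * β
∣ab-cd∣< a b c d {A} {B} {α} {β} 0<A 0<B ∣a∣≤A ∣d∣≤B b-d a-c =
  ≤-<-trans (subst (λ t → ∣ t ∣ ≤ ∣ p ∣ + ∣ q ∣) (sym split) (∣p+q∣≤∣p∣+∣q∣ p q))
    (+-mono-< (≤-<-trans p≤ p<) (≤-<-trans q≤ q<))
  where
  p q : ℚ
  p = a * (b - d)
  q = d * (a - c)
  split : a * b - c * d ≡ p + q
  split = solve 4
    (λ a b c d → a :* b :- c :* d := a :* (b :- d) :+ d :* (a :- c)) refl a b c d
  p≤ : ∣ p ∣ ≤ A * ∣ b - d ∣
  p≤ = subst (_≤ A * ∣ b - d ∣) (sym (∣p*q∣≡∣p∣*∣q∣ a (b - d)))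
    (*-monoʳ-≤-nonNeg ∣ b - d ∣ {{nonNegative (0≤∣p∣ (b - d))}} ∣a∣≤A)
  q≤ : ∣ q ∣ ≤ B * ∣ a - c ∣
  q≤ = subst (_≤ B * ∣ a - c ∣) (sym (∣p*q∣≡∣p∣*∣q∣ d (a - c)))
    (*-monoʳ-≤-nonNeg ∣ a - c ∣ {{nonNegative (0≤∣p∣ (a - c))}} ∣d∣≤B)
  p< : A * ∣ b - d ∣ < A * α
  p< = *-monoʳ-<-pos A {{positive 0<A}} b-d
  q< : B * ∣ a - c ∣ < B * β
  q< = *-monoʳ-<-pos B {{positive 0<B}} a-c

cauchy-* : ∀ x y → IsCauchy x → IsCauchy y → IsCauchy (λ n → x n * y n)
cauchy-* x y cx cy ε 0<ε =
  let (A , 0<A , K , hA) = cauchy⇒bounded cx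
      (B , 0<B , L , hB) = cauchy⇒bounded cy
      (α , 0<α , Aα≡) = divide 0<A (half-pos 0<ε)
      (β , 0<β , Bβ≡) = divide 0<B (half-pos 0<ε)
      (M , hx) = cx β 0<β
      (N , hy) = cy α 0<α
  in K ℕ.⊔ L ℕ.⊔ (M ℕ.⊔ N) , λ m n ≤m ≤n →
  let K≤m = ℕP.m⊔n≤o⇒m≤o K L (ℕP.m⊔n≤o⇒m≤o (K ℕ.⊔ L) (M ℕ.⊔ N) ≤m)
      L≤n = ℕP.m⊔n≤o⇒n≤o K L (ℕP.m⊔n≤o⇒m≤o (K ℕ.⊔ L) (M ℕ.⊔ N) ≤n)
      MN≤m = ℕP.m⊔n≤o⇒n≤o (K ℕ.⊔ L) (M ℕ.⊔ N) ≤m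
      MN≤n = ℕP.m⊔n≤o⇒n≤o (K ℕ.⊔ L) (M ℕ.⊔ N) ≤n
  in subst (∣ x m * y m - x n * y n ∣ <_) (trans (cong₂ _+_ Aα≡ Bβ≡) (half+half ε))
      (∣ab-cd∣< (x m) (y m) (x n) (y n) 0<A 0<B (hA m K≤m) (hB n L≤n)
        (hy m n (ℕP.m⊔n≤o⇒n≤o M N MN≤m) (ℕP.m⊔n≤o⇒n≤o M N MN≤n))
        (hx m n (ℕP.m⊔n≤o⇒m≤o M N MN≤m) (ℕP.m⊔n≤o⇒m≤o M N MN≤n)))

½^ : ℕ → ℚ
½^ zero    = 1ℚ
½^ (suc n) = ½^ n * ½

0<½^ : ∀ n → 0ℚ < ½^ n
0<½^ zero    = positive⁻¹ 1ℚ
0<½^ (suc n) = half-pos (0<½^ n)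

ι : ℕ → ℚ
ι zero    = 0ℚ
ι (suc n) = ι n + 1ℚ

0≤ι : ∀ n → 0ℚ ≤ ι n
0≤ι zero    = ≤-refl
0≤ι (suc n) = ≤-trans (0≤ι n)
  (≤-trans (≤-reflexive (sym (+-identityʳ (ι n)))) (+-monoʳ-≤ (ι n) (nonNegative⁻¹ 1ℚ)))

ι-mono : ∀ {m n} → m ℕ.≤ n → ι m ≤ ι n
ι-mono {n = n} ℕ.z≤n = 0≤ι n
ι-mono (ℕ.s≤s m≤n)   = +-monoˡ-≤ 1ℚ (ι-mono m≤n)

ι≡ : ∀ n → ι n ≡ mkℚ (+ n) 0 (coprime-sym (1-coprimeTo n))
ι≡ zero    = refl
ι≡ (suc n) = trans (cong (_+ 1ℚ) (ι≡ n))
  (trans (cong (λ k → k / 1)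
           (trans (cong₂ ℤ._+_ (ℤP.*-identityʳ (+ n)) (ℤP.*-identityʳ (+ 1)))
                  (cong +_ (ℕP.+-comm n 1))))
    (↥p/↧p≡p (mkℚ (+ suc n) 0 (coprime-sym (1-coprimeTo (suc n))))))

p≤ι∣↥p∣ : ∀ p → p ≤ ι ℤ.∣ ↥ p ∣
p≤ι∣↥p∣ p = subst (p ≤_) (sym (ι≡ ℤ.∣ ↥ p ∣)) (*≤* (lemma (↥ p) (↧ₙ p)))
  where
  lemma : ∀ i d .{{_ : ℕ.NonZero d}} → i ℤ.* + 1 ℤ.≤ + ℤ.∣ i ∣ ℤ.* + d
  lemma (+ n) d = subst (ℤ._≤ + n ℤ.* + d) (sym (ℤP.*-identityʳ (+ n)))
    (subst (+ n ℤ.≤_) (ℤP.pos-* n d) (ℤ.+≤+ (ℕP.m≤m*n n d)))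
  lemma ℤ.-[1+ n ] (suc d) = ℤ.-≤+

ι*½^≤1 : ∀ n → (ι n + 1ℚ) * ½^ n ≤ 1ℚ
ι*½^≤1 zero    = ≤-refl
ι*½^≤1 (suc n) = ≤-trans
  (≤-trans
    (≤-reflexive (solve 2
      (λ a h → (a :+ con 1ℚ :+ con 1ℚ) :* (h :* con ½) := (a :* con ½ :+ con 1ℚ) :* h)
      refl (ι n) (½^ n)))
    (*-monoʳ-≤-nonNeg (½^ n) {{nonNegative (<⇒≤ (0<½^ n))}}
      (+-monoˡ-≤ 1ℚ (≤-trans
        (*-monoˡ-≤-nonNeg (ι n) {{nonNegative (0≤ι n)}} (*≤* (ℤ.+≤+ (ℕ.s≤s ℕ.z≤n))))
        (≤-reflexive (*-identityʳ (ι n)))))))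
  (ι*½^≤1 n)

small½^ : ∀ {B ε} → 0ℚ < B → 0ℚ < ε → Eventually (λ n → B * ½^ n < ε)
small½^ {B} {ε} 0<B 0<ε =
  let (C , 0<C , εC≡B) = divide 0<ε 0<B
  in ℤ.∣ ↥ C ∣ , λ n N≤n →
  let open ≤-Reasoning in begin-strict
    B * ½^ n
      ≡⟨ cong (_* ½^ n) (sym εC≡B) ⟩
    ε * C * ½^ n
      ≡⟨ *-assoc ε C (½^ n) ⟩
    ε * (C * ½^ n)
      <⟨ *-monoʳ-<-pos ε {{positive 0<ε}}
          (*-monoˡ-<-pos (½^ n) {{positive (0<½^ n)}} (≤-<-trans
            (≤-trans (p≤ι∣↥p∣ C) (ι-mono N≤n))
            (subst (_< ι n + 1ℚ) (+-identityʳ (ι n)) (+-monoʳ-< (ι n) (positive⁻¹ 1ℚ))))) ⟩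
    ε * ((ι n + 1ℚ) * ½^ n)
      ≤⟨ *-monoˡ-≤-nonNeg ε {{nonNegative (<⇒≤ 0<ε)}} (ι*½^≤1 n) ⟩
    ε * 1ℚ
      ≡⟨ *-identityʳ ε ⟩
    ε ∎

-- n bisection steps for √ a, starting from the interval [ 0 , 1 + a ];
-- the value is the left endpoint of an interval of length (1 + a) / 2ⁿ.
bisect : ℚ → ℕ → ℚ
bisect a zero    = 0ℚ
bisect a (suc n) =
  let mid = bisect a n + (1ℚ + a) * ½^ (suc n)
  in if does (mid * mid ≤? a) then mid else bisect a n

record BisectSpec (a : ℚ) (n : ℕ) (s : ℚ) : Set where
  field
    nonneg : 0ℚ ≤ s
    lower  : s * s ≤ a
    upper  : a < (s + (1ℚ + a) * ½^ n) * (s + (1ℚ + a) * ½^ n)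

bisect-spec : ∀ a n → 0ℚ ≤ a → BisectSpec a n (bisect a n)
bisect-spec a zero 0≤a = record
  { nonneg = ≤-refl
  ; lower  = 0≤a
  ; upper  = subst (a <_)
      (solve 1 (λ a → a :+ (con 1ℚ :+ (a :+ a :* a)) :=
          (con 0ℚ :+ (con 1ℚ :+ a) :* con 1ℚ) :* (con 0ℚ :+ (con 1ℚ :+ a) :* con 1ℚ))
        refl a)
      (subst (_< a + (1ℚ + (a + a * a))) (+-identityʳ a)
        (+-monoʳ-< a (+-mono-<-≤ (positive⁻¹ 1ℚ) (+-mono-≤ 0≤a (0≤* 0≤a 0≤a)))))
  }
bisect-spec a (suc n) 0≤a = step (mid * mid ≤? a)
  where
  ih : BisectSpec a n (bisect a n)
  ih = bisect-spec a n 0≤a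
  mid : ℚ
  mid = bisect a n + (1ℚ + a) * ½^ (suc n)
  0≤1+a : 0ℚ ≤ 1ℚ + a
  0≤1+a = +-mono-≤ (nonNegative⁻¹ 1ℚ) 0≤a
  halves : bisect a n + (1ℚ + a) * ½^ n ≡ mid + (1ℚ + a) * ½^ (suc n)
  halves = solve 3
    (λ s w h → s :+ w :* h := s :+ w :* (h :* con ½) :+ w :* (h :* con ½))
    refl (bisect a n) (1ℚ + a) (½^ n)
  step : (d : Dec (mid * mid ≤ a)) →
    BisectSpec a (suc n) (if does d then mid else bisect a n)
  step (yes mid²≤a) = record
    { nonneg = +-mono-≤ (BisectSpec.nonneg ih) (0≤* 0≤1+a (<⇒≤ (0<½^ (suc n))))
    ; lower  = mid²≤a
    ; upper  = subst (λ t → a < t * t) halves (BisectSpec.upper ih)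
    }
  step (no mid²≰a) = record
    { nonneg = BisectSpec.nonneg ih
    ; lower  = BisectSpec.lower ih
    ; upper  = ≰⇒> mid²≰a
    }

-- If s and t approximate √ a and √ b from below, t to within v ≤ η, and
-- a < b + η², then s < t + 2η.
lower-root-close : ∀ {a b s t v η} → 0ℚ ≤ s → 0ℚ ≤ t → 0ℚ ≤ v → 0ℚ ≤ η →
  s * s ≤ a → b < (t + v) * (t + v) → v ≤ η → a < b + η * η → s < t + (η + η)
lower-root-close {a} {b} {s} {t} {v} {η} 0≤s 0≤t 0≤v 0≤η s²≤a b<t+v² v≤η a<b+η² =
  ≰⇒> λ t+2η≤s → <-irrefl {a} refl (<-≤-trans a<
    (≤-trans (*-mono-nonNeg (+-mono-≤ 0≤t (+-mono-≤ 0≤η 0≤η)) 0≤s t+2η≤s t+2η≤s) s²≤a))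
  where
  rest : ℚ
  rest = t * η + t * η + (η * η + η * η)
  0≤rest : 0ℚ ≤ rest
  0≤rest = +-mono-≤ (+-mono-≤ (0≤* 0≤t 0≤η) (0≤* 0≤t 0≤η))
                    (+-mono-≤ (0≤* 0≤η 0≤η) (0≤* 0≤η 0≤η))
  t+v² : (t + v) * (t + v) ≤ (t + η) * (t + η)
  t+v² = *-mono-nonNeg (+-mono-≤ 0≤t 0≤v) (+-mono-≤ 0≤t 0≤η)
    (+-monoʳ-≤ t v≤η) (+-monoʳ-≤ t v≤η)
  expand : (t + η) * (t + η) + η * η + rest ≡ (t + (η + η)) * (t + (η + η))
  expand = solve 2 (λ t h →
      (t :+ h) :* (t :+ h) :+ h :* h :+ (t :* h :+ t :* h :+ (h :* h :+ h :* h))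
      := (t :+ (h :+ h)) :* (t :+ (h :+ h))) refl t η
  a< : a < (t + (η + η)) * (t + (η + η))
  a< = subst (a <_) expand (subst (_< (t + η) * (t + η) + η * η + rest) (+-identityʳ a)
    (+-mono-<-≤ (<-≤-trans a<b+η² (+-monoˡ-≤ (η * η) (≤-trans (<⇒≤ b<t+v²) t+v²))) 0≤rest))

cauchy-√ : ∀ x → IsCauchy x → IsCauchy (λ n → bisect (x n ⊔ 0ℚ) n)
cauchy-√ x cx ε 0<ε = K ℕ.⊔ L ℕ.⊔ M , λ m n ≤m ≤n →
  ∣p-q∣<r (close m n ≤m ≤n) (close n m ≤n ≤m)
  where
  η : ℚ
  η = ε * ½
  0<η : 0ℚ < η
  0<η = half-pos 0<ε
  bounded : ∃[ B ] (0ℚ < B × Eventually (λ n → ∣ x n ∣ ≤ B))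
  bounded = cauchy⇒bounded cx
  B : ℚ
  B = proj₁ bounded
  0<B : 0ℚ < B
  0<B = proj₁ (proj₂ bounded)
  K L M : ℕ
  K = proj₁ (proj₂ (proj₂ bounded))
  small : Eventually (λ n → (1ℚ + B) * ½^ n < η)
  small = small½^ (+-mono-< (positive⁻¹ 1ℚ) 0<B) 0<η
  L = proj₁ small
  near : ∃[ N ] ∀ m n → N ℕ.≤ m → N ℕ.≤ n → ∣ x m - x n ∣ < η * η
  near = cx (η * η) (pos-* 0<η 0<η)
  M = proj₁ near
  a s w : ℕ → ℚ
  a n = x n ⊔ 0ℚ
  s n = bisect (a n) n
  w n = (1ℚ + a n) * ½^ n
  0≤a : ∀ n → 0ℚ ≤ a n
  0≤a n = p≤q⊔p (x n) 0ℚ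
  spec : ∀ n → BisectSpec (a n) n (s n)
  spec n = bisect-spec (a n) n (0≤a n)
  0≤w : ∀ n → 0ℚ ≤ w n
  0≤w n = 0≤* (+-mono-≤ (nonNegative⁻¹ 1ℚ) (0≤a n)) (<⇒≤ (0<½^ n))
  w≤η : ∀ n → K ℕ.≤ n → L ℕ.≤ n → w n ≤ η
  w≤η n K≤n L≤n = ≤-trans
    (*-monoʳ-≤-nonNeg (½^ n) {{nonNegative (<⇒≤ (0<½^ n))}} (+-monoʳ-≤ 1ℚ
      (⊔-lub (≤-trans (p≤∣p∣ (x n)) (proj₂ (proj₂ (proj₂ bounded)) n K≤n)) (<⇒≤ 0<B))))
    (<⇒≤ (proj₂ small n L≤n))
  close : ∀ m n → K ℕ.⊔ L ℕ.⊔ M ℕ.≤ m → K ℕ.⊔ L ℕ.⊔ M ℕ.≤ n → s m < s n + ε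
  close m n ≤m ≤n = subst (λ t → s m < s n + t) (half+half ε)
    (lower-root-close
      (BisectSpec.nonneg (spec m)) (BisectSpec.nonneg (spec n)) (0≤w n) (<⇒≤ 0<η)
      (BisectSpec.lower (spec m)) (BisectSpec.upper (spec n))
      (w≤η n (ℕP.m⊔n≤o⇒m≤o K L KL≤n) (ℕP.m⊔n≤o⇒n≤o K L KL≤n))
      (≤-<-trans (p⊔0-Lipschitz (x m) (x n))
        (+-monoʳ-< (a n) (proj₂ near m n
          (ℕP.m⊔n≤o⇒n≤o (K ℕ.⊔ L) M ≤m) (ℕP.m⊔n≤o⇒n≤o (K ℕ.⊔ L) M ≤n)))))
    where
    KL≤n : K ℕ.⊔ L ℕ.≤ n
    KL≤n = ℕP.m⊔n≤o⇒m≤o (K ℕ.⊔ L) M ≤n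

----------------------------------------------------------------------
-- ℝ: Cauchy sequences of rationals, with equality _≃_ (a null difference)
-- in place of a quotient.

record ℝ : Set where
  constructor mkℝ
  field
    seq    : ℕ → ℚ
    cauchy : IsCauchy seq
open ℝ public

infix  4 _≃ʳ_ _<ʳ_ _≃ᶜ_
infixl 6 _+ʳ_ _+ᶜ_
infixl 7 _*ʳ_ _*ᶜ_
infix  8 -ʳ_

_≃ʳ_ : ℝ → ℝ → Set
x ≃ʳ y = ∀ ε → 0ℚ < ε → Eventually (λ n → ∣ seq x n - seq y n ∣ < ε)

-- The uniform gap ε makes this the strict order: a termwise _<_ alone
-- would also hold between sequences with the same limit.
_<ʳ_ : ℝ → ℝ → Set
x <ʳ y = ∃[ ε ] (0ℚ < ε × Eventually (λ n → seq x n + ε < seq y n))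

fromℚ : ℚ → ℝ
fromℚ p = mkℝ (λ _ → p) λ ε 0<ε →
  0 , λ _ _ _ _ → subst (_< ε) (sym (cong ∣_∣ (+-inverseʳ p))) 0<ε

fromℤ : ℤ → ℝ
fromℤ i = fromℚ (i / 1)

_+ʳ_ : ℝ → ℝ → ℝ
x +ʳ y = mkℝ (λ n → seq x n + seq y n) (cauchy-+ (seq x) (seq y) (cauchy x) (cauchy y))

-ʳ_ : ℝ → ℝ
-ʳ x = mkℝ (λ n → - seq x n) (cauchy-neg (seq x) (cauchy x))

_*ʳ_ : ℝ → ℝ → ℝ
x *ʳ y = mkℝ (λ n → seq x n * seq y n) (cauchy-* (seq x) (seq y) (cauchy x) (cauchy y))

-- The square root of max(x, 0); it is only applied to sums of squares.
√_ : ℝ → ℝ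
√ x = mkℝ (λ n → bisect (seq x n ⊔ 0ℚ) n) (cauchy-√ (seq x) (cauchy x))

record ℂ : Set where
  constructor _+i_
  field
    re im : ℝ
open ℂ public

_≃ᶜ_ : ℂ → ℂ → Set
z ≃ᶜ w = re z ≃ʳ re w × im z ≃ʳ im w

fromℝ : ℝ → ℂ
fromℝ x = x +i fromℚ 0ℚ

_+ᶜ_ : ℂ → ℂ → ℂ
z +ᶜ w = (re z +ʳ re w) +i (im z +ʳ im w)

_*ᶜ_ : ℂ → ℂ → ℂ
z *ᶜ w = (re z *ʳ re w +ʳ -ʳ (im z *ʳ im w)) +i (re z *ʳ im w +ʳ im z *ʳ re w)

modulus : ℂ → ℝ
modulus z = √ (re z *ʳ re z +ʳ im z *ʳ im z)

IsReal : ℂ → Set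
IsReal z = im z ≃ʳ fromℚ 0ℚ

----------------------------------------------------------------------

-- c₀ ∷ … ∷ cₙ₋₁ ∷ [] stands for c₀ + c₁ X + … + cₙ₋₁ Xⁿ⁻¹ + Xⁿ: the leading
-- coefficient 1 is not stored.
MonicPoly : Set → ℕ → Set
MonicPoly A n = Vec A n

eval : ∀ {n} → MonicPoly ℚ n → ℂ → ℂ
eval []       z = fromℝ (fromℚ 1ℚ)
eval (c ∷ cs) z = fromℝ (fromℚ c) +ᶜ z *ᶜ eval cs z

IsRoot : ∀ {n} → MonicPoly ℚ n → ℂ → Set
IsRoot f z = eval f z ≃ᶜ fromℝ (fromℚ 0ℚ)

IsAlgebraicInteger : ℝ → Set
IsAlgebraicInteger q =
  ∃[ n ] Σ[ f ∈ MonicPoly ℤ n ] IsRoot (map (_/ 1) f) (fromℝ q)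

-- The monic rational polynomial of least degree that vanishes at q.
record IsMinimalPolynomial (q : ℝ) {n : ℕ} (f : MonicPoly ℚ n) : Set where
  field
    root  : IsRoot f (fromℝ q)
    least : ∀ {k} (g : MonicPoly ℚ k) → IsRoot g (fromℝ q) → n ℕ.≤ k

-- Includes z = q itself.
IsGaloisConjugate : ℝ → ℂ → Set
IsGaloisConjugate q z =
  ∃[ n ] Σ[ f ∈ MonicPoly ℚ n ] (IsMinimalPolynomial q f × IsRoot f z)

record IsPisot (q : ℝ) : Set where
  field
    algebraicInteger : IsAlgebraicInteger q
    1<q              : fromℚ 1ℚ <ʳ q
    conjugates       : ∀ z → IsGaloisConjugate q z → ¬ (z ≃ᶜ fromℝ q) →
                       modulus z <ʳ fromℚ 1ℚ

m+½-pos : ∀ m → Positive (+ m / 1 + ½)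
m+½-pos m = nonNeg+pos⇒pos (+ m / 1) {{normalize-nonNeg m 1}} ½

-- 1 / (m + 1/2)
radius : ℕ → ℝ
radius m = fromℚ ((1/ (+ m / 1 + ½)) {{pos⇒nonZero (+ m / 1 + ½) {{m+½-pos m}}}})

{-# OPTIONS --safe #-}
-- If z and w are different conjugates of q in the disc of radius 1/(m + 1/2),
-- then |q z w| < (m + 1)/(m + 1/2)² < 1, while the constant term of the minimal
-- polynomial f of q is a nonzero integer by Gauss's lemma. So f has a further
-- root outside the unit disc, and q is not a Pisot number. A non-real z is
-- treated by taking w to be its complex conjugate.
--
-- The further root has to be constructed. This is done over the Gaussian
-- rationals: if a monic polynomial P were bounded away from 0, then zⁿ⁻¹/P(z)
-- would contradict a discrete form of Cauchy's theorem, so P has approximate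
-- roots; dividing them out one by one shows that a small value of P at x forces
-- an approximate root near x, and iterating this yields a Cauchy sequence.
module Submission where

open import Algebra.Bundles using (CommutativeRing)
import Algebra.Solver.Ring.AlmostCommutativeRing as ACR
import Algebra.Solver.Ring.Simple as RingSolver
open import Algebra.Structures using (IsCommutativeRing)
open import Data.Empty using (⊥-elim)
open import Data.Integer.Base as ℤ using (ℤ; +_; 0ℤ; 1ℤ)
open import Data.Integer.Divisibility.Signed as ℤD
  using (divides) renaming (_∣_ to _∣ℤ_; _∣?_ to _∣ℤ?_)
import Data.Integer.Properties as ℤP
import Data.Integer.Solver as ℤSolver
open import Data.List.Base as List using (List; []; _∷_)
open import Data.List.Membership.Propositional using (_∈_)
open import Data.List.Membership.Propositional.Properties using (∈-map⁺; ∈-map⁻)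
open import Data.List.Relation.Unary.All as All using (All; []; _∷_)
open import Data.List.Relation.Unary.All.Properties using (map⁺)
open import Data.List.Relation.Unary.Any using (here; there)
open import Data.Nat.Base as ℕ using (ℕ; zero; suc)
import Data.Nat.Divisibility as ℕD
open import Data.Nat.ListAction using (product)
open import Data.Nat.Primality using (Prime; euclidsLemma; prime⇒nonZero)
open import Data.Nat.Primality.Factorisation using (PrimeFactorisation; factorise)
import Data.Nat.Properties as ℕP
open import Data.Product.Base using (Σ-syntax; ∃-syntax; _×_; _,_; proj₁; proj₂)
open import Data.Rational.Base
open import Data.Rational.Properties
open import Data.Rational.Solver using (module +-*-Solver)
open import Data.Rational.Unnormalised.Base as ℚᵘ using (mkℚᵘ)
import Data.Rational.Unnormalised.Properties as ℚᵘP
open import Data.Sum.Base using (_⊎_; inj₁; inj₂)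
open import Data.Vec.Base as Vec using (Vec; []; _∷_; last; replicate; toList; zipWith)
open import Function.Base using (case_of_)
open import Level using (0ℓ)
open import Relation.Binary.PropositionalEquality hiding (J)
open import Relation.Nullary using (¬_; Dec; yes; no)
open import Relation.Nullary.Decidable using (map′; _×-dec_)
open import Defs

open +-*-Solver using (solve; con; _:=_; _:+_; _:*_; _:-_; :-_)
open ℤSolver.+-*-Solver using () renaming
  (solve to solveℤ; con to conℤ; _:=_ to _:=ℤ_; _:+_ to _:+ℤ_; _:*_ to _:*ℤ_)

-- Gaussian rationals

-- Vieta's formula would need all roots of f at once. Instead f is divided, at each index k, by X -
-- q k, X - z k and X - w k for Gaussian rational approximations of the three roots. The remainders
-- are null, but the quotient is a different polynomial for each k: bounds have to be uniform in k,
-- and the root picked at index k may jump between distinct roots as k grows. Convergence is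
-- therefore restored only at the end, by refining the root picked at one late index. Equality of
-- reals is not decidable. Being different is carried by the positive notion `Away`, whereas
-- `z ≃ᶜ w` already follows when `Away` is impossible. Hence the argument may assume z and w apart
-- and aim at a contradiction, inside which double negations can be opened. The quantity (m + 1)/(m
-- + 1/2)² is largest at m = 1, with value 8/9. Sizes are compared through squared moduli, which
-- stay rational, so the working constant is 64/81.

≤-cert : ∀ {p q} s → 0ℚ ≤ s → p + s ≡ q → p ≤ q
≤-cert {p} s 0≤s eq = subst₂ _≤_ (+-identityʳ p) eq (+-monoʳ-≤ p 0≤s)

-- As with `≤-cert`, an inequality is split into an explicit slack `s` and a ring identity left to
-- the solver. The slacks below are sums of products of quantities known to be nonnegative.
<-cert : ∀ {p q} s → 0ℚ < s → p + s ≡ q → p < q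
<-cert {p} s 0<s eq = subst₂ _<_ (+-identityʳ p) eq (+-monoʳ-< p 0<s)

p≤q⇒0≤q-p : ∀ {p q} → p ≤ q → 0ℚ ≤ q - p
p≤q⇒0≤q-p {p} {q} p≤q = subst (_≤ q - p) (+-inverseʳ p) (+-monoˡ-≤ (- p) p≤q)

p<q⇒0<q-p : ∀ {p q} → p < q → 0ℚ < q - p
p<q⇒0<q-p {p} {q} p<q = subst (_< q - p) (+-inverseʳ p) (+-monoˡ-< (- p) p<q)

-p≤∣p∣ : ∀ p → - p ≤ ∣ p ∣
-p≤∣p∣ p = subst (- p ≤_) (∣-p∣≡∣p∣ p) (p≤∣p∣ (- p))

0≤p² : ∀ p → 0ℚ ≤ p * p
0≤p² p with ≤-total 0ℚ p
... | inj₁ 0≤p = 0≤* 0≤p 0≤p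
... | inj₂ p≤0 = subst (0ℚ ≤_) (solve 1 (λ p → (:- p) :* (:- p) := p :* p) refl p)
  (0≤* (neg-antimono-≤ p≤0) (neg-antimono-≤ p≤0))

∣p∣²≡p² : ∀ p → ∣ p ∣ * ∣ p ∣ ≡ p * p
∣p∣²≡p² p = trans (sym (∣p*q∣≡∣p∣*∣q∣ p p)) (0≤p⇒∣p∣≡p (0≤p² p))

+-nonneg : ∀ {p q} → 0ℚ ≤ p → 0ℚ ≤ q → 0ℚ ≤ p + q
+-nonneg = +-mono-≤

p≤p+q : ∀ {p q} → 0ℚ ≤ q → p ≤ p + q
p≤p+q {p} {q} 0≤q = ≤-cert q 0≤q refl

p≤q+p : ∀ {p q} → 0ℚ ≤ q → p ≤ q + p
p≤q+p {p} {q} 0≤q = ≤-cert q 0≤q (+-comm p q)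

-- 𝔾 has no eta and the norms below are opaque, so that unification does not
-- unfold arithmetic on open terms.
record 𝔾 : Set where
  no-eta-equality
  pattern
  constructor ⟨_,_⟩
  field
    Re Im : ℚ
open 𝔾 public

infixl 6 _+ᵍ_ _-ᵍ_
infixl 7 _*ᵍ_

_+ᵍ_ _*ᵍ_ : 𝔾 → 𝔾 → 𝔾
⟨ a , b ⟩ +ᵍ ⟨ c , d ⟩ = ⟨ a + c , b + d ⟩
⟨ a , b ⟩ *ᵍ ⟨ c , d ⟩ = ⟨ a * c + - (b * d) , a * d + b * c ⟩

negᵍ : 𝔾 → 𝔾
negᵍ ⟨ a , b ⟩ = ⟨ - a , - b ⟩

_-ᵍ_ : 𝔾 → 𝔾 → 𝔾
u -ᵍ v = u +ᵍ negᵍ v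

0ᵍ 1ᵍ : 𝔾
0ᵍ = ⟨ 0ℚ , 0ℚ ⟩
1ᵍ = ⟨ 1ℚ , 0ℚ ⟩

fromℚᵍ : ℚ → 𝔾
fromℚᵍ p = ⟨ p , 0ℚ ⟩

private
  *ᵍ-assoc : ∀ u v w → (u *ᵍ v) *ᵍ w ≡ u *ᵍ (v *ᵍ w)
  *ᵍ-assoc ⟨ a , b ⟩ ⟨ c , d ⟩ ⟨ e , f ⟩ = cong₂ ⟨_,_⟩
    (solve 6 (λ a b c d e f →
      (a :* c :+ :- (b :* d)) :* e :+ :- ((a :* d :+ b :* c) :* f) :=
      a :* (c :* e :+ :- (d :* f)) :+ :- (b :* (c :* f :+ d :* e))) refl a b c d e f)
    (solve 6 (λ a b c d e f →
      (a :* c :+ :- (b :* d)) :* f :+ (a :* d :+ b :* c) :* e :=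
      a :* (c :* f :+ d :* e) :+ b :* (c :* e :+ :- (d :* f))) refl a b c d e f)

  *ᵍ-comm : ∀ u v → u *ᵍ v ≡ v *ᵍ u
  *ᵍ-comm ⟨ a , b ⟩ ⟨ c , d ⟩ = cong₂ ⟨_,_⟩
    (solve 4 (λ a b c d → a :* c :+ :- (b :* d) := c :* a :+ :- (d :* b)) refl a b c d)
    (solve 4 (λ a b c d → a :* d :+ b :* c := c :* b :+ d :* a) refl a b c d)

  *ᵍ-identityˡ : ∀ u → 1ᵍ *ᵍ u ≡ u
  *ᵍ-identityˡ ⟨ a , b ⟩ = cong₂ ⟨_,_⟩
    (solve 2 (λ a b → con 1ℚ :* a :+ :- (con 0ℚ :* b) := a) refl a b)
    (solve 2 (λ a b → con 1ℚ :* b :+ con 0ℚ :* a := b) refl a b)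

  *ᵍ-distribˡ-+ᵍ : ∀ u v w → u *ᵍ (v +ᵍ w) ≡ u *ᵍ v +ᵍ u *ᵍ w
  *ᵍ-distribˡ-+ᵍ ⟨ a , b ⟩ ⟨ c , d ⟩ ⟨ e , f ⟩ = cong₂ ⟨_,_⟩
    (solve 6 (λ a b c d e f →
      a :* (c :+ e) :+ :- (b :* (d :+ f)) :=
      a :* c :+ :- (b :* d) :+ (a :* e :+ :- (b :* f))) refl a b c d e f)
    (solve 6 (λ a b c d e f →
      a :* (d :+ f) :+ b :* (c :+ e) :=
      a :* d :+ b :* c :+ (a :* f :+ b :* e)) refl a b c d e f)

+ᵍ-*ᵍ-isCommutativeRing : IsCommutativeRing _≡_ _+ᵍ_ _*ᵍ_ negᵍ 0ᵍ 1ᵍ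
+ᵍ-*ᵍ-isCommutativeRing = record
  { isRing = record
    { +-isAbelianGroup = record
      { isGroup = record
        { isMonoid = record
          { isSemigroup = record
            { isMagma = record { isEquivalence = isEquivalence ; ∙-cong = cong₂ _+ᵍ_ }
            ; assoc = λ { ⟨ a , b ⟩ ⟨ c , d ⟩ ⟨ e , f ⟩ →
                cong₂ ⟨_,_⟩ (+-assoc a c e) (+-assoc b d f) }
            }
          ; identity = (λ { ⟨ a , b ⟩ → cong₂ ⟨_,_⟩ (+-identityˡ a) (+-identityˡ b) })
                     , (λ { ⟨ a , b ⟩ → cong₂ ⟨_,_⟩ (+-identityʳ a) (+-identityʳ b) })
          }
        ; inverse = (λ { ⟨ a , b ⟩ → cong₂ ⟨_,_⟩ (+-inverseˡ a) (+-inverseˡ b) })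
                  , (λ { ⟨ a , b ⟩ → cong₂ ⟨_,_⟩ (+-inverseʳ a) (+-inverseʳ b) })
        ; ⁻¹-cong = cong negᵍ
        }
      ; comm = λ { ⟨ a , b ⟩ ⟨ c , d ⟩ → cong₂ ⟨_,_⟩ (+-comm a c) (+-comm b d) }
      }
    ; *-cong = cong₂ _*ᵍ_
    ; *-assoc = *ᵍ-assoc
    ; *-identity = *ᵍ-identityˡ , λ u → trans (*ᵍ-comm u 1ᵍ) (*ᵍ-identityˡ u)
    ; distrib = *ᵍ-distribˡ-+ᵍ , λ u v w → trans (*ᵍ-comm (v +ᵍ w) u)
        (trans (*ᵍ-distribˡ-+ᵍ u v w) (cong₂ _+ᵍ_ (*ᵍ-comm u v) (*ᵍ-comm u w)))
    }
  ; *-comm = *ᵍ-comm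
  }

𝔾-commutativeRing : CommutativeRing 0ℓ 0ℓ
𝔾-commutativeRing = record { isCommutativeRing = +ᵍ-*ᵍ-isCommutativeRing }

_≟ᵍ_ : (u v : 𝔾) → Dec (u ≡ v)
⟨ a , b ⟩ ≟ᵍ ⟨ c , d ⟩ = map′ (λ (p , q) → cong₂ ⟨_,_⟩ p q)
  (λ p → cong Re p , cong Im p) (a ≟ c ×-dec b ≟ d)

module 𝔾-Solver = RingSolver (ACR.fromCommutativeRing 𝔾-commutativeRing) _≟ᵍ_

open 𝔾-Solver using () renaming
  (solve to solveᵍ; con to conᵍ; _:=_ to _:=ᵍ_; _:+_ to _:+ᵍ_; _:*_ to _:*ᵍ_; _:-_ to _:-ᵍ_; :-_ to :-ᵍ_)

infix 9 ∥_∥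

opaque
  -- Two rational substitutes for the modulus, which is irrational in general: `∥_∥` satisfies the
  -- triangle inequality, and `N`, the squared modulus, is multiplicative. `N≤∥∥²` and `∥∥²≤2N`
  -- translate between them at the cost of a factor 2.
  ∥_∥ N : 𝔾 → ℚ
  ∥ ⟨ a , b ⟩ ∥ = ∣ a ∣ + ∣ b ∣
  N ⟨ a , b ⟩   = a * a + b * b

  ∥⟨,⟩∥ : ∀ a b → ∥ ⟨ a , b ⟩ ∥ ≡ ∣ a ∣ + ∣ b ∣
  ∥⟨,⟩∥ a b = refl

  N⟨,⟩ : ∀ a b → N ⟨ a , b ⟩ ≡ a * a + b * b
  N⟨,⟩ a b = refl

  ∥1ᵍ∥ : ∥ 1ᵍ ∥ ≡ 1ℚ
  ∥1ᵍ∥ = refl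

  ∥0ᵍ∥ : ∥ 0ᵍ ∥ ≡ 0ℚ
  ∥0ᵍ∥ = refl

  0≤∥u∥ : ∀ u → 0ℚ ≤ ∥ u ∥
  0≤∥u∥ ⟨ a , b ⟩ = +-nonneg (0≤∣p∣ a) (0≤∣p∣ b)

  ∣Re∣≤∥∥ : ∀ u → ∣ Re u ∣ ≤ ∥ u ∥
  ∣Re∣≤∥∥ ⟨ a , b ⟩ = p≤p+q (0≤∣p∣ b)

  ∣Im∣≤∥∥ : ∀ u → ∣ Im u ∣ ≤ ∥ u ∥
  ∣Im∣≤∥∥ ⟨ a , b ⟩ = p≤q+p (0≤∣p∣ a)

  ∥fromℚᵍ∥ : ∀ p → ∥ fromℚᵍ p ∥ ≡ ∣ p ∣
  ∥fromℚᵍ∥ p = +-identityʳ ∣ p ∣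

  ∥u+v∥≤ : ∀ u v → ∥ u +ᵍ v ∥ ≤ ∥ u ∥ + ∥ v ∥
  ∥u+v∥≤ ⟨ a , b ⟩ ⟨ c , d ⟩ = ≤-trans (+-mono-≤ (∣p+q∣≤∣p∣+∣q∣ a c) (∣p+q∣≤∣p∣+∣q∣ b d))
    (≤-reflexive (solve 4 (λ a b c d → a :+ c :+ (b :+ d) := a :+ b :+ (c :+ d)) refl
      (∣ a ∣) (∣ b ∣) (∣ c ∣) (∣ d ∣)))

  ∥-u∥≡ : ∀ u → ∥ negᵍ u ∥ ≡ ∥ u ∥
  ∥-u∥≡ ⟨ a , b ⟩ = cong₂ _+_ (∣-p∣≡∣p∣ a) (∣-p∣≡∣p∣ b)

  ∥u-v∥≤ : ∀ u v → ∥ u -ᵍ v ∥ ≤ ∥ u ∥ + ∥ v ∥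
  ∥u-v∥≤ u v = subst (λ t → ∥ u -ᵍ v ∥ ≤ ∥ u ∥ + t) (∥-u∥≡ v) (∥u+v∥≤ u (negᵍ v))

  ∥u-v∥-sym : ∀ u v → ∥ u -ᵍ v ∥ ≡ ∥ v -ᵍ u ∥
  ∥u-v∥-sym u v = trans (sym (∥-u∥≡ (u -ᵍ v)))
    (cong ∥_∥ (solveᵍ 2 (λ u v → :-ᵍ (u :-ᵍ v) :=ᵍ v :-ᵍ u) refl u v))

  ∥u*v∥≤ : ∀ u v → ∥ u *ᵍ v ∥ ≤ ∥ u ∥ * ∥ v ∥
  ∥u*v∥≤ ⟨ a , b ⟩ ⟨ c , d ⟩ = ≤-trans
    (+-mono-≤ (∣p-q∣≤∣p∣+∣q∣ (a * c) (b * d)) (∣p+q∣≤∣p∣+∣q∣ (a * d) (b * c)))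
    (≤-reflexive (trans
      (cong₂ _+_ (cong₂ _+_ (∣p*q∣≡∣p∣*∣q∣ a c) (∣p*q∣≡∣p∣*∣q∣ b d))
                 (cong₂ _+_ (∣p*q∣≡∣p∣*∣q∣ a d) (∣p*q∣≡∣p∣*∣q∣ b c)))
      (solve 4 (λ a b c d → a :* c :+ b :* d :+ (a :* d :+ b :* c) := (a :+ b) :* (c :+ d))
        refl (∣ a ∣) (∣ b ∣) (∣ c ∣) (∣ d ∣))))

  ∥u∥≤∥v∥+∥u-v∥ : ∀ u v → ∥ u ∥ ≤ ∥ v ∥ + ∥ u -ᵍ v ∥
  ∥u∥≤∥v∥+∥u-v∥ u v = subst (λ t → ∥ t ∥ ≤ ∥ v ∥ + ∥ u -ᵍ v ∥)
    (solveᵍ 2 (λ u v → v :+ᵍ (u :-ᵍ v) :=ᵍ u) refl u v) (∥u+v∥≤ v (u -ᵍ v))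

  0≤N : ∀ u → 0ℚ ≤ N u
  0≤N ⟨ a , b ⟩ = +-nonneg (0≤p² a) (0≤p² b)

  N-* : ∀ u v → N (u *ᵍ v) ≡ N u * N v
  N-* ⟨ a , b ⟩ ⟨ c , d ⟩ = solve 4 (λ a b c d →
      (a :* c :+ :- (b :* d)) :* (a :* c :+ :- (b :* d)) :+ (a :* d :+ b :* c) :* (a :* d :+ b :* c)
      := (a :* a :+ b :* b) :* (c :* c :+ d :* d)) refl a b c d

  N≤∥∥² : ∀ u → N u ≤ ∥ u ∥ * ∥ u ∥
  N≤∥∥² ⟨ a , b ⟩ = ≤-cert (∣ a ∣ * ∣ b ∣ + ∣ a ∣ * ∣ b ∣)
    (+-nonneg 0≤ab 0≤ab)
    (trans (cong₂ (λ s t → s + t + (∣ a ∣ * ∣ b ∣ + ∣ a ∣ * ∣ b ∣)) (sym (∣p∣²≡p² a)) (sym (∣p∣²≡p² b)))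
      (solve 2 (λ a b → a :* a :+ b :* b :+ (a :* b :+ a :* b) := (a :+ b) :* (a :+ b)) refl (∣ a ∣) (∣ b ∣)))
    where
    0≤ab : 0ℚ ≤ ∣ a ∣ * ∣ b ∣
    0≤ab = 0≤* (0≤∣p∣ a) (0≤∣p∣ b)

  ∥∥²≤2N : ∀ u → ∥ u ∥ * ∥ u ∥ ≤ N u + N u
  ∥∥²≤2N ⟨ a , b ⟩ = ≤-cert ((∣ a ∣ - ∣ b ∣) * (∣ a ∣ - ∣ b ∣)) (0≤p² (∣ a ∣ - ∣ b ∣))
    (trans
      (solve 2 (λ a b → (a :+ b) :* (a :+ b) :+ (a :- b) :* (a :- b) :=
         a :* a :+ b :* b :+ (a :* a :+ b :* b)) refl (∣ a ∣) (∣ b ∣))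
      (cong (λ t → t + t) (cong₂ _+_ (∣p∣²≡p² a) (∣p∣²≡p² b))))

-- Approximate roots: a discrete Cauchy theorem

ev : ∀ {n} → Vec 𝔾 n → 𝔾 → 𝔾
ev []       z = 1ᵍ
ev (c ∷ cs) z = c +ᵍ z *ᵍ ev cs z

+-bound : ∀ {u v A B} → ∥ u ∥ ≤ A → ∥ v ∥ ≤ B → ∥ u +ᵍ v ∥ ≤ A + B
+-bound {u} {v} p q = ≤-trans (∥u+v∥≤ u v) (+-mono-≤ p q)

neg-bound : ∀ {u A} → ∥ u ∥ ≤ A → ∥ negᵍ u ∥ ≤ A
neg-bound {u} p = subst (_≤ _) (sym (∥-u∥≡ u)) p

*-bound : ∀ {u v A B} → ∥ u ∥ ≤ A → ∥ v ∥ ≤ B → ∥ u *ᵍ v ∥ ≤ A * B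
*-bound {u} {v} p q = ≤-trans (∥u*v∥≤ u v)
  (*-mono-nonNeg (0≤∥u∥ v) (≤-trans (0≤∥u∥ u) p) p q)

0≡∥u∥ : ∀ {u} → u ≡ 0ᵍ → 0ℚ ≡ ∥ u ∥
0≡∥u∥ u≡0 = trans (sym ∥0ᵍ∥) (cong ∥_∥ (sym u≡0))

-- Holomorphy in quantitative form, with one constant for all estimates. The conditions concern
-- pairs of points of `D` only, so `D` may be any set, for instance one that contains just some
-- points of a grid. The bound and the Lipschitz estimate are what products and inverses need to
-- inherit the Taylor estimate.
record Smooth (K : ℚ) (D : 𝔾 → Set) (F F′ : 𝔾 → 𝔾) : Set where
  field
    0≤K       : 0ℚ ≤ K
    bound     : ∀ {z} → D z → ∥ F z ∥ ≤ K
    bound′    : ∀ {z} → D z → ∥ F′ z ∥ ≤ K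
    lipschitz : ∀ {z w} → D z → D w → ∥ F w -ᵍ F z ∥ ≤ K * ∥ w -ᵍ z ∥
    taylor    : ∀ {z w} → D z → D w →
      ∥ F w -ᵍ F z -ᵍ (w -ᵍ z) *ᵍ F′ z ∥ ≤ K * (∥ w -ᵍ z ∥ * ∥ w -ᵍ z ∥)

smooth-restrict : ∀ {K D D₀ F F′} → (∀ {z} → D₀ z → D z) → Smooth K D F F′ → Smooth K D₀ F F′
smooth-restrict D₀⊆D s = record
  { 0≤K = 0≤K ; bound = λ d → bound (D₀⊆D d) ; bound′ = λ d → bound′ (D₀⊆D d)
  ; lipschitz = λ d e → lipschitz (D₀⊆D d) (D₀⊆D e)
  ; taylor = λ d e → taylor (D₀⊆D d) (D₀⊆D e) }
  where open Smooth s

smooth-const : ∀ {D} c → Smooth ∥ c ∥ D (λ _ → c) (λ _ → 0ᵍ)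
smooth-const c = record
  { 0≤K = 0≤∥u∥ c ; bound = λ _ → ≤-refl ; bound′ = λ _ → subst (_≤ ∥ c ∥) (sym ∥0ᵍ∥) (0≤∥u∥ c)
  ; lipschitz = λ {z} {w} _ _ → subst (_≤ ∥ c ∥ * ∥ w -ᵍ z ∥)
      (0≡∥u∥ (solveᵍ 1 (λ c → c :-ᵍ c :=ᵍ conᵍ 0ᵍ) refl c)) (0≤* (0≤∥u∥ c) (0≤∥u∥ (w -ᵍ z)))
  ; taylor = λ {z} {w} _ _ → subst (_≤ ∥ c ∥ * (∥ w -ᵍ z ∥ * ∥ w -ᵍ z ∥))
      (0≡∥u∥ (solveᵍ 2 (λ c d → c :-ᵍ c :-ᵍ d :*ᵍ conᵍ 0ᵍ :=ᵍ conᵍ 0ᵍ) refl c (w -ᵍ z)))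
      (0≤* (0≤∥u∥ c) (0≤* (0≤∥u∥ (w -ᵍ z)) (0≤∥u∥ (w -ᵍ z))))
  }

smooth-id : ∀ {R} → 0ℚ ≤ R → Smooth (R + 1ℚ) (λ z → ∥ z ∥ ≤ R) (λ z → z) (λ _ → 1ᵍ)
smooth-id {R} 0≤R = record
  { 0≤K = 0≤R+1
  ; bound = λ d → ≤-trans d (p≤p+q (nonNegative⁻¹ 1ℚ))
  ; bound′ = λ _ → ≤-trans (≤-reflexive ∥1ᵍ∥) (p≤q+p 0≤R)
  ; lipschitz = λ {z} {w} _ _ → subst (_≤ (R + 1ℚ) * ∥ w -ᵍ z ∥) (*-identityˡ ∥ w -ᵍ z ∥)
      (*-monoʳ-≤-nonNeg ∥ w -ᵍ z ∥ {{nonNegative (0≤∥u∥ (w -ᵍ z))}} (p≤q+p 0≤R))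
  ; taylor = λ {z} {w} _ _ → subst (_≤ (R + 1ℚ) * (∥ w -ᵍ z ∥ * ∥ w -ᵍ z ∥))
      (0≡∥u∥ (solveᵍ 2 (λ w z → w :-ᵍ z :-ᵍ (w :-ᵍ z) :*ᵍ conᵍ 1ᵍ :=ᵍ conᵍ 0ᵍ) refl w z))
      (0≤* 0≤R+1 (0≤* (0≤∥u∥ (w -ᵍ z)) (0≤∥u∥ (w -ᵍ z))))
  }
  where
  0≤R+1 : 0ℚ ≤ R + 1ℚ
  0≤R+1 = +-nonneg 0≤R (nonNegative⁻¹ 1ℚ)

smooth-+ : ∀ {A B D F F′ G G′} → Smooth A D F F′ → Smooth B D G G′ →
  Smooth (A + B) D (λ z → F z +ᵍ G z) (λ z → F′ z +ᵍ G′ z)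
smooth-+ {A} {B} {F = F} {F′} {G} {G′} s t = record
  { 0≤K = +-nonneg S.0≤K T.0≤K
  ; bound = λ d → +-bound (S.bound d) (T.bound d)
  ; bound′ = λ d → +-bound (S.bound′ d) (T.bound′ d)
  ; lipschitz = λ {z} {w} d e → subst₂ (λ u r → ∥ u ∥ ≤ r)
      (solveᵍ 4 (λ a b c d → (a :-ᵍ b) :+ᵍ (c :-ᵍ d)
        :=ᵍ (a :+ᵍ c) :-ᵍ (b :+ᵍ d)) refl (F w) (F z) (G w) (G z))
      (sym (*-distribʳ-+ ∥ w -ᵍ z ∥ A B))
      (+-bound (S.lipschitz d e) (T.lipschitz d e))
  ; taylor = λ {z} {w} d e → subst₂ (λ u r → ∥ u ∥ ≤ r)
      (rearrange (F w) (F z) (G w) (G z) (w -ᵍ z) (F′ z) (G′ z))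
      (sym (*-distribʳ-+ (∥ w -ᵍ z ∥ * ∥ w -ᵍ z ∥) A B))
      (+-bound (S.taylor d e) (T.taylor d e))
  }
  where
  module S = Smooth s
  module T = Smooth t
  rearrange : ∀ a b c d h p q → (a -ᵍ b -ᵍ h *ᵍ p) +ᵍ (c -ᵍ d -ᵍ h *ᵍ q)
    ≡ (a +ᵍ c) -ᵍ (b +ᵍ d) -ᵍ h *ᵍ (p +ᵍ q)
  rearrange = solveᵍ 7 (λ a b c d h p q → (a :-ᵍ b :-ᵍ h :*ᵍ p) :+ᵍ (c :-ᵍ d :-ᵍ h :*ᵍ q)
    :=ᵍ (a :+ᵍ c) :-ᵍ (b :+ᵍ d) :-ᵍ h :*ᵍ (p :+ᵍ q)) refl

smooth-* : ∀ {A B D F F′ G G′} → Smooth A D F F′ → Smooth B D G G′ →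
  Smooth (A * B + A * B + A * B) D (λ z → F z *ᵍ G z) (λ z → F′ z *ᵍ G z +ᵍ F z *ᵍ G′ z)
smooth-* {A} {B} {F = F} {F′} {G} {G′} s t = record
  { 0≤K = +-nonneg (+-nonneg 0≤AB 0≤AB) 0≤AB
  ; bound = λ d → ≤-trans (*-bound (S.bound d) (T.bound d)) (p≤q+p (+-nonneg 0≤AB 0≤AB))
  ; bound′ = λ d → ≤-trans (+-bound (*-bound (S.bound′ d) (T.bound d)) (*-bound (S.bound d) (T.bound′ d)))
      (p≤p+q 0≤AB)
  ; lipschitz = λ {z} {w} d e → ≤-trans
      (subst₂ (λ u r → ∥ u ∥ ≤ r)
        (solveᵍ 4 (λ a b c d → (a :-ᵍ b) :*ᵍ c :+ᵍ b :*ᵍ (c :-ᵍ d) :=ᵍ a :*ᵍ c :-ᵍ b :*ᵍ d)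
          refl (F w) (F z) (G w) (G z))
        (solve 3 (λ a b h → a :* h :* b :+ a :* (b :* h) := (a :* b :+ a :* b) :* h)
          refl A B ∥ w -ᵍ z ∥)
        (+-bound (*-bound (S.lipschitz d e) (T.bound e)) (*-bound (S.bound d) (T.lipschitz d e))))
      (*-monoʳ-≤-nonNeg ∥ w -ᵍ z ∥ {{nonNegative (0≤∥u∥ (w -ᵍ z))}} (p≤p+q {A * B + A * B} 0≤AB))
  ; taylor = λ {z} {w} d e → subst₂ (λ u r → ∥ u ∥ ≤ r)
      (rearrange (F w) (F z) (G w) (G z) (w -ᵍ z) (F′ z) (G′ z))
      (solve 3 (λ a b h → a :* (h :* h) :* b :+ h :* a :* (b :* h) :+ a :* (b :* (h :* h))
         := (a :* b :+ a :* b :+ a :* b) :* (h :* h)) refl A B ∥ w -ᵍ z ∥)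
      (+-bound
        (+-bound (*-bound (S.taylor d e) (T.bound e))
          (*-bound (*-bound (≤-refl {∥ w -ᵍ z ∥}) (S.bound′ d)) (T.lipschitz d e)))
        (*-bound (S.bound d) (T.taylor d e)))
  }
  where
  module S = Smooth s
  module T = Smooth t
  0≤AB : 0ℚ ≤ A * B
  0≤AB = 0≤* S.0≤K T.0≤K
  rearrange : ∀ a b c d h p q → (a -ᵍ b -ᵍ h *ᵍ p) *ᵍ c +ᵍ h *ᵍ p *ᵍ (c -ᵍ d) +ᵍ b *ᵍ (c -ᵍ d -ᵍ h *ᵍ q)
    ≡ a *ᵍ c -ᵍ b *ᵍ d -ᵍ h *ᵍ (p *ᵍ d +ᵍ b *ᵍ q)
  rearrange = solveᵍ 7 (λ a b c d h p q →
    (a :-ᵍ b :-ᵍ h :*ᵍ p) :*ᵍ c :+ᵍ h :*ᵍ p :*ᵍ (c :-ᵍ d) :+ᵍ b :*ᵍ (c :-ᵍ d :-ᵍ h :*ᵍ q)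
    :=ᵍ a :*ᵍ c :-ᵍ b :*ᵍ d :-ᵍ h :*ᵍ (p :*ᵍ d :+ᵍ b :*ᵍ q)) refl

-- Everything follows from U w - U z = - U w U z (Q w - Q z). The Taylor remainder of U splits into
-- that of Q and the error of replacing one factor U w by U z.
smooth-inverse : ∀ {K E D Q Q′ U} → Smooth K D Q Q′ → 0ℚ ≤ E →
  (∀ {z} → D z → Q z *ᵍ U z ≡ 1ᵍ) → (∀ {z} → D z → ∥ U z ∥ ≤ E) →
  Smooth (E + (E * E * K + K * E * (E * E * K))) D U (λ z → negᵍ (Q′ z *ᵍ (U z *ᵍ U z)))
smooth-inverse {K} {E} {D} {Q} {Q′} {U} s 0≤E QU≡1 U≤E = record
  { 0≤K = +-nonneg 0≤E (+-nonneg 0≤EEK 0≤KEEEK)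
  ; bound = λ d → ≤-trans (U≤E d) (p≤p+q (+-nonneg 0≤EEK 0≤KEEEK))
  ; bound′ = λ d → ≤-trans (neg-bound (*-bound (S.bound′ d) (*-bound (U≤E d) (U≤E d))))
      (≤-trans (≤-reflexive (*-comm K (E * E)))
        (≤-trans (p≤p+q {E * E * K} 0≤KEEEK) (p≤q+p {E * E * K + K * E * (E * E * K)} 0≤E)))
  ; lipschitz = λ {z} {w} d e → ≤-trans (lip d e)
      (*-monoʳ-≤-nonNeg ∥ w -ᵍ z ∥ {{nonNegative (0≤∥u∥ (w -ᵍ z))}}
        (≤-trans (p≤p+q {E * E * K} 0≤KEEEK) (p≤q+p {E * E * K + K * E * (E * E * K)} 0≤E)))
  ; taylor = λ {z} {w} d e → ≤-trans
      (subst₂ (λ u r → ∥ u ∥ ≤ r) (sym (split d e))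
        (solve 3 (λ k e h → e :* e :* (k :* (h :* h)) :+ h :* k :* e :* (e :* e :* k :* h)
           := (e :* e :* k :+ k :* e :* (e :* e :* k)) :* (h :* h)) refl K E ∥ w -ᵍ z ∥)
        (+-bound
          (neg-bound (*-bound (*-bound (U≤E e) (U≤E d)) (S.taylor d e)))
          (*-bound (*-bound (*-bound (≤-refl {∥ w -ᵍ z ∥}) (S.bound′ d)) (U≤E d))
            (subst (_≤ E * E * K * ∥ w -ᵍ z ∥) (∥u-v∥-sym (U w) (U z)) (lip d e)))))
      (*-monoʳ-≤-nonNeg (∥ w -ᵍ z ∥ * ∥ w -ᵍ z ∥)
        {{nonNegative (0≤* (0≤∥u∥ (w -ᵍ z)) (0≤∥u∥ (w -ᵍ z)))}}
        (p≤q+p {E * E * K + K * E * (E * E * K)} 0≤E))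
  }
  where
  module S = Smooth s
  0≤EEK : 0ℚ ≤ E * E * K
  0≤EEK = 0≤* (0≤* 0≤E 0≤E) S.0≤K
  0≤KEEEK : 0ℚ ≤ K * E * (E * E * K)
  0≤KEEEK = 0≤* (0≤* S.0≤K 0≤E) 0≤EEK
  difference : ∀ {z w} → D z → D w → U w -ᵍ U z ≡ negᵍ (U w *ᵍ U z *ᵍ (Q w -ᵍ Q z))
  difference {z} {w} d e = trans
    (solveᵍ 2 (λ v u → v :-ᵍ u :=ᵍ v :*ᵍ conᵍ 1ᵍ :-ᵍ u :*ᵍ conᵍ 1ᵍ) refl (U w) (U z))
    (trans (cong₂ (λ s t → U w *ᵍ s -ᵍ U z *ᵍ t) (sym (QU≡1 d)) (sym (QU≡1 e)))
      (solveᵍ 4 (λ v u q p → v :*ᵍ (p :*ᵍ u) :-ᵍ u :*ᵍ (q :*ᵍ v) :=ᵍ :-ᵍ (v :*ᵍ u :*ᵍ (q :-ᵍ p)))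
        refl (U w) (U z) (Q w) (Q z)))
  lip : ∀ {z w} → D z → D w → ∥ U w -ᵍ U z ∥ ≤ E * E * K * ∥ w -ᵍ z ∥
  lip {z} {w} d e = subst₂ (λ u r → ∥ u ∥ ≤ r) (sym (difference d e))
    (sym (*-assoc (E * E) K ∥ w -ᵍ z ∥))
    (neg-bound (*-bound (*-bound (U≤E e) (U≤E d)) (S.lipschitz d e)))
  split : ∀ {z w} → D z → D w →
    U w -ᵍ U z -ᵍ (w -ᵍ z) *ᵍ (negᵍ (Q′ z *ᵍ (U z *ᵍ U z))) ≡
    negᵍ (U w *ᵍ U z *ᵍ (Q w -ᵍ Q z -ᵍ (w -ᵍ z) *ᵍ Q′ z)) +ᵍ (w -ᵍ z) *ᵍ Q′ z *ᵍ U z *ᵍ (U z -ᵍ U w)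
  split {z} {w} d e = trans
    (cong (_-ᵍ (w -ᵍ z) *ᵍ (negᵍ (Q′ z *ᵍ (U z *ᵍ U z)))) (difference d e))
    (solveᵍ 5 (λ v u q h p → :-ᵍ (v :*ᵍ u :*ᵍ q) :-ᵍ h :*ᵍ (:-ᵍ (p :*ᵍ (u :*ᵍ u)))
      :=ᵍ :-ᵍ (v :*ᵍ u :*ᵍ (q :-ᵍ h :*ᵍ p)) :+ᵍ h :*ᵍ p :*ᵍ u :*ᵍ (u :-ᵍ v)) refl
      (U w) (U z) (Q w -ᵍ Q z) (w -ᵍ z) (Q′ z))

smooth-ev : ∀ {n R} → 0ℚ ≤ R → (cs : Vec 𝔾 n) →
  ∃[ K ] ∃[ F′ ] Smooth K (λ z → ∥ z ∥ ≤ R) (ev cs) F′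
smooth-ev 0≤R []       = ∥ 1ᵍ ∥ , _ , smooth-const 1ᵍ
smooth-ev 0≤R (c ∷ cs) =
  let (_ , _ , s) = smooth-ev 0≤R cs
  in _ , _ , smooth-+ (smooth-const c) (smooth-* (smooth-id 0≤R) s)

infixr 8 _^ᵍ_

-- Total, with value 0 at 0, so that `invᵍ` and the quotient zⁿ / P are functions on all of `𝔾`;
-- only the inverse law carries a side condition.
recip : ℚ → ℚ
recip p with p ≟ 0ℚ
... | yes _   = 0ℚ
... | no p≢0 = (1/ p) {{≢-nonZero p≢0}}

*-recip : ∀ {p} → p ≢ 0ℚ → p * recip p ≡ 1ℚ
*-recip {p} p≢0 with p ≟ 0ℚ
... | yes p≡0 = ⊥-elim (p≢0 p≡0)
... | no p≢0′ = *-inverseʳ p {{≢-nonZero p≢0′}}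

pos⇒≢0 : ∀ {p} → 0ℚ < p → p ≢ 0ℚ
pos⇒≢0 0<p p≡0 = <-irrefl (sym p≡0) 0<p

0≤recip : ∀ {p} → 0ℚ < p → 0ℚ ≤ recip p
0≤recip {p} 0<p = *-cancelˡ-≤-pos p {{positive 0<p}}
  (subst₂ _≤_ (sym (*-zeroʳ p)) (sym (*-recip (pos⇒≢0 0<p))) (nonNegative⁻¹ 1ℚ))

conj : 𝔾 → 𝔾
conj ⟨ a , b ⟩ = ⟨ a , - b ⟩

invᵍ : 𝔾 → 𝔾
invᵍ z = conj z *ᵍ fromℚᵍ (recip (N z))

0<N : ∀ {z} → 0ℚ < ∥ z ∥ → 0ℚ < N z
0<N {z} 0<z = ≰⇒> λ N≤0 → <-irrefl {0ℚ} refl (<-≤-trans (pos-* 0<z 0<z)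
  (≤-trans (∥∥²≤2N z) (+-mono-≤ {N z} {0ℚ} {N z} {0ℚ} N≤0 N≤0)))

*-invᵍ : ∀ {z} → 0ℚ < ∥ z ∥ → z *ᵍ invᵍ z ≡ 1ᵍ
*-invᵍ {z@(⟨ a , b ⟩)} 0<z = cong₂ ⟨_,_⟩
  (trans (solve 3 (λ a b r → a :* (a :* r :+ :- (:- b :* con 0ℚ)) :+ :- (b :* (a :* con 0ℚ :+ :- b :* r))
     := (a :* a :+ b :* b) :* r) refl a b (recip (N z)))
    (trans (cong (_* recip (N z)) (sym (N⟨,⟩ a b))) (*-recip (pos⇒≢0 (0<N {z} 0<z)))))
  (solve 3 (λ a b r → a :* (a :* con 0ℚ :+ :- b :* r) :+ b :* (a :* r :+ :- (:- b :* con 0ℚ))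
     := con 0ℚ) refl a b (recip (N z)))

∥conj∥ : ∀ z → ∥ conj z ∥ ≡ ∥ z ∥
∥conj∥ ⟨ a , b ⟩ = trans (∥⟨,⟩∥ a (- b)) (trans (cong (λ t → ∣ a ∣ + t) (∣-p∣≡∣p∣ b)) (sym (∥⟨,⟩∥ a b)))

-- The inverse has norm ∥z∥ / N z, which is at most 2 / ∥z∥ because of `∥∥²≤2N`. Hence the 2 in the
-- relation between ε and E.
∥invᵍ∥≤ : ∀ {z ε E} → 0ℚ < ε → ε ≤ ∥ z ∥ → ε * E ≡ 1ℚ + 1ℚ → ∥ invᵍ z ∥ ≤ E
∥invᵍ∥≤ {z} {ε} {E} 0<ε ε≤z εE≡2 = ≤-trans
  (*-bound {conj z} (≤-reflexive (∥conj∥ z))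
    (≤-reflexive (trans (∥fromℚᵍ∥ r) (0≤p⇒∣p∣≡p 0≤r))))
  (*-cancelˡ-≤-pos ε {{positive 0<ε}} (begin
    ε * (∥ z ∥ * r)       ≡⟨ *-assoc ε ∥ z ∥ r ⟨
    ε * ∥ z ∥ * r         ≤⟨ *-monoʳ-≤-nonNeg r {{nonNegative 0≤r}}
                              (*-monoʳ-≤-nonNeg ∥ z ∥ {{nonNegative (0≤∥u∥ z)}} ε≤z) ⟩
    ∥ z ∥ * ∥ z ∥ * r     ≤⟨ *-monoʳ-≤-nonNeg r {{nonNegative 0≤r}} (∥∥²≤2N z) ⟩
    (N z + N z) * r       ≡⟨ *-distribʳ-+ r (N z) (N z) ⟩
    N z * r + N z * r     ≡⟨ cong (λ t → t + t) (*-recip (pos⇒≢0 (0<N {z} 0<z))) ⟩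
    1ℚ + 1ℚ               ≡⟨ εE≡2 ⟨
    ε * E                 ∎))
  where
  open ≤-Reasoning
  r : ℚ
  r = recip (N z)
  0<z : 0ℚ < ∥ z ∥
  0<z = <-≤-trans 0<ε ε≤z
  0≤r : 0ℚ ≤ r
  0≤r = 0≤recip (0<N {z} 0<z)

-- Sums over a square grid

Σ< : ℕ → (ℕ → ℚ) → ℚ
Σ< zero    f = 0ℚ
Σ< (suc M) f = Σ< M f + f M

Σ<-lower : ∀ M {f β} → (∀ a → a ℕ.< M → β ≤ f a) → ι M * β ≤ Σ< M f
Σ<-lower zero    {β = β} h = ≤-reflexive (*-zeroˡ β)
Σ<-lower (suc M) {β = β} h = subst (_≤ _)
  (solve 2 (λ m b → m :* b :+ b := (m :+ con 1ℚ) :* b) refl (ι M) β)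
  (+-mono-≤ (Σ<-lower M (λ a a<M → h a (ℕP.m<n⇒m<1+n a<M))) (h M ℕP.≤-refl))

Σ<-upper : ∀ M {f β} → (∀ a → a ℕ.< M → f a ≤ β) → Σ< M f ≤ ι M * β
Σ<-upper zero    {β = β} h = ≤-reflexive (sym (*-zeroˡ β))
Σ<-upper (suc M) {β = β} h = subst (_ ≤_)
  (solve 2 (λ m b → m :* b :+ b := (m :+ con 1ℚ) :* b) refl (ι M) β)
  (+-mono-≤ (Σ<-upper M (λ a a<M → h a (ℕP.m<n⇒m<1+n a<M))) (h M ℕP.≤-refl))

-- A discrete Stokes inequality: the contributions of the cells of a square
-- grid telescope to the boundary terms.
module _ (u v : ℕ → ℕ → ℚ) (M : ℕ) (κ β : ℚ)
  (cell   : ∀ a b → a ℕ.< M → b ℕ.< M → (u (suc a) b - u a b) + (v a b - v a (suc b)) ≤ κ)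
  (right  : ∀ b → b ℕ.< M → β ≤ u M b)
  (left   : ∀ b → b ℕ.< M → u 0 b ≤ - β)
  (bottom : ∀ a → a ℕ.< M → β ≤ v a 0)
  (top    : ∀ a → a ℕ.< M → v a M ≤ - β)
  where

  private
    V : ℕ → ℕ → ℚ
    V m b = Σ< m (λ a → v a b)

    row : ∀ m b → m ℕ.≤ M → b ℕ.< M → (u m b - u 0 b) + (V m b - V m (suc b)) ≤ ι m * κ
    row zero    b m≤M b<M = ≤-reflexive
      (solve 2 (λ x k → (x :- x) :+ (con 0ℚ :- con 0ℚ) := con 0ℚ :* k) refl (u 0 b) κ)
    row (suc m) b m≤M b<M = subst₂ _≤_
      (solve 7 (λ x y z p q r s → (x :- z) :+ (p :- q) :+ ((y :- x) :+ (r :- s)) :=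
         (y :- z) :+ ((p :+ r) :- (q :+ s))) refl
         (u m b) (u (suc m) b) (u 0 b) (V m b) (V m (suc b)) (v m b) (v m (suc b)))
      (solve 2 (λ m k → m :* k :+ k := (m :+ con 1ℚ) :* k) refl (ι m) κ)
      (+-mono-≤ (row m b (ℕP.<⇒≤ m≤M) b<M) (cell m b m≤M b<M))

    rows : ∀ m → m ℕ.≤ M → V M 0 - V M m ≤ ι m * (ι M * κ - (β + β))
    rows zero    m≤M = ≤-reflexive
      (solve 2 (λ x k → x :- x := con 0ℚ :* k) refl (V M 0) (ι M * κ - (β + β)))
    rows (suc m) m≤M = ≤-cert
      ((ι m * (ι M * κ - (β + β)) - (V M 0 - V M m)) +
        (ι M * κ - ((u M m - u 0 m) + (V M m - V M (suc m))) +
          ((u M m - β) + (- β - u 0 m))))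
      (+-nonneg (p≤q⇒0≤q-p (rows m (ℕP.<⇒≤ m≤M)))
        (+-nonneg (p≤q⇒0≤q-p (row M m ℕP.≤-refl m≤M))
          (+-nonneg (p≤q⇒0≤q-p (right m m≤M)) (p≤q⇒0≤q-p (left m m≤M)))))
      (solve 8 (λ n k b x y z s t →
        (x :- z) :+ ((n :* (k :- (b :+ b)) :- (x :- y)) :+
          (k :- ((s :- t) :+ (y :- z)) :+ ((s :- b) :+ (:- b :- t))))
        := (n :+ con 1ℚ) :* (k :- (b :+ b))) refl
        (ι m) (ι M * κ) β (V M 0) (V M m) (V M (suc m)) (u M m) (u 0 m))

  -- For u = Re F and v = Im F a cell is a discrete form of ∂u/∂x - ∂v/∂y, and the sum over all
  -- cells corresponds to Im ∮ F dz. Each of the four sides contributes at least M β and the M²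
  -- cells at most M² κ; one factor M cancels.
  boundary≤cells : 0 ℕ.< M → (β + β) + (β + β) ≤ ι M * κ
  boundary≤cells 0<M = *-cancelˡ-≤-pos (ι M) {{positive 0<ιM}} (≤-cert
    ((ι M * (ι M * κ - (β + β)) - (V M 0 - V M M)) +
      ((V M 0 - ι M * β) + (ι M * (- β) - V M M)))
    (+-nonneg (p≤q⇒0≤q-p (rows M ℕP.≤-refl))
      (+-nonneg (p≤q⇒0≤q-p (Σ<-lower M bottom)) (p≤q⇒0≤q-p (Σ<-upper M top))))
    (solve 5 (λ m k b x y →
      m :* ((b :+ b) :+ (b :+ b)) :+
        ((m :* (k :- (b :+ b)) :- (x :- y)) :+ ((x :- m :* b) :+ (m :* (:- b) :- y)))
      := m :* k) refl (ι M) (ι M * κ) β (V M 0) (V M M)))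
    where
    0<ιM : 0ℚ < ι M
    0<ιM = <-≤-trans (positive⁻¹ (ι 1)) (ι-mono 0<M)

-- A power is the value of a monic polynomial whose stored coefficients are all 0, so `smooth-ev`
-- applies to it.
_^ᵍ_ : 𝔾 → ℕ → 𝔾
z ^ᵍ n = ev (replicate n 0ᵍ) z

^ᵍ-inverse : ∀ n {z w} → z *ᵍ w ≡ 1ᵍ → (z ^ᵍ n) *ᵍ (w ^ᵍ n) ≡ 1ᵍ
^ᵍ-inverse zero            zw≡1 = refl
^ᵍ-inverse (suc n) {z} {w} zw≡1 = trans
  (solveᵍ 4 (λ z w p q → (conᵍ 0ᵍ :+ᵍ z :*ᵍ p) :*ᵍ (conᵍ 0ᵍ :+ᵍ w :*ᵍ q) :=ᵍ (z :*ᵍ w) :*ᵍ (p :*ᵍ q)) refl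
    z w (z ^ᵍ n) (w ^ᵍ n))
  (trans (cong₂ _*ᵍ_ zw≡1 (^ᵍ-inverse n zw≡1)) refl)

coeffSum : ∀ {n} → Vec 𝔾 n → ℚ
coeffSum []       = 0ℚ
coeffSum (c ∷ cs) = ∥ c ∥ + coeffSum cs

0≤coeffSum : ∀ {n} (cs : Vec 𝔾 n) → 0ℚ ≤ coeffSum cs
0≤coeffSum []       = ≤-refl
0≤coeffSum (c ∷ cs) = +-nonneg (0≤∥u∥ c) (0≤coeffSum cs)

∥^ᵍ∥≤1 : ∀ n {w} → ∥ w ∥ ≤ 1ℚ → ∥ w ^ᵍ n ∥ ≤ 1ℚ
∥^ᵍ∥≤1 zero        w≤1 = ≤-reflexive ∥1ᵍ∥
∥^ᵍ∥≤1 (suc n) {w} w≤1 = subst (λ t → ∥ t ∥ ≤ 1ℚ)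
  (solveᵍ 2 (λ w p → w :*ᵍ p :=ᵍ conᵍ 0ᵍ :+ᵍ w :*ᵍ p) refl w (w ^ᵍ n))
  (*-bound {w} w≤1 (∥^ᵍ∥≤1 n w≤1))

-- For w = 1/z the product is 1 plus a sum of stored coefficients times positive powers of w, and
-- each such power has norm at most ∥w∥ as long as ∥w∥ ≤ 1.
ev-asymptotic : ∀ {n} (cs : Vec 𝔾 n) {z w} → z *ᵍ w ≡ 1ᵍ → ∥ w ∥ ≤ 1ℚ →
  ∥ ev cs z *ᵍ (w ^ᵍ n) -ᵍ 1ᵍ ∥ ≤ coeffSum cs * ∥ w ∥
ev-asymptotic []               {z} {w} zw≡1 w≤1 = subst (_≤ 0ℚ * ∥ w ∥) (0≡∥u∥ refl) (0≤* ≤-refl (0≤∥u∥ w))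
ev-asymptotic {suc n} (c ∷ cs) {z} {w} zw≡1 w≤1 = subst₂ (λ u r → ∥ u ∥ ≤ r)
  (trans
    (solveᵍ 4 (λ c p w q → c :*ᵍ (w :*ᵍ q) :+ᵍ (p :*ᵍ q :-ᵍ conᵍ 1ᵍ) :=ᵍ
       c :*ᵍ (w :*ᵍ q) :+ᵍ (conᵍ 1ᵍ :*ᵍ (p :*ᵍ q) :-ᵍ conᵍ 1ᵍ)) refl c (ev cs z) w (w ^ᵍ n))
    (trans (cong (λ t → c *ᵍ (w *ᵍ w ^ᵍ n) +ᵍ (t *ᵍ (ev cs z *ᵍ w ^ᵍ n) -ᵍ 1ᵍ)) (sym zw≡1))
      (solveᵍ 5 (λ c p z w q → c :*ᵍ (w :*ᵍ q) :+ᵍ ((z :*ᵍ w) :*ᵍ (p :*ᵍ q) :-ᵍ conᵍ 1ᵍ) :=ᵍ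
       (c :+ᵍ z :*ᵍ p) :*ᵍ (conᵍ 0ᵍ :+ᵍ w :*ᵍ q) :-ᵍ conᵍ 1ᵍ) refl c (ev cs z) z w (w ^ᵍ n))))
  (solve 3 (λ c w s → c :* (w :* con 1ℚ) :+ s :* w
     := (c :+ s) :* w) refl ∥ c ∥ ∥ w ∥ (coeffSum cs))
  (+-bound
    (*-bound {c} ≤-refl (*-bound {w} ≤-refl (∥^ᵍ∥≤1 n w≤1)))
    (ev-asymptotic cs zw≡1 w≤1))

¼ ⅕ : ℚ
¼ = + 1 / 4
⅕ = + 1 / 5

-- From Y - 1 = - Y g, the number y = ∥Y - 1∥ satisfies y ≤ (1 + y)/5, which is y ≤ 1/4.
near-one : ∀ {Y g} → Y *ᵍ (1ᵍ +ᵍ g) ≡ 1ᵍ → ∥ g ∥ ≤ ⅕ → ∥ Y -ᵍ 1ᵍ ∥ ≤ ¼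
near-one {Y} {g} Y*≡1 g≤⅕ = ≤-cert
  (((1ℚ + ∥ Y -ᵍ 1ᵍ ∥) * ⅕ - ∥ Y -ᵍ 1ᵍ ∥) * (+ 5 / 4))
  (0≤* (p≤q⇒0≤q-p bound) (nonNegative⁻¹ (+ 5 / 4)))
  (solve 1 (λ y → y :+ ((con 1ℚ :+ y) :* con ⅕ :- y) :* con (+ 5 / 4) := con ¼) refl ∥ Y -ᵍ 1ᵍ ∥)
  where
  difference : negᵍ (Y *ᵍ g) ≡ Y -ᵍ 1ᵍ
  difference = trans
    (solveᵍ 2 (λ Y g → :-ᵍ (Y :*ᵍ g) :=ᵍ
      Y :-ᵍ Y :*ᵍ (conᵍ 1ᵍ :+ᵍ g)) refl Y g)
    (cong (Y -ᵍ_) Y*≡1)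
  bound : ∥ Y -ᵍ 1ᵍ ∥ ≤ (1ℚ + ∥ Y -ᵍ 1ᵍ ∥) * ⅕
  bound = subst (λ t → ∥ t ∥ ≤ (1ℚ + ∥ Y -ᵍ 1ᵍ ∥) * ⅕) difference
    (neg-bound (*-bound {Y}
      (subst (λ t → ∥ Y ∥ ≤ t + ∥ Y -ᵍ 1ᵍ ∥) ∥1ᵍ∥ (∥u∥≤∥v∥+∥u-v∥ Y 1ᵍ)) g≤⅕))

-- Here n stands for N z at a boundary point z, and y₁ + i y₂ for z F z, which is close to 1. Then c
-- n ≥ (3/4) R - (1/4) R = R/2, while n ≤ 2 R², so c ≥ 1/(4R). This is the origin of β.
component-lower : ∀ {R β n p y₁ y₂ c} → 0ℚ < n → n ≤ R * R + R * R → 0ℚ < β →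
  (R + R + (R + R)) * β ≡ 1ℚ → ∣ y₁ - 1ℚ ∣ ≤ ¼ → ∣ y₂ ∣ ≤ ¼ → ∣ p ∣ ≤ R →
  c * n ≡ y₁ * R + y₂ * p → β ≤ c
component-lower {R} {β} {n} {p} {y₁} {y₂} {c} 0<n n≤2R² 0<β 4Rβ≡1 y₁≈1 y₂≈0 p≤R cn≡ =
  ≮⇒≥ λ c<β → <-irrefl {c * n} refl (<-≤-trans (*-monoˡ-<-pos n {{positive 0<n}} c<β) (begin
    β * n
      ≤⟨ *-monoˡ-≤-nonNeg β {{nonNegative (<⇒≤ 0<β)}} n≤2R² ⟩
    β * (R * R + R * R)
      ≡⟨ solve 2 (λ b r → b :* (r :* r :+ r :* r) := (r :+ r :+ (r :+ r)) :* b :* (r :* con ½)) refl β R ⟩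
    (R + R + (R + R)) * β * (R * ½)
      ≡⟨ cong (_* (R * ½)) 4Rβ≡1 ⟩
    1ℚ * (R * ½)
      ≤⟨ ≤-cert ((¼ - - (y₁ - 1ℚ)) * R + (¼ * R - - (y₂ * p)))
          (+-nonneg (0≤* (p≤q⇒0≤q-p (≤-trans (-p≤∣p∣ (y₁ - 1ℚ)) y₁≈1)) (≤-trans (0≤∣p∣ p) p≤R))
            (p≤q⇒0≤q-p (≤-trans (-p≤∣p∣ (y₂ * p)) (≤-trans (≤-reflexive (∣p*q∣≡∣p∣*∣q∣ y₂ p))
              (*-mono-nonNeg (0≤∣p∣ p) (nonNegative⁻¹ ¼) y₂≈0 p≤R)))))
          (solve 4 (λ r p y z → con 1ℚ :* (r :* con ½) :+ ((con ¼ :- (:- (y :- con 1ℚ))) :* r :+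
             (con ¼ :* r :- (:- (z :* p)))) := y :* r :+ z :* p) refl R p y₁ y₂) ⟩
    y₁ * R + y₂ * p
      ≡⟨ cn≡ ⟨
    c * n ∎))
  where open ≤-Reasoning

abs-bound : ∀ {p B} → p ≤ B → - p ≤ B → ∣ p ∣ ≤ B
abs-bound {p} p≤B -p≤B with ∣p∣≡p∨∣p∣≡-p p
... | inj₁ eq = subst (_≤ _) (sym eq) p≤B
... | inj₂ eq = subst (_≤ _) (sym eq) -p≤B

square-bound : ∀ {p B} → ∣ p ∣ ≤ B → p * p ≤ B * B
square-bound {p} p≤B = subst (_≤ _) (∣p∣²≡p² p)
  (*-mono-nonNeg (0≤∣p∣ p) (≤-trans (0≤∣p∣ p) p≤B) p≤B p≤B)

2^ : ℕ → ℕ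
2^ zero    = 1
2^ (suc j) = 2^ j ℕ.+ 2^ j

ι-+ : ∀ m n → ι (m ℕ.+ n) ≡ ι m + ι n
ι-+ zero    n = sym (+-identityˡ (ι n))
ι-+ (suc m) n = trans (cong (_+ 1ℚ) (ι-+ m n))
  (solve 2 (λ m n → m :+ n :+ con 1ℚ := m :+ con 1ℚ :+ n) refl (ι m) (ι n))

ι2^*½^ : ∀ j → ι (2^ j) * ½^ j ≡ 1ℚ
ι2^*½^ zero    = refl
ι2^*½^ (suc j) = trans (cong (_* (½^ j * ½)) (ι-+ (2^ j) (2^ j)))
  (trans (solve 2 (λ m h → (m :+ m) :* (h :* con ½) := m :* h) refl (ι (2^ j)) (½^ j)) (ι2^*½^ j))

0<2^ : ∀ j → 0 ℕ.< 2^ j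
0<2^ zero    = ℕP.≤-refl
0<2^ (suc j) = ℕP.≤-trans (0<2^ j) (ℕP.m≤m+n (2^ j) (2^ j))

Re-- : ∀ u v → Re (u -ᵍ v) ≡ Re u - Re v
Re-- ⟨ _ , _ ⟩ ⟨ _ , _ ⟩ = refl

Im-- : ∀ u v → Im (u -ᵍ v) ≡ Im u - Im v
Im-- ⟨ _ , _ ⟩ ⟨ _ , _ ⟩ = refl

-- The real part of u N(z) = (z u) conj(z). It recovers F on the boundary from z F, which is the
-- quantity under control there.
Re-N : ∀ x y u → Re u * N ⟨ x , y ⟩ ≡ Re (⟨ x , y ⟩ *ᵍ u) * x + Im (⟨ x , y ⟩ *ᵍ u) * y
Re-N x y ⟨ p , q ⟩ = trans (cong (p *_) (N⟨,⟩ x y))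
  (solve 4 (λ x y p q → p :* (x :* x :+ y :* y) :=
    (x :* p :+ :- (y :* q)) :* x :+ (x :* q :+ y :* p) :* y) refl x y p q)

Im-N : ∀ x y u → Im u * N ⟨ x , y ⟩ ≡ Im (⟨ x , y ⟩ *ᵍ u) * x - Re (⟨ x , y ⟩ *ᵍ u) * y
Im-N x y ⟨ p , q ⟩ = trans (cong (q *_) (N⟨,⟩ x y))
  (solve 4 (λ x y p q → q :* (x :* x :+ y :* y) :=
    (x :* q :+ y :* p) :* x :- (x :* p :+ :- (y :* q)) :* y) refl x y p q)

-- The derivative `g` enters through Re (δ g) and Im (i δ g), which are equal and cancel: the
-- Cauchy-Riemann equation. Only Taylor remainders are left.
cell-difference : ∀ f f₁ f₂ g δ → (Re f₁ - Re f) + (Im f - Im f₂) ≡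
  Re (f₁ -ᵍ f -ᵍ ⟨ δ , 0ℚ ⟩ *ᵍ g) - Im (f₂ -ᵍ f -ᵍ ⟨ 0ℚ , δ ⟩ *ᵍ g)
cell-difference ⟨ a , b ⟩ ⟨ c , _ ⟩ ⟨ _ , d ⟩ ⟨ p , q ⟩ δ =
  solve 7 (λ a b c d p q h → (c :- a) :+ (b :- d) :=
    (c :- a :- (h :* p :+ :- (con 0ℚ :* q))) :- (d :- b :- (con 0ℚ :* q :+ h :* p))) refl a b c d p q δ

-- If P stayed away from 0 on a fine grid in a large square, then
-- F = zⁿ / P would be smooth there and F ≈ 1 / z on the boundary, contradicting
-- the discrete form of ∮ F = 0.
module _ {n} (P : Vec 𝔾 (suc n)) {ε} (0<ε : 0ℚ < ε) where

  private
    S R E β A : ℚ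
    S = coeffSum P
    -- Half the side of the square. For ∥z∥ ≥ R the inverse of z has norm at most E = 2/R, and the
    -- factor 10 makes S E ≤ 1/5, as `near-one` requires.
    R = (S + 1ℚ) * (+ 10 / 1)
    0<S+1 : 0ℚ < S + 1ℚ
    0<S+1 = +-mono-≤-< (0≤coeffSum P) (positive⁻¹ 1ℚ)
    0<R : 0ℚ < R
    0<R = pos-* 0<S+1 (positive⁻¹ (+ 10 / 1))
    0≤R+R : 0ℚ ≤ R + R
    0≤R+R = +-nonneg (<⇒≤ 0<R) (<⇒≤ 0<R)
    inverse-R : ∃[ E ] (0ℚ < E × R * E ≡ 1ℚ + 1ℚ)
    inverse-R = divide 0<R (positive⁻¹ (1ℚ + 1ℚ))
    E = proj₁ inverse-R
    E≤⅕/[S+1] : (S + 1ℚ) * E ≡ ⅕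
    E≤⅕/[S+1] = trans (solve 2 (λ s e → s :* e := s :* con (+ 10 / 1) :* e :* con (+ 1 / 10)) refl (S + 1ℚ) E)
      (cong (_* (+ 1 / 10)) (proj₂ (proj₂ inverse-R)))
    0<E : 0ℚ < E
    0<E = proj₁ (proj₂ inverse-R)
    E≤1 : E ≤ 1ℚ
    E≤1 = ≤-trans
      (≤-cert (S * E) (0≤* (0≤coeffSum P) (<⇒≤ 0<E))
        (trans (solve 2 (λ s e → e :+ s :* e := (s :+ con 1ℚ) :* e) refl S E) E≤⅕/[S+1]))
      (≤ᵇ⇒≤ _)
    SE≤⅕ : S * E ≤ ⅕
    SE≤⅕ = ≤-cert E (<⇒≤ 0<E)
      (trans (solve 2 (λ s e → s :* e :+ e := (s :+ con 1ℚ) :* e) refl S E) E≤⅕/[S+1])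
    0<4R : 0ℚ < R + R + (R + R)
    0<4R = +-mono-< (+-mono-< 0<R 0<R) (+-mono-< 0<R 0<R)
    inverse-4R : ∃[ β ] (0ℚ < β × (R + R + (R + R)) * β ≡ 1ℚ)
    inverse-4R = divide 0<4R (positive⁻¹ 1ℚ)
    β = proj₁ inverse-4R
    0<β : 0ℚ < β
    0<β = proj₁ (proj₂ inverse-4R)
    inverse-ε : ∃[ A ] (0ℚ < A × ε * A ≡ 1ℚ + 1ℚ)
    inverse-ε = divide 0<ε (positive⁻¹ (1ℚ + 1ℚ))
    A = proj₁ inverse-ε

    -- The corners of the square have norm 2R, hence the first bound. The second is the assumption
    -- to be refuted, made at grid points only.
    D : 𝔾 → Set
    D z = ∥ z ∥ ≤ R + R × ε ≤ ∥ ev P z ∥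

    U F : 𝔾 → 𝔾
    U z = invᵍ (ev P z)
    F z = (z ^ᵍ n) *ᵍ U z

    PU≡1 : ∀ {z} → D z → ev P z *ᵍ U z ≡ 1ᵍ
    PU≡1 (_ , ε≤) = *-invᵍ (<-≤-trans 0<ε ε≤)

    F-smooth : ∃[ K ] ∃[ F′ ] Smooth K D F F′
    F-smooth =
      let (_ , _ , s) = smooth-ev 0≤R+R P
          (_ , _ , t) = smooth-ev 0≤R+R (replicate n 0ᵍ)
      in _ , _ , smooth-* (smooth-restrict proj₁ t)
           (smooth-inverse (smooth-restrict proj₁ s) (<⇒≤ (proj₁ (proj₂ inverse-ε))) PU≡1
             λ (_ , ε≤) → ∥invᵍ∥≤ 0<ε ε≤ (proj₂ (proj₂ inverse-ε)))

    -- The reciprocal of z F z = zⁿ⁺¹ / P(z) is P(z) wⁿ⁺¹ with w = 1/z, which `ev-asymptotic` places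
    -- within 1/5 of 1.
    zF≈1 : ∀ {z} → D z → R ≤ ∥ z ∥ → ∥ z *ᵍ F z -ᵍ 1ᵍ ∥ ≤ ¼
    zF≈1 {z} d R≤z = near-one {z *ᵍ F z} {G -ᵍ 1ᵍ}
      (trans (solveᵍ 5 (λ z Z p u W → z :*ᵍ (Z :*ᵍ u) :*ᵍ (conᵍ 1ᵍ :+ᵍ (p :*ᵍ W :-ᵍ conᵍ 1ᵍ)) :=ᵍ
           (p :*ᵍ u) :*ᵍ ((conᵍ 0ᵍ :+ᵍ z :*ᵍ Z) :*ᵍ W)) refl
           z (z ^ᵍ n) (ev P z) (U z) (w ^ᵍ (suc n)))
        (cong₂ _*ᵍ_ (PU≡1 d) (^ᵍ-inverse (suc n) {z} {w} zw≡1)))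
      (≤-trans (ev-asymptotic P zw≡1 (≤-trans w≤E E≤1))
        (≤-trans (*-monoˡ-≤-nonNeg S {{nonNegative (0≤coeffSum P)}} w≤E) SE≤⅕))
      where
      w G : 𝔾
      w = invᵍ z
      G = ev P z *ᵍ (w ^ᵍ (suc n))
      zw≡1 : z *ᵍ w ≡ 1ᵍ
      zw≡1 = *-invᵍ (<-≤-trans 0<R R≤z)
      w≤E : ∥ w ∥ ≤ E
      w≤E = ∥invᵍ∥≤ 0<R R≤z (proj₂ (proj₂ inverse-R))

  private
    -- Serves all four sides: `c` is the real or imaginary part of F up to sign, `R` stands for the
    -- coordinate that is constant on the side, and `p` for the other coordinate, with signs
    -- adjusted to match.
    edge : ∀ {x y} → D ⟨ x , y ⟩ → ∣ x ∣ ≤ R → ∣ y ∣ ≤ R → R ≤ ∥ ⟨ x , y ⟩ ∥ →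
      ∀ c p → ∣ p ∣ ≤ R →
      c * N ⟨ x , y ⟩ ≡ Re (⟨ x , y ⟩ *ᵍ F ⟨ x , y ⟩) * R + Im (⟨ x , y ⟩ *ᵍ F ⟨ x , y ⟩) * p →
      β ≤ c
    edge {x} {y} d x≤R y≤R R≤z c p p≤R = component-lower {y₁ = Re Y} {Im Y}
      (0<N (<-≤-trans 0<R R≤z))
      (subst (_≤ R * R + R * R) (sym (N⟨,⟩ x y)) (+-mono-≤ (square-bound x≤R) (square-bound y≤R)))
      0<β (proj₂ (proj₂ inverse-4R))
      (subst (λ t → ∣ t ∣ ≤ ¼) (Re-- Y 1ᵍ) (≤-trans (∣Re∣≤∥∥ (Y -ᵍ 1ᵍ)) (zF≈1 d R≤z)))
      (subst (λ t → ∣ t ∣ ≤ ¼) (trans (Im-- Y 1ᵍ) (+-identityʳ (Im Y)))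
        (≤-trans (∣Im∣≤∥∥ (Y -ᵍ 1ᵍ)) (zF≈1 d R≤z)))
      p≤R
      where
      Y : 𝔾
      Y = ⟨ x , y ⟩ *ᵍ F ⟨ x , y ⟩

  module Grid (j : ℕ) where

    private
      δ : ℚ
      δ = (R + R) * ½^ j
      M : ℕ
      M = 2^ j
      0<δ : 0ℚ < δ
      0<δ = pos-* (+-mono-< 0<R 0<R) (0<½^ j)
      Mδ≡2R : ι M * δ ≡ R + R
      Mδ≡2R = trans (solve 3 (λ m r h → m :* (r :* h) := m :* h :* r) refl (ι M) (R + R) (½^ j))
        (trans (cong (_* (R + R)) (ι2^*½^ j)) (*-identityˡ (R + R)))
      x : ℕ → ℚ
      x a = ι a * δ - R
      x0≡-R : x 0 ≡ - R
      x0≡-R = solve 2 (λ d r → con 0ℚ :* d :- r := :- r) refl δ R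
      xM≡R : x M ≡ R
      xM≡R = trans (cong (_- R) Mδ≡2R) (solve 1 (λ r → r :+ r :- r := r) refl R)
      ∣x∣≤R : ∀ {a} → a ℕ.≤ M → ∣ x a ∣ ≤ R
      ∣x∣≤R {a} a≤M = abs-bound
        (≤-cert (ι M * δ - ι a * δ) (p≤q⇒0≤q-p (*-monoʳ-≤-nonNeg δ {{nonNegative (<⇒≤ 0<δ)}} (ι-mono a≤M)))
          (trans (solve 3 (λ m n r → n :- r :+ (m :- n) := m :- r) refl (ι M * δ) (ι a * δ) R) xM≡R))
        (≤-cert (ι a * δ) (0≤* (0≤ι a) (<⇒≤ 0<δ))
          (solve 2 (λ n r → :- (n :- r) :+ n := r) refl (ι a * δ) R))

    point : ℕ → ℕ → 𝔾
    point a b = ⟨ x a , x b ⟩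

    module _ (far : ∀ a b → a ℕ.≤ M → b ℕ.≤ M → ε ≤ ∥ ev P (point a b) ∥) where

      private
        dom : ∀ {a b} → a ℕ.≤ M → b ℕ.≤ M → D (point a b)
        dom {a} {b} a≤M b≤M =
          subst (_≤ R + R) (sym (∥⟨,⟩∥ (x a) (x b))) (+-mono-≤ (∣x∣≤R a≤M) (∣x∣≤R b≤M))
          , far a b a≤M b≤M
        K : ℚ
        K = proj₁ F-smooth
        F′ : 𝔾 → 𝔾
        F′ = proj₁ (proj₂ F-smooth)
        open Smooth (proj₂ (proj₂ F-smooth))

        κ : ℚ
        κ = K * (δ * δ) + K * (δ * δ)

        step : ∀ {z w d} → w -ᵍ z ≡ d → ∥ d ∥ ≡ δ → D z → D w →
          ∥ F w -ᵍ F z -ᵍ d *ᵍ F′ z ∥ ≤ K * (δ * δ)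
        step {z} {w} refl d≡δ dz dw = subst (λ t → ∥ F w -ᵍ F z -ᵍ (w -ᵍ z) *ᵍ F′ z ∥ ≤ K * (t * t))
          d≡δ (taylor dz dw)

        x-step : ∀ a → x (suc a) - x a ≡ δ
        x-step a = solve 3 (λ n d r → (n :+ con 1ℚ) :* d :- r :- (n :* d :- r) := d) refl (ι a) δ R

        cell : ∀ a b → a ℕ.< M → b ℕ.< M →
          (Re (F (point (suc a) b)) - Re (F (point a b))) + (Im (F (point a b)) - Im (F (point a (suc b)))) ≤ κ
        cell a b a<M b<M = subst (_≤ κ)
          (sym (cell-difference (F (point a b)) (F (point (suc a) b)) (F (point a (suc b))) (F′ (point a b)) δ))
          (+-mono-≤
            (≤-trans (p≤∣p∣ (Re e₁)) (≤-trans (∣Re∣≤∥∥ e₁)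
              (step (cong₂ ⟨_,_⟩ (x-step a) (+-inverseʳ (x b)))
                (trans (∥⟨,⟩∥ δ 0ℚ) (trans (+-identityʳ ∣ δ ∣) (0≤p⇒∣p∣≡p (<⇒≤ 0<δ))))
                (dom (ℕP.<⇒≤ a<M) (ℕP.<⇒≤ b<M)) (dom a<M (ℕP.<⇒≤ b<M)))))
            (≤-trans (-p≤∣p∣ (Im e₂)) (≤-trans (∣Im∣≤∥∥ e₂)
              (step (cong₂ ⟨_,_⟩ (+-inverseʳ (x a)) (x-step b))
                (trans (∥⟨,⟩∥ 0ℚ δ) (trans (+-identityˡ ∣ δ ∣) (0≤p⇒∣p∣≡p (<⇒≤ 0<δ))))
                (dom (ℕP.<⇒≤ a<M) (ℕP.<⇒≤ b<M)) (dom (ℕP.<⇒≤ a<M) b<M)))))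
          where
          e₁ e₂ : 𝔾
          e₁ = F (point (suc a) b) -ᵍ F (point a b) -ᵍ ⟨ δ , 0ℚ ⟩ *ᵍ F′ (point a b)
          e₂ = F (point a (suc b)) -ᵍ F (point a b) -ᵍ ⟨ 0ℚ , δ ⟩ *ᵍ F′ (point a b)

        R≤∣xM∣ : R ≤ ∣ x M ∣
        R≤∣xM∣ = ≤-trans (≤-reflexive (sym xM≡R)) (p≤∣p∣ (x M))
        R≤∣x0∣ : R ≤ ∣ x 0 ∣
        R≤∣x0∣ = ≤-trans (≤-reflexive (trans (solve 1 (λ r → r := :- (:- r)) refl R) (cong -_ (sym x0≡-R)))) (-p≤∣p∣ (x 0))
        ∣-x∣≤R : ∀ {a} → a ℕ.≤ M → ∣ - x a ∣ ≤ R
        ∣-x∣≤R {a} a≤M = subst (_≤ R) (sym (∣-p∣≡∣p∣ (x a))) (∣x∣≤R a≤M)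

        right : ∀ b → b ℕ.< M → β ≤ Re (F (point M b))
        right b b<M = edge (dom ℕP.≤-refl (ℕP.<⇒≤ b<M)) (∣x∣≤R ℕP.≤-refl) (∣x∣≤R (ℕP.<⇒≤ b<M))
          (≤-trans R≤∣xM∣ (∣Re∣≤∥∥ (point M b))) _ (x b) (∣x∣≤R (ℕP.<⇒≤ b<M))
          (trans (Re-N (x M) (x b) (F (point M b))) (cong (λ t → Re Y * t + Im Y * x b) xM≡R))
          where
          Y : 𝔾
          Y = point M b *ᵍ F (point M b)

        left : ∀ b → b ℕ.< M → Re (F (point 0 b)) ≤ - β
        left b b<M = subst (_≤ - β) (solve 1 (λ p → :- (:- p) := p) refl (Re (F (point 0 b)))) (neg-antimono-≤
          (edge (dom ℕ.z≤n (ℕP.<⇒≤ b<M)) (∣x∣≤R ℕ.z≤n) (∣x∣≤R (ℕP.<⇒≤ b<M))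
            (≤-trans R≤∣x0∣ (∣Re∣≤∥∥ (point 0 b))) _ (- x b) (∣-x∣≤R (ℕP.<⇒≤ b<M))
            (trans (sym (neg-distribˡ-* (Re (F (point 0 b))) (N (point 0 b))))
              (trans (cong -_ (trans (Re-N (x 0) (x b) (F (point 0 b))) (cong (λ t → Re Y * t + Im Y * x b) x0≡-R)))
                (solve 4 (λ r p s t → :- (s :* (:- r) :+ t :* p) := s :* r :+ t :* (:- p)) refl
                  R (x b) (Re Y) (Im Y))))))
          where
          Y : 𝔾
          Y = point 0 b *ᵍ F (point 0 b)

        bottom : ∀ a → a ℕ.< M → β ≤ Im (F (point a 0))
        bottom a a<M = edge (dom (ℕP.<⇒≤ a<M) ℕ.z≤n) (∣x∣≤R (ℕP.<⇒≤ a<M)) (∣x∣≤R ℕ.z≤n)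
          (≤-trans R≤∣x0∣ (∣Im∣≤∥∥ (point a 0))) _ (x a) (∣x∣≤R (ℕP.<⇒≤ a<M))
          (trans (Im-N (x a) (x 0) (F (point a 0))) (trans (cong (λ t → Im Y * x a - Re Y * t) x0≡-R)
            (solve 4 (λ r p s t → t :* p :- s :* (:- r) := s :* r :+ t :* p) refl
                  R (x a) (Re Y) (Im Y))))
          where
          Y : 𝔾
          Y = point a 0 *ᵍ F (point a 0)

        top : ∀ a → a ℕ.< M → Im (F (point a M)) ≤ - β
        top a a<M = subst (_≤ - β) (solve 1 (λ p → :- (:- p) := p) refl (Im (F (point a M)))) (neg-antimono-≤
          (edge (dom (ℕP.<⇒≤ a<M) ℕP.≤-refl) (∣x∣≤R (ℕP.<⇒≤ a<M)) (∣x∣≤R ℕP.≤-refl)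
            (≤-trans R≤∣xM∣ (∣Im∣≤∥∥ (point a M))) _ (- x a) (∣-x∣≤R (ℕP.<⇒≤ a<M))
            (trans (sym (neg-distribˡ-* (Im (F (point a M))) (N (point a M))))
              (trans (cong -_ (trans (Im-N (x a) (x M) (F (point a M))) (cong (λ t → Im Y * x a - Re Y * t) xM≡R)))
                (solve 4 (λ r p s t → :- (t :* p :- s :* r) := s :* r :+ t :* (:- p)) refl
                  R (x a) (Re Y) (Im Y))))))
          where
          Y : 𝔾
          Y = point a M *ᵍ F (point a M)

      -- Since M δ = 2R, the cell errors add up to M κ = 2 K (M δ) δ, which halves with each
      -- refinement, whereas β does not depend on the mesh. The summand 1 keeps the factor positive
      -- when K = 0, as `small½^` needs.
      mesh-lower : β + β + (β + β) ≤ (K * ((R + R) * (R + R)) + K * ((R + R) * (R + R)) + 1ℚ) * ½^ j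
      mesh-lower = ≤-trans
        (boundary≤cells (λ a b → Re (F (point a b))) (λ a b → Im (F (point a b))) M κ β
          cell right left bottom top (0<2^ j))
        (≤-cert (½^ j) (<⇒≤ (0<½^ j))
          (trans (solve 4 (λ m k h r → m :* (k :* (r :* h :* (r :* h)) :+ k :* (r :* h :* (r :* h))) :+ h :=
            m :* (r :* h) :* (k :* r :+ k :* r) :* h :+ h) refl (ι M) K (½^ j) (R + R))
            (trans (cong (λ t → t * (K * (R + R) + K * (R + R)) * ½^ j + ½^ j) Mδ≡2R)
              (solve 3 (λ k h r → r :* (k :* r :+ k :* r) :* h :+ h :=
                (k :* (r :* r) :+ k :* (r :* r) :+ con 1ℚ) :* h) refl K (½^ j) (R + R)))))

  -- The grid is finite and its values have rational norms, so a search decides whether some grid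
  -- point works. For j large enough, failure at every point contradicts `mesh-lower`.
  approximate-root : ∃[ r ] ∥ ev P r ∥ < ε
  approximate-root = search (ℕP.anyUpTo? (λ a → ℕP.anyUpTo? (λ b → ∥ ev P (point a b) ∥ <? ε) (suc M)) (suc M))
    where
    K C : ℚ
    K = proj₁ F-smooth
    C = K * ((R + R) * (R + R)) + K * ((R + R) * (R + R)) + 1ℚ
    0≤KRR : 0ℚ ≤ K * ((R + R) * (R + R))
    0≤KRR = 0≤* (Smooth.0≤K (proj₂ (proj₂ F-smooth))) (0≤* 0≤R+R 0≤R+R)
    fine : Eventually (λ j → C * ½^ j < β + β + (β + β))
    fine = small½^ (+-mono-≤-< (+-nonneg 0≤KRR 0≤KRR) (positive⁻¹ 1ℚ))
      (+-mono-< (+-mono-< 0<β 0<β) (+-mono-< 0<β 0<β))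
    j M : ℕ
    j = proj₁ fine
    M = 2^ j
    open Grid j
    search : Dec (∃[ a ] (a ℕ.< suc M × ∃[ b ] (b ℕ.< suc M × ∥ ev P (point a b) ∥ < ε))) → ∃[ r ] ∥ ev P r ∥ < ε
    search (yes (a , _ , b , _ , small)) = point a b , small
    search (no none) = ⊥-elim (<-irrefl {β + β + (β + β)} refl (≤-<-trans
      (mesh-lower λ a b a≤M b≤M → ≮⇒≥ λ small → none (a , ℕ.s≤s a≤M , b , ℕ.s≤s b≤M , small))
      (proj₂ fine j ℕP.≤-refl)))

-- Refining approximate roots

-- Synthetic division by X - y: Horner's intermediate values are the coefficients of the quotient,
-- whose leading 1 again remains implicit.
quo : ∀ {n} → Vec 𝔾 (suc n) → 𝔾 → Vec 𝔾 n
quo {zero}  (c ∷ [])     y = []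
quo {suc n} (c ∷ cs)     y = ev cs y ∷ quo cs y

ev-quo : ∀ {n} (cs : Vec 𝔾 (suc n)) x y → ev cs x ≡ (x -ᵍ y) *ᵍ ev (quo cs y) x +ᵍ ev cs y
ev-quo {zero} (c ∷ []) x y =
  solveᵍ 3 (λ c x y → c :+ᵍ x :*ᵍ conᵍ 1ᵍ :=ᵍ (x :-ᵍ y) :*ᵍ conᵍ 1ᵍ :+ᵍ (c :+ᵍ y :*ᵍ conᵍ 1ᵍ)) refl c x y
ev-quo {suc n} (c ∷ cs) x y = trans (cong (λ t → c +ᵍ x *ᵍ t) (ev-quo cs x y))
  (solveᵍ 5 (λ c x y q p → c :+ᵍ x :*ᵍ ((x :-ᵍ y) :*ᵍ q :+ᵍ p) :=ᵍ (x :-ᵍ y) :*ᵍ (p :+ᵍ x :*ᵍ q) :+ᵍ (c :+ᵍ y :*ᵍ p))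
    refl c x y (ev (quo cs y) x) (ev cs y))

²-cancel-< : ∀ {p q} → 0ℚ ≤ q → p * p < q * q → p < q
²-cancel-< {p} {q} 0≤q p²<q² = ≰⇒> λ q≤p →
  <-irrefl {p * p} refl (<-≤-trans p²<q² (*-mono-nonNeg 0≤q (≤-trans 0≤q q≤p) q≤p q≤p))

-- The norm itself is only submultiplicative; the reverse estimate goes through the multiplicative
-- `N`: ∥u∥² ∥v∥² ≤ 4 N u N v = 4 N (u v) ≤ 4 ∥u v∥².
∥u∥∥v∥≤2∥uv∥ : ∀ u v → ∥ u ∥ * ∥ v ∥ ≤ ∥ u *ᵍ v ∥ + ∥ u *ᵍ v ∥
∥u∥∥v∥≤2∥uv∥ u v = ≮⇒≥ λ 2w<uv → <-irrefl {w + w} refl (<-≤-trans 2w<uv (≮⇒≥ λ 2w<uv′ →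
  <-irrefl {(w + w) * (w + w)} refl (<-≤-trans
    (≤-<-trans
      (*-monoˡ-≤-nonNeg (w + w) {{nonNegative 0≤2w}} (<⇒≤ 2w<uv))
      (*-monoˡ-<-pos (∥ u ∥ * ∥ v ∥) {{positive (≤-<-trans 0≤2w 2w<uv)}} 2w<uv)) square)))
  where
  w : ℚ
  w = ∥ u *ᵍ v ∥
  0≤2w : 0ℚ ≤ w + w
  0≤2w = +-nonneg (0≤∥u∥ (u *ᵍ v)) (0≤∥u∥ (u *ᵍ v))
  open ≤-Reasoning
  square : ∥ u ∥ * ∥ v ∥ * (∥ u ∥ * ∥ v ∥) ≤ (w + w) * (w + w)
  square = begin
    ∥ u ∥ * ∥ v ∥ * (∥ u ∥ * ∥ v ∥)
      ≡⟨ solve 2 (λ a b → a :* b :* (a :* b) := a :* a :* (b :* b)) refl (∥ u ∥) (∥ v ∥) ⟩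
    ∥ u ∥ * ∥ u ∥ * (∥ v ∥ * ∥ v ∥)
      ≤⟨ *-mono-nonNeg (0≤p² ∥ v ∥) (+-nonneg (0≤N u) (0≤N u)) (∥∥²≤2N u) (∥∥²≤2N v) ⟩
    (N u + N u) * (N v + N v)
      ≡⟨ solve 2 (λ a b → (a :+ a) :* (b :+ b) := a :* b :* con (1ℚ + 1ℚ + (1ℚ + 1ℚ))) refl (N u) (N v) ⟩
    N u * N v * (1ℚ + 1ℚ + (1ℚ + 1ℚ))
      ≡⟨ cong (_* (1ℚ + 1ℚ + (1ℚ + 1ℚ))) (sym (N-* u v)) ⟩
    N (u *ᵍ v) * (1ℚ + 1ℚ + (1ℚ + 1ℚ))
      ≤⟨ *-monoʳ-≤-nonNeg (1ℚ + 1ℚ + (1ℚ + 1ℚ)) (N≤∥∥² (u *ᵍ v)) ⟩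
    w * w * (1ℚ + 1ℚ + (1ℚ + 1ℚ))
      ≡⟨ solve 1 (λ w → w :* w :* con (1ℚ + 1ℚ + (1ℚ + 1ℚ)) := (w :+ w) :* (w :+ w)) refl w ⟩
    (w + w) * (w + w) ∎

-- Induction along Horner's scheme: if the inner value has norm at least 1, multiplying by r gives
-- norm at least ∥r∥/2 ≥ 1 + C, and adding a coefficient of norm at most C leaves 1. The loss in
-- `∥u∥∥v∥≤2∥uv∥` explains the doubled radius.
ev-lower : ∀ {n} (cs : Vec 𝔾 n) {C r} → coeffSum cs ≤ C →
  (1ℚ + C) + (1ℚ + C) ≤ ∥ r ∥ → 1ℚ ≤ ∥ ev cs r ∥
ev-lower []       S≤C C≤r = ≤-reflexive (sym ∥1ᵍ∥)
ev-lower (c ∷ cs) {C} {r} S≤C C≤r = ≤-cert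
  (((e - 1ℚ) * (1ℚ + C) + (∥ r ∥ - (1ℚ + C + (1ℚ + C))) * e * ½) +
    ((w + w - ∥ r ∥ * e) * ½ + ((∥ c +ᵍ r *ᵍ ev cs r ∥ + ∥ c ∥ - w) + (C - ∥ c ∥))))
  (+-nonneg
    (+-nonneg
      (0≤* (p≤q⇒0≤q-p (ev-lower cs (≤-trans (p≤q+p (0≤∥u∥ c)) S≤C) C≤r)) (+-nonneg (nonNegative⁻¹ 1ℚ) 0≤C))
      (0≤* (0≤* (p≤q⇒0≤q-p C≤r) (0≤∥u∥ (ev cs r))) (nonNegative⁻¹ ½)))
    (+-nonneg
      (0≤* (p≤q⇒0≤q-p (∥u∥∥v∥≤2∥uv∥ r (ev cs r))) (nonNegative⁻¹ ½))
      (+-nonneg (p≤q⇒0≤q-p w≤) (p≤q⇒0≤q-p c≤C))))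
  (solve 6 (λ e r w c C v → con 1ℚ :+ (((e :- con 1ℚ) :* (con 1ℚ :+ C) :+
      (r :- (con 1ℚ :+ C :+ (con 1ℚ :+ C))) :* e :* con ½) :+
    ((w :+ w :- r :* e) :* con ½ :+ ((v :+ c :- w) :+ (C :- c)))) := v) refl
    e (∥ r ∥) w (∥ c ∥) C (∥ c +ᵍ r *ᵍ ev cs r ∥))
  where
  e w : ℚ
  e = ∥ ev cs r ∥
  w = ∥ r *ᵍ ev cs r ∥
  c≤C : ∥ c ∥ ≤ C
  c≤C = ≤-trans (p≤p+q (0≤coeffSum cs)) S≤C
  0≤C : 0ℚ ≤ C
  0≤C = ≤-trans (0≤∥u∥ c) c≤C
  w≤ : w ≤ ∥ c +ᵍ r *ᵍ ev cs r ∥ + ∥ c ∥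
  w≤ = subst (λ t → ∥ t ∥ ≤ ∥ c +ᵍ r *ᵍ ev cs r ∥ + ∥ c ∥)
    (solveᵍ 2 (λ c p → (c :+ᵍ p) :-ᵍ c :=ᵍ p) refl c (r *ᵍ ev cs r))
    (∥u-v∥≤ (c +ᵍ r *ᵍ ev cs r) c)

rootBound : ∀ {n} → Vec 𝔾 n → ℚ
rootBound cs = (1ℚ + coeffSum cs) + (1ℚ + coeffSum cs)

∥root∥≤ : ∀ {n} (cs : Vec 𝔾 n) {r} → ∥ ev cs r ∥ < 1ℚ → ∥ r ∥ ≤ rootBound cs
∥root∥≤ cs {r} small = ≮⇒≥ λ B<r →
  <-irrefl {1ℚ} refl (≤-<-trans (ev-lower cs {coeffSum cs} ≤-refl (<⇒≤ B<r)) small)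

positive-min : ∀ {p q} → 0ℚ < p → 0ℚ < q → ∃[ m ] (0ℚ < m × m ≤ p × m ≤ q)
positive-min {p} {q} 0<p 0<q with ≤-total p q
... | inj₁ p≤q = p , 0<p , ≤-refl , p≤q
... | inj₂ q≤p = q , 0<q , q≤p , ≤-refl

-- Good singles out roots through their factor x - r, and Ok d v says that a
-- product v of d factors must contain a good one, even after a small error.
module _ (Good : 𝔾 → Set) (Ok : ℕ → 𝔾 → Set) (¬Ok₀ : ¬ Ok 0 1ᵍ)
  (peel : ∀ {d v} → Ok (suc d) v → ∃[ η ] (0ℚ < η ×
    (∀ {e a b} → ∥ e ∥ < η → a *ᵍ b ≡ v -ᵍ e → Good a ⊎ Ok d b)))
  where

  -- For an approximate root r of h with quotient h₁, (x - r) h₁(x) = h(x) - h(r) with h(r) tiny, so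
  -- either x - r is good or `Ok` passes to h₁(x). In the latter case a root s of h₁ found
  -- recursively is one of h, because h(s) = (s - r) h₁(s) + h(r).
  good-root : ∀ {d} (h : Vec 𝔾 d) {x} → Ok d (ev h x) → ∀ {ε} → 0ℚ < ε →
    ∃[ r ] (Good (x -ᵍ r) × ∥ ev h r ∥ < ε)
  good-root {zero}  []    ok 0<ε = ⊥-elim (¬Ok₀ ok)
  good-root {suc d} h {x} ok {ε} 0<ε = continue (split small-η factor)
    where
    η : ℚ
    η = proj₁ (peel ok)
    split : ∀ {e a b} → ∥ e ∥ < η → a *ᵍ b ≡ ev h x -ᵍ e → Good a ⊎ Ok d b
    split = proj₂ (proj₂ (peel ok))
    min₁ : ∃[ m ] (0ℚ < m × m ≤ η × m ≤ ε * ½)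
    min₁ = positive-min (proj₁ (proj₂ (peel ok))) (half-pos 0<ε)
    approximate : ∃[ r ] ∥ ev h r ∥ < proj₁ min₁
    approximate = approximate-root h (proj₁ (proj₂ min₁))
    r : 𝔾
    r = proj₁ approximate
    small-η : ∥ ev h r ∥ < η
    small-η = <-≤-trans (proj₂ approximate) (proj₁ (proj₂ (proj₂ min₁)))
    small-ε : ∥ ev h r ∥ < ε * ½
    small-ε = <-≤-trans (proj₂ approximate) (proj₂ (proj₂ (proj₂ min₁)))
    h₁ : Vec 𝔾 d
    h₁ = quo h r
    factor : (x -ᵍ r) *ᵍ ev h₁ x ≡ ev h x -ᵍ ev h r
    factor = trans (solveᵍ 2 (λ a b → a :=ᵍ a :+ᵍ b :-ᵍ b) refl ((x -ᵍ r) *ᵍ ev h₁ x) (ev h r))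
      (cong (_-ᵍ ev h r) (sym (ev-quo h x r)))
    continue : Good (x -ᵍ r) ⊎ Ok d (ev h₁ x) → ∃[ r ] (Good (x -ᵍ r) × ∥ ev h r ∥ < ε)
    continue (inj₁ good) = r , good , <-≤-trans small-ε
      (≤-trans (p≤p+q (<⇒≤ (half-pos 0<ε))) (≤-reflexive (half+half ε)))
    continue (inj₂ ok₁)  = s , proj₁ (proj₂ rest) ,
      subst₂ (λ u t → ∥ u ∥ < t) (sym (ev-quo h s r)) (half+half ε)
        (≤-<-trans (∥u+v∥≤ ((s -ᵍ r) *ᵍ ev h₁ s) (ev h r)) (+-mono-< close small-ε))
      where
      C : ℚ
      -- Bounds ∥s - r∥ for every s with ∥h₁(s)∥ < 1, so the accuracy demanded of s can be fixed
      -- before s is known.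
      C = rootBound h₁ + ∥ r ∥ + 1ℚ
      0<1+S : 0ℚ < 1ℚ + coeffSum h₁
      0<1+S = +-mono-<-≤ (positive⁻¹ 1ℚ) (0≤coeffSum h₁)
      0<C : 0ℚ < C
      0<C = +-mono-≤-< (+-nonneg (<⇒≤ (+-mono-< 0<1+S 0<1+S)) (0≤∥u∥ r)) (positive⁻¹ 1ℚ)
      scale : ∃[ δ ] (0ℚ < δ × C * δ ≡ ε * ½)
      scale = divide 0<C (half-pos 0<ε)
      min₂ : ∃[ m ] (0ℚ < m × m ≤ 1ℚ × m ≤ proj₁ scale)
      min₂ = positive-min (positive⁻¹ 1ℚ) (proj₁ (proj₂ scale))
      rest : ∃[ s ] (Good (x -ᵍ s) × ∥ ev h₁ s ∥ < proj₁ min₂)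
      rest = good-root h₁ ok₁ (proj₁ (proj₂ min₂))
      s : 𝔾
      s = proj₁ rest
      s-r≤C : ∥ s -ᵍ r ∥ ≤ C
      s-r≤C = ≤-trans (∥u-v∥≤ s r) (≤-trans
        (+-monoˡ-≤ ∥ r ∥ (∥root∥≤ h₁ (<-≤-trans (proj₂ (proj₂ rest)) (proj₁ (proj₂ (proj₂ min₂))))))
        (p≤p+q (nonNegative⁻¹ 1ℚ)))
      close : ∥ (s -ᵍ r) *ᵍ ev h₁ s ∥ < ε * ½
      close = ≤-<-trans (*-bound {s -ᵍ r} s-r≤C ≤-refl) (subst (C * ∥ ev h₁ s ∥ <_) (proj₂ (proj₂ scale))
        (*-monoʳ-<-pos C {{positive 0<C}} (<-≤-trans (proj₂ (proj₂ rest)) (proj₂ (proj₂ (proj₂ min₂))))))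

private
  dot≤ : ∀ a b p q → a * p + b * q ≤ (∣ a ∣ + ∣ b ∣) * (∣ p ∣ + ∣ q ∣)
  dot≤ a b p q = ≤-trans
    (+-mono-≤ (≤-trans (p≤∣p∣ (a * p)) (≤-reflexive (∣p*q∣≡∣p∣*∣q∣ a p)))
              (≤-trans (p≤∣p∣ (b * q)) (≤-reflexive (∣p*q∣≡∣p∣*∣q∣ b q))))
    (≤-cert (∣ a ∣ * ∣ q ∣ + ∣ b ∣ * ∣ p ∣)
      (+-nonneg (0≤* (0≤∣p∣ a) (0≤∣p∣ q)) (0≤* (0≤∣p∣ b) (0≤∣p∣ p)))
      (solve 4 (λ a b p q → a :* p :+ b :* q :+ (a :* q :+ b :* p) := (a :+ b) :* (p :+ q)) refl
        (∣ a ∣) (∣ b ∣) (∣ p ∣) (∣ q ∣)))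

N-+-upper : ∀ u v → N (u +ᵍ v) ≤ N u + (∥ u ∥ * ∥ v ∥ + ∥ u ∥ * ∥ v ∥ + ∥ v ∥ * ∥ v ∥)
N-+-upper u@(⟨ a , b ⟩) v@(⟨ p , q ⟩) = ≤-cert
  ((X - (a * p + b * q)) + (X - (a * p + b * q)) + (∥ v ∥ * ∥ v ∥ - N v))
  (+-nonneg (+-nonneg 0≤X 0≤X) (p≤q⇒0≤q-p (N≤∥∥² v)))
  (trans (cong₂ (λ s t → s + ((X - (a * p + b * q)) + (X - (a * p + b * q)) + (∥ v ∥ * ∥ v ∥ - t)))
      (N⟨,⟩ (a + p) (b + q)) (N⟨,⟩ p q))
    (trans (solve 6 (λ a b p q x y →
      (a :+ p) :* (a :+ p) :+ (b :+ q) :* (b :+ q) :+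
        ((x :- (a :* p :+ b :* q)) :+ (x :- (a :* p :+ b :* q)) :+ (y :- (p :* p :+ q :* q)))
      := a :* a :+ b :* b :+ (x :+ x :+ y)) refl a b p q X (∥ v ∥ * ∥ v ∥))
    (cong (_+ (X + X + ∥ v ∥ * ∥ v ∥)) (sym (N⟨,⟩ a b)))))
  where
  X : ℚ
  X = ∥ u ∥ * ∥ v ∥
  0≤X : 0ℚ ≤ X - (a * p + b * q)
  0≤X = p≤q⇒0≤q-p (subst (a * p + b * q ≤_) (sym (cong₂ _*_ (∥⟨,⟩∥ a b) (∥⟨,⟩∥ p q))) (dot≤ a b p q))

N--upper : ∀ u v → N (u -ᵍ v) ≤ N u + (∥ u ∥ * ∥ v ∥ + ∥ u ∥ * ∥ v ∥ + ∥ v ∥ * ∥ v ∥)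
N--upper u v = subst (λ t → N (u -ᵍ v) ≤ N u + (∥ u ∥ * t + ∥ u ∥ * t + t * t)) (∥-u∥≡ v) (N-+-upper u (negᵍ v))

N-lipschitz : ∀ v {e} → ∥ e ∥ ≤ 1ℚ →
  N (v -ᵍ e) ≤ N v + (∥ v ∥ + ∥ v ∥ + 1ℚ) * ∥ e ∥ ×
  N v ≤ N (v -ᵍ e) + (∥ v ∥ + ∥ v ∥ + (1ℚ + 1ℚ + 1ℚ)) * ∥ e ∥
N-lipschitz v {e} e≤1 =
    ≤-trans (N--upper v e) (≤-cert ((1ℚ - ∥ e ∥) * ∥ e ∥) (0≤* 0≤1-e 0≤e)
      (solve 3 (λ n v e → n :+ (v :* e :+ v :* e :+ e :* e) :+ (con 1ℚ :- e) :* e :=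
        n :+ (v :+ v :+ con 1ℚ) :* e) refl (N v) (∥ v ∥) (∥ e ∥)))
  , ≤-trans
      (subst (λ t → N t ≤ N (v -ᵍ e) + (∥ v -ᵍ e ∥ * ∥ e ∥ + ∥ v -ᵍ e ∥ * ∥ e ∥ + ∥ e ∥ * ∥ e ∥))
        (solveᵍ 2 (λ v e → (v :-ᵍ e) :+ᵍ e :=ᵍ v) refl v e)
        (N-+-upper (v -ᵍ e) e))
      (≤-cert (((∥ v ∥ + ∥ e ∥ - ∥ v -ᵍ e ∥) * ∥ e ∥ + (∥ v ∥ + ∥ e ∥ - ∥ v -ᵍ e ∥) * ∥ e ∥) +
          ((1ℚ - ∥ e ∥) * ∥ e ∥ + ((1ℚ - ∥ e ∥) * ∥ e ∥ + (1ℚ - ∥ e ∥) * ∥ e ∥)))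
        (+-nonneg (+-nonneg (0≤* 0≤v-e 0≤e) (0≤* 0≤v-e 0≤e))
          (+-nonneg (0≤* 0≤1-e 0≤e) (+-nonneg (0≤* 0≤1-e 0≤e) (0≤* 0≤1-e 0≤e))))
        (solve 4 (λ n v e w → n :+ (w :* e :+ w :* e :+ e :* e) :+
          (((v :+ e :- w) :* e :+ (v :+ e :- w) :* e) :+
            ((con 1ℚ :- e) :* e :+ ((con 1ℚ :- e) :* e :+ (con 1ℚ :- e) :* e)))
          := n :+ (v :+ v :+ (con 1ℚ :+ con 1ℚ :+ con 1ℚ)) :* e) refl (N (v -ᵍ e)) (∥ v ∥) (∥ e ∥) (∥ v -ᵍ e ∥)))
  where
  0≤e : 0ℚ ≤ ∥ e ∥
  0≤e = 0≤∥u∥ e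
  0≤1-e : 0ℚ ≤ 1ℚ - ∥ e ∥
  0≤1-e = p≤q⇒0≤q-p e≤1
  0≤v-e : 0ℚ ≤ ∥ v ∥ + ∥ e ∥ - ∥ v -ᵍ e ∥
  0≤v-e = p≤q⇒0≤q-p (∥u-v∥≤ v e)

N-continuous : ∀ v {η} → 0ℚ < η → ∃[ ε ] (0ℚ < ε ×
  (∀ {e} → ∥ e ∥ < ε → N (v -ᵍ e) < N v + η × N v < N (v -ᵍ e) + η))
N-continuous v {η} 0<η = proj₁ min , proj₁ (proj₂ min) , λ {e} e<ε →
  let (up , down) = N-lipschitz v {e} (<⇒≤ (<-≤-trans e<ε (proj₁ (proj₂ (proj₂ min)))))
      Ce<η = subst (C * ∥ e ∥ <_) (proj₂ (proj₂ scale))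
        (*-monoʳ-<-pos C {{positive 0<C}} (<-≤-trans e<ε (proj₂ (proj₂ (proj₂ min)))))
  in ≤-<-trans up (+-monoʳ-< (N v) (≤-<-trans
       (*-monoʳ-≤-nonNeg ∥ e ∥ {{nonNegative (0≤∥u∥ e)}} {∥ v ∥ + ∥ v ∥ + 1ℚ} {C}
         (+-monoʳ-≤ (∥ v ∥ + ∥ v ∥) (≤ᵇ⇒≤ _))) Ce<η))
   , ≤-<-trans down (+-monoʳ-< (N (v -ᵍ e)) Ce<η)
  where
  C : ℚ
  C = ∥ v ∥ + ∥ v ∥ + (1ℚ + 1ℚ + 1ℚ)
  0<C : 0ℚ < C
  0<C = +-mono-≤-< (+-nonneg (0≤∥u∥ v) (0≤∥u∥ v)) (positive⁻¹ (1ℚ + 1ℚ + 1ℚ))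
  scale : ∃[ δ ] (0ℚ < δ × C * δ ≡ η)
  scale = divide 0<C 0<η
  min : ∃[ m ] (0ℚ < m × m ≤ 1ℚ × m ≤ proj₁ scale)
  min = positive-min (positive⁻¹ 1ℚ) (proj₁ (proj₂ scale))

-- Roots far from a point and roots near it

infixr 8 _^ℚ_

_^ℚ_ : ℚ → ℕ → ℚ
t ^ℚ zero  = 1ℚ
t ^ℚ suc n = t * t ^ℚ n

0<^ℚ : ∀ {t} n → 0ℚ < t → 0ℚ < t ^ℚ n
0<^ℚ zero    0<t = positive⁻¹ 1ℚ
0<^ℚ (suc n) 0<t = pos-* 0<t (0<^ℚ n 0<t)

a<b⇒gap : ∀ {a b} → a < b → a + (b - a) ≡ b
a<b⇒gap {a} {b} _ = solve 2 (λ a b → a :+ (b :- a) := b) refl a b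

-- N (h x) is morally the product of N (x - r) over the d roots r, so these factors cannot all be
-- below t.
large-root : ∀ {d t} → 0ℚ < t → (h : Vec 𝔾 d) {x : 𝔾} → t ^ℚ d < N (ev h x) → ∀ {ε} → 0ℚ < ε →
  ∃[ r ] (t ≤ N (x -ᵍ r) × ∥ ev h r ∥ < ε)
large-root {t = t} 0<t = good-root (λ a → t ≤ N a) (λ d v → t ^ℚ d < N v)
  (λ 1<N → <-irrefl {1ℚ} refl (subst (1ℚ <_) (N⟨,⟩ 1ℚ 0ℚ) 1<N))
  λ {d} {v} t^<N → let (η , 0<η , near) = N-continuous v (p<q⇒0<q-p t^<N) in
    η , 0<η , λ {e} {a} {b} e<η ab≡ →
      let t^<ab = subst (t ^ℚ suc d <_) (trans (cong N (sym ab≡)) (N-* a b))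
            (≰⇒> λ N≤ → <-irrefl {N v} refl (<-≤-trans (proj₂ (near {e} e<η))
              (≤-trans (+-monoˡ-≤ (N v - t ^ℚ suc d) N≤) (≤-reflexive (a<b⇒gap t^<N)))))
      in case (t ≤? N a) of λ
        { (yes t≤a) → inj₁ t≤a
        ; (no t≰a)  → inj₂ (≰⇒> λ b≤ → <-irrefl {t ^ℚ suc d} refl (<-≤-trans t^<ab
            (*-mono-nonNeg (0≤N b) (<⇒≤ 0<t) (<⇒≤ (≰⇒> t≰a)) b≤))) }

-- Dual to `large-root`: the factors N (x - r) cannot all be at least s.
near-root : ∀ {d s} → 0ℚ < s → (h : Vec 𝔾 d) {x : 𝔾} → N (ev h x) < s ^ℚ d → ∀ {ε} → 0ℚ < ε →
  ∃[ r ] (N (x -ᵍ r) < s × ∥ ev h r ∥ < ε)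
near-root {s = s} 0<s = good-root (λ a → N a < s) (λ d v → N v < s ^ℚ d)
  (λ N<1 → <-irrefl {1ℚ} refl (subst (_< 1ℚ) (N⟨,⟩ 1ℚ 0ℚ) N<1))
  λ {d} {v} N<s^ → let (η , 0<η , near) = N-continuous v (p<q⇒0<q-p N<s^) in
    η , 0<η , λ {e} {a} {b} e<η ab≡ →
      let ab<s^ = subst (_< s ^ℚ suc d) (trans (cong N (sym ab≡)) (N-* a b))
            (<-≤-trans (proj₁ (near {e} e<η)) (≤-reflexive (a<b⇒gap N<s^)))
      in case (N a <? s) of λ
        { (yes a<s) → inj₁ a<s
        ; (no a≮s)  → inj₂ (≰⇒> λ ≤b → <-irrefl {N a * N b} refl (<-≤-trans ab<s^
            (*-mono-nonNeg (<⇒≤ (0<^ℚ d 0<s)) (0≤N a) (≮⇒≥ a≮s) ≤b))) }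

-- `Away` is apartness from 0, the positive counterpart of `¬ Null`. None of the three presupposes
-- convergence: they are also applied to sequences of approximate roots that may alternate between
-- different roots.
Null Bounded Away : (ℕ → 𝔾) → Set
Null u    = ∀ ε → 0ℚ < ε → Eventually (λ k → ∥ u k ∥ < ε)
Bounded u = ∃[ B ] (0ℚ < B × Eventually (λ k → ∥ u k ∥ ≤ B))
Away u    = ∃[ γ ] (0ℚ < γ × Eventually (λ k → γ ≤ ∥ u k ∥))

CauchyNorm : (ℕ → 𝔾) → Set
CauchyNorm u = ∀ ε → 0ℚ < ε → ∃[ K ] ∀ k l → K ℕ.≤ k → K ℕ.≤ l → ∥ u k -ᵍ u l ∥ < ε

eventually-map : ∀ {P Q : ℕ → Set} → (∀ {k} → P k → Q k) → Eventually P → Eventually Q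
eventually-map f (K , p) = K , λ k K≤k → f (p k K≤k)

eventually-× : ∀ {P Q : ℕ → Set} → Eventually P → Eventually Q → Eventually (λ k → P k × Q k)
eventually-× (K , p) (L , q) = K ℕ.⊔ L , λ k ≤k →
  p k (ℕP.m⊔n≤o⇒m≤o K L ≤k) , q k (ℕP.m⊔n≤o⇒n≤o K L ≤k)

N<σ²⇒∥∥≤2σ : ∀ {u σ} → 0ℚ < σ → N u < σ * σ → ∥ u ∥ ≤ σ + σ
N<σ²⇒∥∥≤2σ {u} {σ} 0<σ N<σ² = <⇒≤ (²-cancel-< (<⇒≤ (+-mono-< 0<σ 0<σ)) (begin-strict
  ∥ u ∥ * ∥ u ∥                                ≤⟨ ∥∥²≤2N u ⟩
  N u + N u                                    <⟨ +-mono-< N<σ² N<σ² ⟩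
  σ * σ + σ * σ                                ≤⟨ p≤p+q (+-nonneg (0≤p² σ) (0≤p² σ)) ⟩
  (σ * σ + σ * σ) + (σ * σ + σ * σ)
    ≡⟨ solve 1 (λ s → s :* s :+ s :* s :+ (s :* s :+ s :* s) := (s :+ s) :* (s :+ s)) refl σ ⟩
  (σ + σ) * (σ + σ)                            ∎))
  where open ≤-Reasoning

module _ {n} (h : Vec 𝔾 n) (x₀ : 𝔾) {σ} (0<σ : 0ℚ < σ) (small : N (ev h x₀) < (σ * σ) ^ℚ n) where

  private
    σ⟨_⟩ : ℕ → ℚ
    σ⟨ k ⟩ = σ * ½^ k

    0<σ⟨⟩ : ∀ k → 0ℚ < σ⟨ k ⟩
    0<σ⟨⟩ k = pos-* 0<σ (0<½^ k)

    0<σ² : ∀ k → 0ℚ < σ⟨ k ⟩ * σ⟨ k ⟩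
    0<σ² k = pos-* (0<σ⟨⟩ k) (0<σ⟨⟩ k)

    -- The invariant that lets `near-root` produce a next point within 2 σ⟨ k ⟩. That point is
    -- computed to the accuracy `tolerance k`, small enough to restore the invariant at k + 1 and to
    -- make the values of h null.
    Stage : ℕ → Set
    Stage k = ∃[ x ] N (ev h x) < (σ⟨ k ⟩ * σ⟨ k ⟩) ^ℚ n

    tolerance : ∀ k → ∃[ m ] (0ℚ < m × m ≤ 1ℚ × m ≤ (σ⟨ suc k ⟩ * σ⟨ suc k ⟩) ^ℚ n × m ≤ ½^ k)
    tolerance k =
      let (m , 0<m , m≤a , m≤b) = positive-min (0<^ℚ n (0<σ² (suc k))) (0<½^ k)
          (l , 0<l , l≤1 , l≤m) = positive-min (positive⁻¹ 1ℚ) 0<m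
      in l , 0<l , l≤1 , ≤-trans l≤m m≤a , ≤-trans l≤m m≤b

    refinement : ∀ k ((x , _) : Stage k) →
      ∃[ r ] (N (x -ᵍ r) < σ⟨ k ⟩ * σ⟨ k ⟩ × ∥ ev h r ∥ < proj₁ (tolerance k))
    refinement k (x , p) = near-root (0<σ² k) h p (proj₁ (proj₂ (tolerance k)))

    stage : ∀ k → Stage k
    stage zero    = x₀ , subst (λ t → N (ev h x₀) < (t * t) ^ℚ n) (sym (*-identityʳ σ)) small
    stage (suc k) =
      let (r , _ , hr<) = refinement k (stage k)
          (m , _ , m≤1 , m≤σ , _) = tolerance k
      in r , ≤-<-trans (N≤∥∥² (ev h r)) (<-≤-trans
          (≤-<-trans (*-monoʳ-≤-nonNeg ∥ ev h r ∥ {{nonNegative (0≤∥u∥ (ev h r))}} (<⇒≤ (<-≤-trans hr< m≤1)))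
            (subst (_< m) (sym (*-identityˡ ∥ ev h r ∥)) hr<)) m≤σ)

    x : ℕ → 𝔾
    x k = proj₁ (stage k)

    consecutive : ∀ k → ∥ x k -ᵍ x (suc k) ∥ ≤ σ⟨ k ⟩ + σ⟨ k ⟩
    consecutive k = N<σ²⇒∥∥≤2σ {x k -ᵍ x (suc k)} (0<σ⟨⟩ k) (proj₁ (proj₂ (refinement k (stage k))))

    4× : ℚ → ℚ
    4× p = p + p + (p + p)

    -- Each step is at most 2 σ⟨ k ⟩ = 4 σ⟨ k ⟩ - 4 σ⟨ k + 1 ⟩; this is the geometric series in
    -- telescoped form.
    telescope : ∀ m k → ∥ x k -ᵍ x (m ℕ.+ k) ∥ ≤ 4× σ⟨ k ⟩ - 4× σ⟨ m ℕ.+ k ⟩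
    telescope zero    k = ≤-reflexive (trans
      (sym (0≡∥u∥ (solveᵍ 1 (λ x → x :-ᵍ x :=ᵍ conᵍ 0ᵍ) refl (x k))))
      (sym (+-inverseʳ (4× σ⟨ k ⟩))))
    telescope (suc m) k = subst₂ (λ u t → ∥ u ∥ ≤ t)
      (solveᵍ 3 (λ x y z → (x :-ᵍ y) :+ᵍ (y :-ᵍ z) :=ᵍ x :-ᵍ z) refl
        (x k) (x (m ℕ.+ k)) (x (suc m ℕ.+ k)))
      (solve 3 (λ a s h → a :- (s :* h :+ s :* h :+ (s :* h :+ s :* h)) :+ (s :* h :+ s :* h) :=
        a :- (s :* (h :* con ½) :+ s :* (h :* con ½) :+ (s :* (h :* con ½) :+ s :* (h :* con ½)))) refl
        (4× σ⟨ k ⟩) σ (½^ (m ℕ.+ k)))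
      (+-bound (telescope m k) (consecutive (m ℕ.+ k)))

    close : ∀ {k l} → k ℕ.≤ l → ∥ x k -ᵍ x l ∥ ≤ 4× σ⟨ k ⟩
    close {k} {l} k≤l = subst (λ j → ∥ x k -ᵍ x j ∥ ≤ 4× σ⟨ k ⟩) (ℕP.m∸n+n≡m k≤l)
      (≤-trans (telescope (l ℕ.∸ k) k) (≤-cert (4× σ⟨ l ℕ.∸ k ℕ.+ k ⟩)
        (+-nonneg (+-nonneg 0≤σ 0≤σ) (+-nonneg 0≤σ 0≤σ))
        (solve 2 (λ a b → a :- b :+ b := a) refl (4× σ⟨ k ⟩) (4× σ⟨ l ℕ.∸ k ℕ.+ k ⟩))))
      where
      0≤σ : 0ℚ ≤ σ⟨ l ℕ.∸ k ℕ.+ k ⟩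
      0≤σ = <⇒≤ (0<σ⟨⟩ (l ℕ.∸ k ℕ.+ k))

    cauchy-norm : ∀ ε → 0ℚ < ε → ∃[ K ] ∀ k l → K ℕ.≤ k → K ℕ.≤ l → ∥ x k -ᵍ x l ∥ < ε
    cauchy-norm ε 0<ε =
      let (K , p) = small½^ {4× σ + 4× σ} (+-mono-< 0<4σ 0<4σ) 0<ε
      in K , λ k l K≤k K≤l → ≤-<-trans
        (subst (λ u → ∥ u ∥ ≤ 4× σ⟨ K ⟩ + 4× σ⟨ K ⟩)
          (solveᵍ 3 (λ x y z → (x :-ᵍ y) :-ᵍ (x :-ᵍ z) :=ᵍ z :-ᵍ y)
            refl (x K) (x l) (x k))
          (≤-trans (∥u-v∥≤ (x K -ᵍ x l) (x K -ᵍ x k)) (+-mono-≤ (close K≤l) (close K≤k))))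
        (subst (_< ε)
          (solve 2 (λ s h → (s :+ s :+ (s :+ s) :+ (s :+ s :+ (s :+ s))) :* h :=
            s :* h :+ s :* h :+ (s :* h :+ s :* h) :+ (s :* h :+ s :* h :+ (s :* h :+ s :* h))) refl σ (½^ K))
          (p K ℕP.≤-refl))
      where
      0<4σ : 0ℚ < 4× σ
      0<4σ = +-mono-< (+-mono-< 0<σ 0<σ) (+-mono-< 0<σ 0<σ)

  nearby-root : ∃[ x ] (IsCauchy (λ k → Re (x k)) × IsCauchy (λ k → Im (x k)) ×
    Null (λ k → ev h (x k)) × (∀ k → ∥ x₀ -ᵍ x k ∥ ≤ σ + σ + (σ + σ)))
  nearby-root = x
    , (λ ε 0<ε → let (K , p) = cauchy-norm ε 0<ε in K , λ k l K≤k K≤l →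
        ≤-<-trans (subst (λ t → ∣ t ∣ ≤ ∥ x k -ᵍ x l ∥) (Re-- (x k) (x l)) (∣Re∣≤∥∥ (x k -ᵍ x l))) (p k l K≤k K≤l))
    , (λ ε 0<ε → let (K , p) = cauchy-norm ε 0<ε in K , λ k l K≤k K≤l →
        ≤-<-trans (subst (λ t → ∣ t ∣ ≤ ∥ x k -ᵍ x l ∥) (Im-- (x k) (x l)) (∣Im∣≤∥∥ (x k -ᵍ x l))) (p k l K≤k K≤l))
    -- The point of stage k + 1 obeys the tolerance of stage k, hence the shift to `suc K`.
    , (λ ε 0<ε → let (K , p) = small½^ {1ℚ} (positive⁻¹ 1ℚ) 0<ε in suc K , λ where
        (suc k) (ℕ.s≤s K≤k) → <-trans
          (<-≤-trans (proj₂ (proj₂ (refinement k (stage k)))) (proj₂ (proj₂ (proj₂ (proj₂ (tolerance k))))))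
          (subst (_< ε) (*-identityˡ (½^ k)) (p k K≤k)))
    , λ k → subst (λ t → ∥ x₀ -ᵍ x k ∥ ≤ 4× t) (*-identityʳ σ) (close {0} {k} ℕ.z≤n)

-- Sequences of Gaussian rationals

null-cong : ∀ {u v} → (∀ k → u k ≡ v k) → Null u → Null v
null-cong u≡v nu ε 0<ε = let (K , p) = nu ε 0<ε in
  K , λ k K≤k → subst (λ t → ∥ t ∥ < ε) (u≡v k) (p k K≤k)

away-cong : ∀ {u v} → (∀ k → u k ≡ v k) → Away u → Away v
away-cong u≡v (γ , 0<γ , K , a) = γ , 0<γ , K , λ k K≤k → subst (λ t → γ ≤ ∥ t ∥) (u≡v k) (a k K≤k)

null-+ : ∀ {u v} → Null u → Null v → Null (λ k → u k +ᵍ v k)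
null-+ {u} {v} nu nv ε 0<ε = eventually-map
  (λ {k} (p , q) → ≤-<-trans (∥u+v∥≤ (u k) (v k)) (subst (∥ u k ∥ + ∥ v k ∥ <_) (half+half ε) (+-mono-< p q)))
  (eventually-× (nu (ε * ½) (half-pos 0<ε)) (nv (ε * ½) (half-pos 0<ε)))

null-neg : ∀ {u} → Null u → Null (λ k → negᵍ (u k))
null-neg {u} nu ε 0<ε = eventually-map (λ {k} → subst (_< ε) (sym (∥-u∥≡ (u k)))) (nu ε 0<ε)

null-* : ∀ {u v} → Bounded u → Null v → Null (λ k → u k *ᵍ v k)
null-* {u} {v} (B , 0<B , bu) nv ε 0<ε =
  let (δ , 0<δ , Bδ≡ε) = divide 0<B 0<ε
  in eventually-map
    (λ {k} (p , q) → ≤-<-trans (*-bound {u k} p ≤-refl)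
      (subst (B * ∥ v k ∥ <_) Bδ≡ε (*-monoʳ-<-pos B {{positive 0<B}} q)))
    (eventually-× bu (nv δ 0<δ))

bounded-+ : ∀ {u v} → Bounded u → Bounded v → Bounded (λ k → u k +ᵍ v k)
bounded-+ {u} {v} (B , 0<B , bu) (C , 0<C , bv) = B + C , +-mono-< 0<B 0<C ,
  eventually-map (λ {k} (p , q) → +-bound {u k} p q) (eventually-× bu bv)

bounded-neg : ∀ {u} → Bounded u → Bounded (λ k → negᵍ (u k))
bounded-neg {u} (B , 0<B , bu) = B , 0<B , eventually-map (λ {k} → neg-bound {u k}) bu

bounded-const : ∀ c → Bounded (λ _ → c)
bounded-const c = ∥ c ∥ + 1ℚ , +-mono-≤-< (0≤∥u∥ c) (positive⁻¹ 1ℚ) , 0 , λ _ _ → p≤p+q (nonNegative⁻¹ 1ℚ)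

away-cancel : ∀ {u v} → Away u → Null (λ k → u k *ᵍ v k) → Null v
away-cancel {u} {v} (γ , 0<γ , au) nuv ε 0<ε = eventually-map
  (λ {k} (p , q) → *-cancelˡ-<-nonNeg γ {{nonNegative (<⇒≤ 0<γ)}} (≤-<-trans
    (≤-trans (*-monoʳ-≤-nonNeg ∥ v k ∥ {{nonNegative (0≤∥u∥ (v k))}} p) (∥u∥∥v∥≤2∥uv∥ (u k) (v k)))
    (subst (∥ u k *ᵍ v k ∥ + ∥ u k *ᵍ v k ∥ <_) (half+half (γ * ε)) (+-mono-< q q))))
  (eventually-× au (nuv (γ * ε * ½) (half-pos (pos-* 0<γ 0<ε))))

away-factor : ∀ {e v c} → Null e → Bounded c → Away (λ k → e k +ᵍ v k *ᵍ c k) → Away v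
away-factor {e} {v} {c} ne (B , 0<B , bc) (γ , 0<γ , a) =
  let (δ , 0<δ , Bδ≡) = divide 0<B (half-pos 0<γ)
  in δ , 0<δ , eventually-map
    (λ {k} (p , q , r) → ≮⇒≥ λ v<δ → <-irrefl {γ} refl (≤-<-trans p (≤-<-trans (∥u+v∥≤ (e k) (v k *ᵍ c k))
      (subst (∥ e k ∥ + ∥ v k *ᵍ c k ∥ <_) (half+half γ) (+-mono-<-≤ q
        (≤-trans (*-bound {v k} (<⇒≤ v<δ) r) (≤-reflexive (trans (*-comm δ B) Bδ≡))))))))
    (eventually-× a (eventually-× (ne (γ * ½) (half-pos 0<γ)) bc))

-- Depends on the degree and on bounds only, since the polynomials to be estimated vary with k and
-- need one bound for all late k.
evBound : ℕ → ℚ → ℚ → ℚ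
evBound zero    C Y = 1ℚ
evBound (suc n) C Y = C + Y * evBound n C Y

∥ev∥≤ : ∀ {n} (cs : Vec 𝔾 n) {y C Y} → coeffSum cs ≤ C → ∥ y ∥ ≤ Y → ∥ ev cs y ∥ ≤ evBound n C Y
∥ev∥≤ []       S≤C y≤Y = ≤-reflexive ∥1ᵍ∥
∥ev∥≤ (c ∷ cs) {y} S≤C y≤Y = +-bound {c} (≤-trans (p≤p+q (0≤coeffSum cs)) S≤C)
  (*-bound {y} y≤Y (∥ev∥≤ cs (≤-trans (p≤q+p (0≤∥u∥ c)) S≤C) y≤Y))

quoBound : ℕ → ℚ → ℚ → ℚ
quoBound zero    C Y = 0ℚ
quoBound (suc n) C Y = evBound (suc n) C Y + quoBound n C Y

coeffSum-quo≤ : ∀ {n} (cs : Vec 𝔾 (suc n)) {y C Y} → coeffSum cs ≤ C → ∥ y ∥ ≤ Y →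
  coeffSum (quo cs y) ≤ quoBound n C Y
coeffSum-quo≤ {zero}  (c ∷ []) S≤C y≤Y = ≤-refl
coeffSum-quo≤ {suc n} (c ∷ cs) S≤C y≤Y =
  let S′≤C = ≤-trans (p≤q+p (0≤∥u∥ c)) S≤C
  in +-mono-≤ (∥ev∥≤ cs S′≤C y≤Y) (coeffSum-quo≤ cs S′≤C y≤Y)

BoundedCoeffs : ∀ {n} → (ℕ → Vec 𝔾 n) → Set
BoundedCoeffs P = ∃[ C ] Eventually (λ k → coeffSum (P k) ≤ C)

p≤∣p∣+1 : ∀ p → p ≤ ∣ p ∣ + 1ℚ
p≤∣p∣+1 p = ≤-trans (p≤∣p∣ p) (p≤p+q (nonNegative⁻¹ 1ℚ))

bounded-by : ∀ {u B} → Eventually (λ k → ∥ u k ∥ ≤ B) → Bounded u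
bounded-by {u} {B} bu = ∣ B ∣ + 1ℚ , +-mono-≤-< (0≤∣p∣ B) (positive⁻¹ 1ℚ) ,
  eventually-map (λ p → ≤-trans p (p≤∣p∣+1 B)) bu

bounded-ev : ∀ {n} (P : ℕ → Vec 𝔾 n) (y : ℕ → 𝔾) → BoundedCoeffs P → Bounded y → Bounded (λ k → ev (P k) (y k))
bounded-ev P y (C , bP) (Y , _ , by) =
  bounded-by (eventually-map (λ {k} (p , q) → ∥ev∥≤ (P k) p q) (eventually-× bP by))

boundedCoeffs-quo : ∀ {n} (P : ℕ → Vec 𝔾 (suc n)) (y : ℕ → 𝔾) → BoundedCoeffs P → Bounded y →
  BoundedCoeffs (λ k → quo (P k) (y k))
boundedCoeffs-quo P y (C , bP) (Y , _ , by) = _ ,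
  eventually-map (λ {k} (p , q) → coeffSum-quo≤ (P k) p q) (eventually-× bP by)

bounded-root : ∀ {n} (P : ℕ → Vec 𝔾 n) (r : ℕ → 𝔾) → BoundedCoeffs P → Null (λ k → ev (P k) (r k)) → Bounded r
bounded-root P r (C , bP) nr = bounded-by (eventually-map
  (λ {k} (p , q) → ≤-trans (∥root∥≤ (P k) q) (+-mono-≤ (+-monoʳ-≤ 1ℚ p) (+-monoʳ-≤ 1ℚ p)))
  (eventually-× bP (nr 1ℚ (positive⁻¹ 1ℚ))))

-- The quotient at x, multiplied by x - y, is P(x) - P(y), which is null; the apart factor x - y can
-- be cancelled.
quo-null : ∀ {n} (P : ℕ → Vec 𝔾 (suc n)) (x y : ℕ → 𝔾) →
  Null (λ k → ev (P k) (y k)) → Null (λ k → ev (P k) (x k)) → Away (λ k → x k -ᵍ y k) →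
  Null (λ k → ev (quo (P k) (y k)) (x k))
quo-null P x y ny nx a = away-cancel {λ k → x k -ᵍ y k} {λ k → ev (quo (P k) (y k)) (x k)} a
  (null-cong {λ k → ev (P k) (x k) -ᵍ ev (P k) (y k)}
    (λ k → trans (cong (_-ᵍ ev (P k) (y k)) (ev-quo (P k) (x k) (y k)))
      (solveᵍ 2 (λ a b → a :+ᵍ b :-ᵍ b :=ᵍ a) refl ((x k -ᵍ y k) *ᵍ ev (quo (P k) (y k)) (x k)) (ev (P k) (y k))))
    (null-+ nx (null-neg ny)))

quo-null⁻¹ : ∀ {n} (P : ℕ → Vec 𝔾 (suc n)) (x y : ℕ → 𝔾) → Bounded (λ k → x k -ᵍ y k) →
  Null (λ k → ev (quo (P k) (y k)) (x k)) → Null (λ k → ev (P k) (y k)) → Null (λ k → ev (P k) (x k))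
quo-null⁻¹ P x y b nq ny =
  null-cong {λ k → (x k -ᵍ y k) *ᵍ ev (quo (P k) (y k)) (x k) +ᵍ ev (P k) (y k)}
    (λ k → sym (ev-quo (P k) (x k) (y k)))
    (null-+ (null-* b nq) ny)

constant-not-null : ∀ (P : ℕ → Vec 𝔾 0) (x : ℕ → 𝔾) → ¬ Null (λ k → ev (P k) (x k))
constant-not-null P x n with n 1ℚ (positive⁻¹ 1ℚ)
... | K , p with P K | p K ℕP.≤-refl
...   | [] | 1<1 = <-irrefl {1ℚ} refl (subst (_< 1ℚ) ∥1ᵍ∥ 1<1)

^ℚ-mono : ∀ {s t} n → 0ℚ ≤ s → s ≤ t → s ^ℚ n ≤ t ^ℚ n
^ℚ-mono zero    0≤s s≤t = ≤-refl
^ℚ-mono {s} {t} (suc n) 0≤s s≤t = *-mono-nonNeg (0≤^ n) (≤-trans 0≤s s≤t) s≤t (^ℚ-mono n 0≤s s≤t)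
  where
  0≤^ : ∀ n → 0ℚ ≤ s ^ℚ n
  0≤^ zero    = nonNegative⁻¹ 1ℚ
  0≤^ (suc n) = 0≤* 0≤s (0≤^ n)

-- Continuity of t ↦ tᵈ at 1. It serves to deduce, from a product of d factors exceeding c, a factor
-- bounded away from 1 by a fixed amount. The induction spends half of the remaining gap on the new
-- factor.
small-power : ∀ d {c} → 1ℚ < c → ∃[ δ ] (0ℚ < δ × (1ℚ + δ) ^ℚ d < c)
small-power zero    1<c = 1ℚ , positive⁻¹ 1ℚ , 1<c
small-power (suc d) {c} 1<c =
  let (δ , 0<δ , x<c) = small-power d 1<c
      0<1+δ = +-mono-< (positive⁻¹ 1ℚ) 0<δ
      x = (1ℚ + δ) ^ℚ d
      0<x = 0<^ℚ d 0<1+δ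
      0<gap = half-pos (p<q⇒0<q-p x<c)
      (η , 0<η , xη≡) = divide 0<x 0<gap
      (m , 0<m , m≤δ , m≤η) = positive-min 0<δ 0<η
      0≤1+m = <⇒≤ (+-mono-< (positive⁻¹ 1ℚ) 0<m)
  in m , 0<m , ≤-<-trans
    (*-mono-nonNeg (<⇒≤ (0<^ℚ d (+-mono-< (positive⁻¹ 1ℚ) 0<m))) (≤-trans 0≤1+m (+-monoʳ-≤ 1ℚ m≤η)) (+-monoʳ-≤ 1ℚ m≤η)
      (^ℚ-mono d 0≤1+m (+-monoʳ-≤ 1ℚ m≤δ)))
    (<-cert ((c - x) * ½) 0<gap
      (trans (solve 3 (λ n x c → (con 1ℚ :+ n) :* x :+ (c :- x) :* con ½ := x :* n :+ x :+ (c :- x) :* con ½) refl η x c)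
        (trans (cong (λ t → t + x + (c - x) * ½) xη≡)
          (solve 2 (λ x c → (c :- x) :* con ½ :+ x :+ (c :- x) :* con ½ := c) refl x c))))

N-small : ∀ {T} → 0ℚ < T → ∃[ ε ] (0ℚ < ε × (∀ {u} → ∥ u ∥ < ε → N u < T))
N-small {T} 0<T =
  let (m , 0<m , m≤1 , m≤T) = positive-min (positive⁻¹ 1ℚ) 0<T
  in m , 0<m , λ {u} u<m → ≤-<-trans (N≤∥∥² u) (≤-<-trans
       (*-monoʳ-≤-nonNeg ∥ u ∥ {{nonNegative (0≤∥u∥ u)}} (<⇒≤ (<-≤-trans u<m m≤1)))
       (subst (_< T) (sym (*-identityˡ ∥ u ∥)) (<-≤-trans u<m m≤T)))

-- The data of a complex number that violates the Pisot condition. The last two clauses are mere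
-- negations: they exclude the modulus bound and equality with q, which is all that a contradiction
-- uses.
IsOuterRoot : ∀ {n} → Vec 𝔾 n → (ℕ → 𝔾) → (ℕ → 𝔾) → Set
IsOuterRoot f q ξ =
  IsCauchy (λ k → Re (ξ k)) × IsCauchy (λ k → Im (ξ k)) × Null (λ k → ev f (ξ k)) ×
  ¬ Eventually (λ k → N (ξ k) < 1ℚ) × ¬ Null (λ k → ξ k -ᵍ q k)

-- The sequence r need not converge. One sufficiently late r k is taken as a starting point for
-- `nearby-root`, whose limit stays so close to r k that it inherits being outside the disc and
-- apart from q.
outer-root-near : ∀ {n} (f : Vec 𝔾 n) (q r : ℕ → 𝔾) {t} → CauchyNorm q → 1ℚ < t →
  Eventually (λ k → t ≤ N (r k)) → Null (λ k → ev f (r k)) → Away (λ k → r k -ᵍ q k) →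
  ∃[ ξ ] IsOuterRoot f q ξ
outer-root-near {n} f q r {t} cq 1<t (K₁ , tr) nr (τ , 0<τ , K₂ , τr) =
  ξ , cRe , cIm , null-ξ , outside , apart
  where
  -- If ξ had N < 1, then its norm would be at most 2, and N (r k) < 1 + 2m + 2m + m; hence 5m < t -
  -- 1. The bound m ≤ τ/2 leaves two quarters of τ for the distances from ξ j to q j and from q j to
  -- q k.
  step : ∃[ m ] (0ℚ < m × m ≤ 1ℚ × m * (+ 5 / 1) < t - 1ℚ × m ≤ τ * ½)
  step =
    let (a , 0<a , 5a≡) = divide (positive⁻¹ (+ 5 / 1)) (half-pos (p<q⇒0<q-p 1<t))
        (b , 0<b , b≤a , b≤τ) = positive-min 0<a (half-pos 0<τ)
        (m , 0<m , m≤1 , m≤b) = positive-min (positive⁻¹ 1ℚ) 0<b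
    in m , 0<m , m≤1 ,
       ≤-<-trans (≤-trans (*-monoʳ-≤-nonNeg (+ 5 / 1) (≤-trans m≤b b≤a)) (≤-reflexive (trans (*-comm a (+ 5 / 1)) 5a≡)))
         (<-cert ((t - 1ℚ) * ½) (half-pos (p<q⇒0<q-p 1<t)) (half+half (t - 1ℚ))) ,
       ≤-trans m≤b b≤τ
  m σ : ℚ
  m = proj₁ step
  σ = m * ½ * ½
  0<m : 0ℚ < m
  0<m = proj₁ (proj₂ step)
  m≤1 : m ≤ 1ℚ
  m≤1 = proj₁ (proj₂ (proj₂ step))
  0<σ : 0ℚ < σ
  0<σ = half-pos (half-pos 0<m)
  4σ≡m : σ + σ + (σ + σ) ≡ m
  4σ≡m = solve 1 (λ m → m :* con ½ :* con ½ :+ m :* con ½ :* con ½ :+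
    (m :* con ½ :* con ½ :+ m :* con ½ :* con ½) := m) refl m
  tiny : ∃[ ε ] (0ℚ < ε × (∀ {u} → ∥ u ∥ < ε → N u < (σ * σ) ^ℚ n))
  tiny = N-small (0<^ℚ n (pos-* 0<σ 0<σ))
  small : Eventually (λ k → ∥ ev f (r k) ∥ < proj₁ tiny)
  small = nr (proj₁ tiny) (proj₁ (proj₂ tiny))
  0<¼τ : 0ℚ < τ * ½ * ½
  0<¼τ = half-pos (half-pos 0<τ)
  near : ∃[ K ] ∀ k l → K ℕ.≤ k → K ℕ.≤ l → ∥ q k -ᵍ q l ∥ < τ * ½ * ½
  near = cq (τ * ½ * ½) 0<¼τ
  k : ℕ
  k = K₁ ℕ.⊔ K₂ ℕ.⊔ (proj₁ small ℕ.⊔ proj₁ near)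
  K₁≤k : K₁ ℕ.≤ k
  K₁≤k = ℕP.≤-trans (ℕP.m≤m⊔n K₁ K₂) (ℕP.m≤m⊔n (K₁ ℕ.⊔ K₂) (proj₁ small ℕ.⊔ proj₁ near))
  K₂≤k : K₂ ℕ.≤ k
  K₂≤k = ℕP.≤-trans (ℕP.m≤n⊔m K₁ K₂) (ℕP.m≤m⊔n (K₁ ℕ.⊔ K₂) (proj₁ small ℕ.⊔ proj₁ near))
  small≤k : proj₁ small ℕ.≤ k
  small≤k = ℕP.≤-trans (ℕP.m≤m⊔n (proj₁ small) (proj₁ near)) (ℕP.m≤n⊔m (K₁ ℕ.⊔ K₂) (proj₁ small ℕ.⊔ proj₁ near))
  near≤k : proj₁ near ℕ.≤ k
  near≤k = ℕP.≤-trans (ℕP.m≤n⊔m (proj₁ small) (proj₁ near)) (ℕP.m≤n⊔m (K₁ ℕ.⊔ K₂) (proj₁ small ℕ.⊔ proj₁ near))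
  root : ∃[ x ] (IsCauchy (λ k → Re (x k)) × IsCauchy (λ k → Im (x k)) ×
    Null (λ k → ev f (x k)) × (∀ j → ∥ r k -ᵍ x j ∥ ≤ σ + σ + (σ + σ)))
  root = nearby-root f (r k) 0<σ (proj₂ (proj₂ tiny) {ev f (r k)} (proj₂ small k small≤k))
  ξ : ℕ → 𝔾
  ξ = proj₁ root
  cRe : IsCauchy (λ k → Re (ξ k))
  cRe = proj₁ (proj₂ root)
  cIm : IsCauchy (λ k → Im (ξ k))
  cIm = proj₁ (proj₂ (proj₂ root))
  null-ξ : Null (λ k → ev f (ξ k))
  null-ξ = proj₁ (proj₂ (proj₂ (proj₂ root)))
  close : ∀ j → ∥ r k -ᵍ ξ j ∥ ≤ m
  close j = subst (∥ r k -ᵍ ξ j ∥ ≤_) 4σ≡m (proj₂ (proj₂ (proj₂ (proj₂ root))) j)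

  outside : ¬ Eventually (λ k → N (ξ k) < 1ℚ)
  outside (j₀ , N<1) = <-irrefl {t} refl (≤-<-trans (tr k K₁≤k) (≤-<-trans N≤ bound))
    where
    x e : ℚ
    x = ∥ ξ j₀ ∥
    e = ∥ r k -ᵍ ξ j₀ ∥
    N≤ : N (r k) ≤ N (ξ j₀) + (x * e + x * e + e * e)
    N≤ = subst (λ u → N u ≤ N (ξ j₀) + (x * e + x * e + e * e))
      (solveᵍ 2 (λ a b → a :+ᵍ (b :-ᵍ a) :=ᵍ b) refl (ξ j₀) (r k))
      (N-+-upper (ξ j₀) (r k -ᵍ ξ j₀))
    x≤2 : x ≤ 1ℚ + 1ℚ
    x≤2 = N<σ²⇒∥∥≤2σ {ξ j₀} (positive⁻¹ 1ℚ) (N<1 j₀ ℕP.≤-refl)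
    0≤e : 0ℚ ≤ e
    0≤e = 0≤∥u∥ (r k -ᵍ ξ j₀)
    xe≤2m : x * e ≤ (1ℚ + 1ℚ) * m
    xe≤2m = *-mono-nonNeg 0≤e (nonNegative⁻¹ (1ℚ + 1ℚ)) x≤2 (close j₀)
    ee≤m : e * e ≤ 1ℚ * m
    ee≤m = *-mono-nonNeg 0≤e (nonNegative⁻¹ 1ℚ) (≤-trans (close j₀) m≤1) (close j₀)
    bound : N (ξ j₀) + (x * e + x * e + e * e) < t
    bound = ≤-<-trans
      (+-mono-≤ (<⇒≤ (N<1 j₀ ℕP.≤-refl)) (+-mono-≤ (+-mono-≤ xe≤2m xe≤2m) ee≤m))
      (subst₂ _<_
        (solve 1 (λ m → con 1ℚ :+ m :* con (+ 5 / 1) :=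
          con 1ℚ :+ (con (1ℚ + 1ℚ) :* m :+ con (1ℚ + 1ℚ) :* m :+ con 1ℚ :* m)) refl m)
        (solve 1 (λ t → con 1ℚ :+ (t :- con 1ℚ) := t) refl t)
        (+-monoʳ-< 1ℚ (proj₁ (proj₂ (proj₂ (proj₂ step))))))

  apart : ¬ Null (λ k → ξ k -ᵍ q k)
  apart null-ξ-q = <-irrefl {τ} refl (≤-<-trans (τr k K₂≤k) (≤-<-trans
    (subst (λ u → ∥ u ∥ ≤ m + ∥ ξ j -ᵍ q j ∥ + ∥ q j -ᵍ q k ∥)
      (solveᵍ 4 (λ r x p q → (r :-ᵍ x) :+ᵍ (x :-ᵍ p) :+ᵍ (p :-ᵍ q)
        :=ᵍ r :-ᵍ q) refl (r k) (ξ j) (q j) (q k))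
      (+-bound (+-bound (close j) ≤-refl) ≤-refl))
    (subst (m + ∥ ξ j -ᵍ q j ∥ + ∥ q j -ᵍ q k ∥ <_)
      (solve 1 (λ t → t :* con ½ :+ t :* con ½ :* con ½ :+ t :* con ½ :* con ½ := t) refl τ)
      (+-mono-< (+-mono-≤-< (proj₂ (proj₂ (proj₂ (proj₂ step))))
          (proj₂ (null-ξ-q (τ * ½ * ½) 0<¼τ) j (ℕP.m≤m⊔n j₀ (proj₁ near))))
        (proj₂ near j k (ℕP.m≤n⊔m j₀ (proj₁ near)) near≤k)))))
    where
    j₀ j : ℕ
    j₀ = proj₁ (null-ξ-q (τ * ½ * ½) 0<¼τ)
    j = j₀ ℕ.⊔ proj₁ near

N-neg : ∀ u → N (0ᵍ -ᵍ u) ≡ N u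
N-neg ⟨ a , b ⟩ = trans (N⟨,⟩ (0ℚ - a) (0ℚ - b)) (trans
  (solve 2 (λ a b → (con 0ℚ :- a) :* (con 0ℚ :- a) :+ (con 0ℚ :- b) :* (con 0ℚ :- b) := a :* a :+ b :* b) refl a b)
  (sym (N⟨,⟩ a b)))

-- Dividing f by X - q, X - z and X - w leaves a monic polynomial whose
-- constant term exceeds 1 in modulus, hence a further root outside the unit
-- disc; this root differs from q because q is a simple root.
outer-root : ∀ {n} (f : Vec 𝔾 (suc n)) (q z w : ℕ → 𝔾) → CauchyNorm q →
  Bounded q → Bounded z → Bounded w →
  Null (λ k → ev f (q k)) → Null (λ k → ev f (z k)) → Null (λ k → ev f (w k)) →
  Away (λ k → z k -ᵍ q k) → Away (λ k → w k -ᵍ q k) → Away (λ k → w k -ᵍ z k) →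
  Away (λ k → ev (quo f (q k)) (q k)) →
  1ℚ ≤ N (ev f 0ᵍ) → Eventually (λ k → N (q k) * (N (z k) * N (w k)) ≤ + 64 / 81) →
  ∃[ ξ ] IsOuterRoot f q ξ
-- In degrees 1 and 2 too many roots are apart from one another: dividing out one or two of them
-- leaves the constant 1, which would have to be null at the next.
outer-root {zero} f q z w _ _ _ _ nq nz nw aqz aqw azw aq 1≤N small =
  ⊥-elim (constant-not-null (λ k → quo f (q k)) z (quo-null (λ _ → f) z q nq nz aqz))
outer-root {suc zero} f q z w _ _ _ _ nq nz nw aqz aqw azw aq 1≤N small =
  ⊥-elim (constant-not-null (λ k → quo (quo f (q k)) (z k)) w
    (quo-null (λ k → quo f (q k)) w z
      (quo-null (λ _ → f) z q nq nz aqz) (quo-null (λ _ → f) w q nq nw aqw) azw))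
outer-root {suc (suc d)} f q z w cq bq bz bw nq nz nw aqz aqw azw aq 1≤N small =
  outer-root-near f q r cq 1<t (eventually-map proj₁ picked) null-f-r away-r-q
  where
  h₁ : ℕ → Vec 𝔾 (suc (suc d))
  h₁ k = quo f (q k)
  h₂ : ℕ → Vec 𝔾 (suc d)
  h₂ k = quo (h₁ k) (z k)
  h₃ : ℕ → Vec 𝔾 d
  h₃ k = quo (h₂ k) (w k)
  δ₁ δ₂ δ₃ V E : ℕ → 𝔾
  δ₁ k = ev f (q k)
  δ₂ k = ev (h₁ k) (z k)
  δ₃ k = ev (h₂ k) (w k)
  null-δ₂ : Null δ₂
  null-δ₂ = quo-null (λ _ → f) z q nq nz aqz
  null-δ₃ : Null δ₃
  null-δ₃ = quo-null h₁ w z null-δ₂ (quo-null (λ _ → f) w q nq nw aqw) azw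
  bf : BoundedCoeffs (λ _ → f)
  bf = coeffSum f , 0 , λ _ _ → ≤-refl
  bh₁ : BoundedCoeffs h₁
  bh₁ = boundedCoeffs-quo (λ _ → f) q bf bq
  bh₂ : BoundedCoeffs h₂
  bh₂ = boundedCoeffs-quo h₁ z bh₁ bz
  bh₃ : BoundedCoeffs h₃
  bh₃ = boundedCoeffs-quo h₂ w bh₂ bw

  -- Vieta's formula with error term: f(0) = V + E, where E collects the remainders of the three
  -- divisions and is null.
  V k = (0ᵍ -ᵍ q k) *ᵍ ((0ᵍ -ᵍ z k) *ᵍ ((0ᵍ -ᵍ w k) *ᵍ ev (h₃ k) 0ᵍ))
  E k = (0ᵍ -ᵍ q k) *ᵍ ((0ᵍ -ᵍ z k) *ᵍ δ₃ k +ᵍ δ₂ k) +ᵍ δ₁ k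
  null-E : Null E
  null-E = null-+ (null-* (bounded-+ (bounded-const 0ᵍ) (bounded-neg bq))
    (null-+ (null-* (bounded-+ (bounded-const 0ᵍ) (bounded-neg bz)) null-δ₃) null-δ₂)) nq
  f0≡ : ∀ k → ev f 0ᵍ ≡ V k +ᵍ E k
  f0≡ k = trans (ev-quo f 0ᵍ (q k))
    (trans (cong (λ t → (0ᵍ -ᵍ q k) *ᵍ t +ᵍ δ₁ k) (trans (ev-quo (h₁ k) 0ᵍ (z k))
      (cong (λ t → (0ᵍ -ᵍ z k) *ᵍ t +ᵍ δ₂ k) (ev-quo (h₂ k) 0ᵍ (w k)))))
      (solveᵍ 7 (λ a b c h d₃ d₂ d₁ → a :*ᵍ (b :*ᵍ (c :*ᵍ h :+ᵍ d₃) :+ᵍ d₂) :+ᵍ d₁ :=ᵍ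
        a :*ᵍ (b :*ᵍ (c :*ᵍ h)) :+ᵍ (a :*ᵍ (b :*ᵍ d₃ :+ᵍ d₂) :+ᵍ d₁)) refl
        (0ᵍ -ᵍ q k) (0ᵍ -ᵍ z k) (0ᵍ -ᵍ w k) (ev (h₃ k) 0ᵍ) (δ₃ k) (δ₂ k) (δ₁ k)))
  N-V : ∀ k → N (V k) ≡ N (q k) * (N (z k) * N (w k)) * N (ev (h₃ k) 0ᵍ)
  N-V k = trans (N-* (0ᵍ -ᵍ q k) ((0ᵍ -ᵍ z k) *ᵍ ((0ᵍ -ᵍ w k) *ᵍ ev (h₃ k) 0ᵍ)))
    (trans (cong₂ _*_ (N-neg (q k)) (trans (N-* (0ᵍ -ᵍ z k) ((0ᵍ -ᵍ w k) *ᵍ ev (h₃ k) 0ᵍ))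
      (cong₂ _*_ (N-neg (z k)) (trans (N-* (0ᵍ -ᵍ w k) (ev (h₃ k) 0ᵍ))
        (cong (_* N (ev (h₃ k) 0ᵍ)) (N-neg (w k)))))))
      (solve 4 (λ a b c h → a :* (b :* (c :* h)) := a :* (b :* c) :* h) refl
        (N (q k)) (N (z k)) (N (w k)) (N (ev (h₃ k) 0ᵍ))))
  continuity : ∃[ ε ] (0ℚ < ε × (∀ {e} → ∥ e ∥ < ε →
    N (ev f 0ᵍ -ᵍ e) < N (ev f 0ᵍ) + + 1 / 9 × N (ev f 0ᵍ) < N (ev f 0ᵍ -ᵍ e) + + 1 / 9))
  continuity = N-continuous (ev f 0ᵍ) (positive⁻¹ (+ 1 / 9))
  -- The constants fit together as (64/81)(9/8) + 1/9 = 8/9 + 1/9 = 1, against N (f 0) ≥ 1.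
  large : Eventually (λ k → + 9 / 8 < N (ev (h₃ k) 0ᵍ))
  large = eventually-map
    (λ {k} (e<ε , prod≤) → ≰⇒> λ N≤9/8 → <-irrefl {1ℚ} refl (≤-<-trans 1≤N (<-≤-trans
      (proj₂ (proj₂ (proj₂ continuity) {E k} e<ε))
      (+-monoˡ-≤ (+ 1 / 9) {_} {+ 8 / 9} (begin
        N (ev f 0ᵍ -ᵍ E k)
          ≡⟨ cong N (trans (cong (_-ᵍ E k) (f0≡ k))
               (solveᵍ 2 (λ v e → v :+ᵍ e :-ᵍ e :=ᵍ v) refl (V k) (E k))) ⟩
        N (V k)
          ≡⟨ N-V k ⟩
        N (q k) * (N (z k) * N (w k)) * N (ev (h₃ k) 0ᵍ)
          ≤⟨ *-mono-nonNeg (0≤N (ev (h₃ k) 0ᵍ)) (nonNegative⁻¹ (+ 64 / 81)) prod≤ N≤9/8 ⟩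
        + 8 / 9 ∎)))))
    (eventually-× (null-E (proj₁ continuity) (proj₁ (proj₂ continuity))) small)
    where open ≤-Reasoning

  threshold : ∃[ δ ] (0ℚ < δ × (1ℚ + δ) ^ℚ d < + 9 / 8)
  threshold = small-power d {+ 9 / 8} (1<9/8)
    where
    1<9/8 : 1ℚ < + 9 / 8
    1<9/8 = <-cert (+ 1 / 8) (positive⁻¹ (+ 1 / 8)) refl
  t : ℚ
  t = 1ℚ + proj₁ threshold
  1<t : 1ℚ < t
  1<t = <-cert (proj₁ threshold) (proj₁ (proj₂ threshold)) refl
  0<t : 0ℚ < t
  0<t = <-trans (positive⁻¹ 1ℚ) 1<t

  pick : ∀ k → ∃[ r ] (t ^ℚ d < N (ev (h₃ k) 0ᵍ) → t ≤ N (0ᵍ -ᵍ r) × ∥ ev (h₃ k) r ∥ < ½^ k)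
  pick k with t ^ℚ d <? N (ev (h₃ k) 0ᵍ)
  ... | yes t< = let (r , p) = large-root 0<t (h₃ k) t< (0<½^ k) in r , λ _ → p
  -- A placeholder that makes r total; `large` excludes this case from some index on.
  ... | no t≮  = 0ᵍ , λ t< → ⊥-elim (t≮ t<)
  r : ℕ → 𝔾
  r k = proj₁ (pick k)
  picked : Eventually (λ k → t ≤ N (r k) × ∥ ev (h₃ k) (r k) ∥ < ½^ k)
  picked = eventually-map
    (λ {k} 9/8< → let (p , p′) = proj₂ (pick k) (<-trans (proj₂ (proj₂ threshold)) 9/8<)
                  in subst (t ≤_) (N-neg (r k)) p , p′) large
  null-h₃-r : Null (λ k → ev (h₃ k) (r k))
  null-h₃-r ε 0<ε = eventually-map (λ {k} ((_ , p) , q) → <-trans p (subst (_< ε) (*-identityˡ (½^ k)) q))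
    (eventually-× picked (small½^ {1ℚ} (positive⁻¹ 1ℚ) 0<ε))
  br : Bounded r
  br = bounded-root h₃ r bh₃ null-h₃-r
  null-h₁-r : Null (λ k → ev (h₁ k) (r k))
  null-h₁-r = quo-null⁻¹ h₁ r z (bounded-+ br (bounded-neg bz))
    (quo-null⁻¹ h₂ r w (bounded-+ br (bounded-neg bw)) null-h₃-r null-δ₃) null-δ₂
  null-f-r : Null (λ k → ev f (r k))
  null-f-r = quo-null⁻¹ (λ _ → f) r q (bounded-+ br (bounded-neg bq)) null-h₁-r nq
  -- From h₁(q) = h₁(r) - (r - q) c, with c the bounded value at r of the next quotient: h₁(q) is
  -- away from 0 because q is a simple root, and h₁(r) is null, so r - q must be away from 0.
  away-r-q : Away (λ k → r k -ᵍ q k)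
  away-r-q = away-factor {λ k → ev (h₁ k) (r k)} {λ k → r k -ᵍ q k} {λ k → negᵍ (ev (quo (h₁ k) (q k)) (r k))}
    null-h₁-r (bounded-neg (bounded-ev (λ k → quo (h₁ k) (q k)) r (boundedCoeffs-quo h₁ q bh₁ bq) br))
    (away-cong (λ k → trans
      (solveᵍ 2 (λ a b → b :=ᵍ a :+ᵍ b :+ᵍ :-ᵍ a) refl ((r k -ᵍ q k) *ᵍ ev (quo (h₁ k) (q k)) (r k)) (ev (h₁ k) (q k)))
      (trans (cong (_-ᵍ ((r k -ᵍ q k) *ᵍ ev (quo (h₁ k) (q k)) (r k))) (sym (ev-quo (h₁ k) (r k) (q k))))
        (solveᵍ 3 (λ h a b → h :-ᵍ a :*ᵍ b :=ᵍ h :+ᵍ a :*ᵍ (:-ᵍ b)) refl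
          (ev (h₁ k) (r k)) (r k -ᵍ q k) (ev (quo (h₁ k) (q k)) (r k))))) aq)

-- Gauss's lemma

module Convolution {R : Set} (_⊕_ _⊗_ : R → R → R) (0# : R) where

  infixl 7 _⋆_

  coeff : List R → ℕ → R
  coeff []       k       = 0#
  coeff (c ∷ cs) zero    = c
  coeff (c ∷ cs) (suc k) = coeff cs k

  shift : (ℕ → R) → ℕ → R
  shift g zero    = 0#
  shift g (suc k) = g k

  -- The coefficients of a product of polynomials. The right factor is a coefficient function on all
  -- of ℕ, which avoids any bookkeeping of degrees.
  _⋆_ : List R → (ℕ → R) → ℕ → R
  ([]       ⋆ g) k = 0#
  ((c ∷ cs) ⋆ g) k = (c ⊗ g k) ⊕ shift (cs ⋆ g) k

module ℚ⋆ = Convolution _+_ _*_ 0ℚ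
module ℤ⋆ = Convolution ℤ._+_ ℤ._*_ 0ℤ

module _ where

  open ℤ⋆

  prime-∣-* : ∀ {p} → Prime p → ∀ a b → + p ∣ℤ a ℤ.* b → + p ∣ℤ a ⊎ + p ∣ℤ b
  prime-∣-* {p} pr a b p∣ab with euclidsLemma ℤ.∣ a ∣ ℤ.∣ b ∣ pr
    (subst (p ℕD.∣_) (ℤP.abs-* a b) (ℤD.∣⇒∣ᵤ p∣ab))
  ... | inj₁ p∣a = inj₁ (ℤD.∣ᵤ⇒∣ p∣a)
  ... | inj₂ p∣b = inj₂ (ℤD.∣ᵤ⇒∣ p∣b)

  ∣-⋆ : ∀ {p} bs {g} k → (∀ j → j ℕ.≤ k → p ∣ℤ g j) → p ∣ℤ (bs ⋆ g) k
  ∣-⋆ []       k       h = divides 0ℤ refl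
  ∣-⋆ (b ∷ bs) zero    h = ℤD.∣m∣n⇒∣m+n (ℤD.∣n⇒∣m*n b (h 0 ℕP.≤-refl)) (divides 0ℤ refl)
  ∣-⋆ (b ∷ bs) (suc k) h = ℤD.∣m∣n⇒∣m+n (ℤD.∣n⇒∣m*n b (h (suc k) ℕP.≤-refl))
    (∣-⋆ bs k λ j j≤k → h j (ℕP.m≤n⇒m≤1+n j≤k))

  gauss : ∀ {p} → Prime p → ∀ bs {g} → (∀ k → + p ∣ℤ (bs ⋆ g) k) → All (+ p ∣ℤ_) bs ⊎ (∀ k → + p ∣ℤ g k)
  gauss pr []       h = inj₁ []
  gauss {p} pr (b ∷ bs) {g} h with + p ∣ℤ? b
  ... | yes p∣b with gauss pr bs {g} (λ k → ℤD.∣m+n∣m⇒∣n (h (suc k)) (ℤD.∣m⇒∣m*n (g (suc k)) p∣b))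
  ...   | inj₁ p∣bs = inj₁ (p∣b ∷ p∣bs)
  ...   | inj₂ p∣g  = inj₂ p∣g
  gauss {p} pr (b ∷ bs) {g} h | no p∤b = inj₂ λ k → prefix (suc k) k ℕP.≤-refl
    where
    last-coefficient : ∀ k → (∀ j → j ℕ.< k → + p ∣ℤ g j) → + p ∣ℤ b ℤ.* g k
    last-coefficient zero    _     = subst (+ p ∣ℤ_) (ℤP.+-identityʳ (b ℤ.* g 0)) (h 0)
    last-coefficient (suc k) below = ℤD.∣m+n∣n⇒∣m (h (suc k)) (∣-⋆ bs k λ j j≤k → below j (ℕ.s≤s j≤k))
    prefix : ∀ k j → j ℕ.< k → + p ∣ℤ g j
    prefix (suc k) j (ℕ.s≤s j≤k) with ℕP.m≤n⇒m<n∨m≡n j≤k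
    ... | inj₁ j<k  = prefix k j j<k
    ... | inj₂ refl with prime-∣-* pr b (g k) (last-coefficient k (prefix k))
    ...   | inj₁ p∣b  = ⊥-elim (p∤b p∣b)
    ...   | inj₂ p∣gk = p∣gk

  ∣coeff⇒All : ∀ {p} cs → (∀ k → p ∣ℤ coeff cs k) → All (p ∣ℤ_) cs
  ∣coeff⇒All []       h = []
  ∣coeff⇒All (c ∷ cs) h = h 0 ∷ ∣coeff⇒All cs (λ k → h (suc k))

  divide-all : ∀ {p cs} → All (p ∣ℤ_) cs → ∃[ ds ] cs ≡ List.map (p ℤ.*_) ds
  divide-all []                              = [] , refl
  divide-all {p} (divides d c≡dp ∷ p∣cs) with divide-all p∣cs
  ... | ds , refl = d ∷ ds , cong (_∷ _) (trans c≡dp (ℤP.*-comm d p))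

  coeff-map : ∀ p cs k → coeff (List.map (p ℤ.*_) cs) k ≡ p ℤ.* coeff cs k
  coeff-map p []       k       = sym (ℤP.*-zeroʳ p)
  coeff-map p (c ∷ cs) zero    = refl
  coeff-map p (c ∷ cs) (suc k) = coeff-map p cs k

  ⋆-scaleʳ : ∀ p bs cs k → (bs ⋆ coeff (List.map (p ℤ.*_) cs)) k ≡ p ℤ.* (bs ⋆ coeff cs) k
  ⋆-scaleʳ p []       cs k       = sym (ℤP.*-zeroʳ p)
  ⋆-scaleʳ p (b ∷ bs) cs zero    = trans (cong (λ t → b ℤ.* t ℤ.+ 0ℤ) (coeff-map p cs 0))
    (solveℤ 3 (λ b p c → b :*ℤ (p :*ℤ c) :+ℤ conℤ 0ℤ :=ℤ p :*ℤ (b :*ℤ c :+ℤ conℤ 0ℤ)) refl b p (coeff cs 0))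
  ⋆-scaleʳ p (b ∷ bs) cs (suc k) = trans
    (cong₂ (λ s t → b ℤ.* s ℤ.+ t) (coeff-map p cs (suc k)) (⋆-scaleʳ p bs cs k))
    (solveℤ 4 (λ b p c d → b :*ℤ (p :*ℤ c) :+ℤ p :*ℤ d :=ℤ p :*ℤ (b :*ℤ c :+ℤ d)) refl b p (coeff cs (suc k)) ((bs ⋆ coeff cs) k))

  ⋆-scaleˡ : ∀ p bs g k → (List.map (p ℤ.*_) bs ⋆ g) k ≡ p ℤ.* (bs ⋆ g) k
  ⋆-scaleˡ p []       g k       = sym (ℤP.*-zeroʳ p)
  ⋆-scaleˡ p (b ∷ bs) g zero    =
    solveℤ 3 (λ b p c → p :*ℤ b :*ℤ c :+ℤ conℤ 0ℤ :=ℤ p :*ℤ (b :*ℤ c :+ℤ conℤ 0ℤ)) refl b p (g 0)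
  ⋆-scaleˡ p (b ∷ bs) g (suc k) = trans (cong (λ t → p ℤ.* b ℤ.* g (suc k) ℤ.+ t) (⋆-scaleˡ p bs g k))
    (solveℤ 4 (λ b p c d → p :*ℤ b :*ℤ c :+ℤ p :*ℤ d :=ℤ p :*ℤ (b :*ℤ c :+ℤ d)) refl b p (g (suc k)) ((bs ⋆ g) k))

  private
    strip : ∀ {p d cs} .{{_ : ℕ.NonZero p}} → + d ∈ List.map (+ p ℤ.*_) cs → ∃[ d′ ] (d ≡ p ℕ.* d′ × + d′ ∈ cs)
    strip {p} {d} d∈ with ∈-map⁻ (+ p ℤ.*_) d∈
    ... | + d′ , d′∈ , eq = d′ , ℤP.+-injective (trans eq (sym (ℤP.pos-* p d′))) , d′∈
    ... | ℤ.-[1+ n ] , n∈ , eq = ⊥-elim (impossible p eq)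
      where
      impossible : ∀ p .{{_ : ℕ.NonZero p}} → + d ≢ + p ℤ.* ℤ.-[1+ n ]
      impossible (suc p) ()

    cancel-prime : ∀ {p m g a} .{{_ : ℕ.NonZero p}} → + p ℤ.* a ≡ + (p ℕ.* m) ℤ.* g → a ≡ + m ℤ.* g
    cancel-prime {p} {m} {g} {a} eq = ℤP.*-cancelˡ-≡ (+ p) a (+ m ℤ.* g)
      (trans eq (trans (cong (ℤ._* g) (ℤP.pos-* p m)) (ℤP.*-assoc (+ p) (+ m) g)))

  -- A and B are d f and e h for monic rational f and h with integral product G;
  -- the primes of d e are removed one at a time from A or B.
  leading∣coefficients : ∀ ps → All Prime ps → ∀ {d e A B} (G : ℕ → ℤ) → d ℕ.* e ≡ product ps →
    (∀ k → (B ⋆ coeff A) k ≡ + (d ℕ.* e) ℤ.* G k) → + d ∈ A → + e ∈ B → All (+ d ∣ℤ_) A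
  leading∣coefficients [] [] {d} {e} {A} G de≡1 _ _ _ =
    All.universal (λ a → divides a (trans (sym (ℤP.*-identityʳ a)) (cong (λ t → a ℤ.* + t) (sym (ℕP.m*n≡1⇒m≡1 d e de≡1))))) A
  leading∣coefficients (p ∷ ps) (pr ∷ prs) {d} {e} {A} {B} G de≡ prod d∈A e∈B = go (gauss pr B p∣prod)
    where
    instance
      p≢0 : ℕ.NonZero p
      p≢0 = prime⇒nonZero pr
    p∣prod : ∀ k → + p ∣ℤ (B ⋆ coeff A) k
    p∣prod k = divides (+ product ps ℤ.* G k) (trans (prod k) (trans
      (cong (λ t → + t ℤ.* G k) de≡)
      (trans (cong (ℤ._* G k) (ℤP.pos-* p (product ps)))
        (solveℤ 3 (λ p q g → p :*ℤ q :*ℤ g :=ℤ q :*ℤ g :*ℤ p) refl (+ p) (+ product ps) (G k)))))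
    go : All (+ p ∣ℤ_) B ⊎ (∀ k → + p ∣ℤ coeff A k) → All (+ d ∣ℤ_) A
    -- As `+ e ∈ B`, the prime also divides e, so d e loses exactly one factor p and all hypotheses
    -- persist. The other case removes p from d and A in the same way and multiplies it back
    -- afterwards.
    go (inj₁ p∣B) with divide-all p∣B
    ... | B′ , refl with strip e∈B
    ...   | e′ , refl , e′∈B′ = leading∣coefficients ps prs {d} {e′} G
      (ℕP.*-cancelˡ-≡ (d ℕ.* e′) (product ps) p (trans (sym swap) de≡))
      (λ k → cancel-prime {p} {d ℕ.* e′} (trans (sym (⋆-scaleˡ (+ p) B′ (coeff A) k))
        (trans (prod k) (cong (λ t → + t ℤ.* G k) swap))))
      d∈A e′∈B′
      where
      swap : d ℕ.* (p ℕ.* e′) ≡ p ℕ.* (d ℕ.* e′)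
      swap = trans (sym (ℕP.*-assoc d p e′)) (trans (cong (ℕ._* e′) (ℕP.*-comm d p)) (ℕP.*-assoc p d e′))
    go (inj₂ p∣A) with divide-all (∣coeff⇒All A p∣A)
    ... | A′ , refl with strip d∈A
    ...   | d′ , refl , d′∈A′ = map⁺ (All.map
      (λ {a} (divides q a≡) → divides q (trans (cong (+ p ℤ.*_) a≡)
        (trans (solveℤ 3 (λ p q d → p :*ℤ (q :*ℤ d) :=ℤ q :*ℤ (p :*ℤ d)) refl (+ p) q (+ d′))
          (cong (q ℤ.*_) (sym (ℤP.pos-* p d′))))))
      (leading∣coefficients ps prs {d′} {e} G
        (ℕP.*-cancelˡ-≡ (d′ ℕ.* e) (product ps) p (trans (sym (ℕP.*-assoc p d′ e)) de≡))
        (λ k → cancel-prime {p} {d′ ℕ.* e} (trans (sym (⋆-scaleʳ (+ p) B A′ k))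
          (trans (prod k) (cong (λ t → + t ℤ.* G k) (ℕP.*-assoc p d′ e)))))
        d′∈A′ e∈B))

-- Monic rational factors of integral polynomials

fromInt : ℤ → ℚ
fromInt i = i / 1

toℚᵘ-fromInt : ∀ i → toℚᵘ (fromInt i) ℚᵘ.≃ mkℚᵘ i 0
toℚᵘ-fromInt i = toℚᵘ-fromℚᵘ (mkℚᵘ i 0)

fromInt-+ : ∀ i j → fromInt (i ℤ.+ j) ≡ fromInt i + fromInt j
fromInt-+ i j = toℚᵘ-injective (ℚᵘP.≃-trans (toℚᵘ-fromInt (i ℤ.+ j)) (ℚᵘP.≃-trans
  (ℚᵘ.*≡* (cong (ℤ._* 1ℤ) (sym (cong₂ ℤ._+_ (ℤP.*-identityʳ i) (ℤP.*-identityʳ j)))))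
  (ℚᵘP.≃-sym (ℚᵘP.≃-trans (toℚᵘ-homo-+ (fromInt i) (fromInt j))
    (ℚᵘP.+-cong (toℚᵘ-fromInt i) (toℚᵘ-fromInt j))))))

fromInt-* : ∀ i j → fromInt (i ℤ.* j) ≡ fromInt i * fromInt j
fromInt-* i j = toℚᵘ-injective (ℚᵘP.≃-trans (toℚᵘ-fromInt (i ℤ.* j)) (ℚᵘP.≃-trans (ℚᵘ.*≡* refl)
  (ℚᵘP.≃-sym (ℚᵘP.≃-trans (toℚᵘ-homo-* (fromInt i) (fromInt j))
    (ℚᵘP.*-cong (toℚᵘ-fromInt i) (toℚᵘ-fromInt j))))))

fromInt-injective : ∀ {i j} → fromInt i ≡ fromInt j → i ≡ j
fromInt-injective {i} {j} eq with ℚᵘP.≃-trans (ℚᵘP.≃-sym (toℚᵘ-fromInt i))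
  (ℚᵘP.≃-trans (ℚᵘP.≃-reflexive (cong toℚᵘ eq)) (toℚᵘ-fromInt j))
... | ℚᵘ.*≡* i*1≡j*1 = trans (sym (ℤP.*-identityʳ i)) (trans i*1≡j*1 (ℤP.*-identityʳ j))

0≤fromInt+ : ∀ n → 0ℚ ≤ fromInt (+ n)
0≤fromInt+ n = nonNegative⁻¹ (fromInt (+ n)) {{normalize-nonNeg n 1}}

0<fromInt+ : ∀ n .{{_ : ℕ.NonZero n}} → 0ℚ < fromInt (+ n)
0<fromInt+ n = positive⁻¹ (fromInt (+ n)) {{normalize-pos n 1}}

fromInt-⋆ : ∀ bs cs k → (List.map fromInt bs ℚ⋆.⋆ ℚ⋆.coeff (List.map fromInt cs)) k ≡ fromInt ((bs ℤ⋆.⋆ ℤ⋆.coeff cs) k)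
fromInt-⋆ bs cs = go bs
  where
  coeff-map-fromInt : ∀ cs k → ℚ⋆.coeff (List.map fromInt cs) k ≡ fromInt (ℤ⋆.coeff cs k)
  coeff-map-fromInt []       k       = refl
  coeff-map-fromInt (c ∷ cs) zero    = refl
  coeff-map-fromInt (c ∷ cs) (suc k) = coeff-map-fromInt cs k
  term : ∀ b k → fromInt b * ℚ⋆.coeff (List.map fromInt cs) k ≡ fromInt (b ℤ.* ℤ⋆.coeff cs k)
  term b k = trans (cong (fromInt b *_) (coeff-map-fromInt cs k)) (sym (fromInt-* b (ℤ⋆.coeff cs k)))
  go : ∀ bs k → (List.map fromInt bs ℚ⋆.⋆ ℚ⋆.coeff (List.map fromInt cs)) k ≡ fromInt ((bs ℤ⋆.⋆ ℤ⋆.coeff cs) k)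
  go []       k       = refl
  go (b ∷ bs) zero    = trans (cong (_+ 0ℚ) (term b 0)) (sym (fromInt-+ (b ℤ.* ℤ⋆.coeff cs 0) 0ℤ))
  go (b ∷ bs) (suc k) = trans (cong₂ _+_ (term b (suc k)) (go bs k))
    (sym (fromInt-+ (b ℤ.* ℤ⋆.coeff cs (suc k)) ((bs ℤ⋆.⋆ ℤ⋆.coeff cs) k)))

coeff-scale : ∀ p cs k → ℚ⋆.coeff (List.map (p *_) cs) k ≡ p * ℚ⋆.coeff cs k
coeff-scale p []       k       = sym (*-zeroʳ p)
coeff-scale p (c ∷ cs) zero    = refl
coeff-scale p (c ∷ cs) (suc k) = coeff-scale p cs k

⋆-scale : ∀ p q bs cs k → (List.map (p *_) bs ℚ⋆.⋆ ℚ⋆.coeff (List.map (q *_) cs)) k ≡ q * p * (bs ℚ⋆.⋆ ℚ⋆.coeff cs) k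
⋆-scale p q []       cs k       = sym (*-zeroʳ (q * p))
⋆-scale p q (b ∷ bs) cs zero    = trans (cong (λ t → p * b * t + 0ℚ) (coeff-scale q cs 0))
  (solve 4 (λ p q b c → p :* b :* (q :* c) :+ con 0ℚ := q :* p :* (b :* c :+ con 0ℚ)) refl p q b (ℚ⋆.coeff cs 0))
⋆-scale p q (b ∷ bs) cs (suc k) = trans
  (cong₂ (λ s t → p * b * s + t) (coeff-scale q cs (suc k)) (⋆-scale p q bs cs k))
  (solve 5 (λ p q b c d → p :* b :* (q :* c) :+ q :* p :* d := q :* p :* (b :* c :+ d)) refl
    p q b (ℚ⋆.coeff cs (suc k)) ((bs ℚ⋆.⋆ ℚ⋆.coeff cs) k))

denominator-* : ∀ p → fromInt (+ (↧ₙ p)) * p ≡ fromInt (↥ p)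
denominator-* p = toℚᵘ-injective (ℚᵘP.≃-trans (toℚᵘ-homo-* (fromInt (+ ↧ₙ p)) p)
  (ℚᵘP.≃-trans (ℚᵘP.*-cong (toℚᵘ-fromInt (+ ↧ₙ p)) (ℚᵘP.≃-refl {toℚᵘ p}))
  (ℚᵘP.≃-trans (cross p) (ℚᵘP.≃-sym (toℚᵘ-fromInt (↥ p))))))
  where
  cross : ∀ p → mkℚᵘ (+ (↧ₙ p)) 0 ℚᵘ.* toℚᵘ p ℚᵘ.≃ mkℚᵘ (↥ p) 0
  cross (mkℚ n d-1 _) = ℚᵘ.*≡* (trans (ℤP.*-identityʳ (+ suc d-1 ℤ.* n)) (trans (ℤP.*-comm (+ suc d-1) n)
    (cong (λ t → n ℤ.* + suc t) (sym (ℕP.+-identityʳ d-1)))))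

clear-denominators : ∀ (cs : List ℚ) → ∃[ d ] Σ[ as ∈ List ℤ ]
  (ℕ.NonZero d × List.map (fromInt (+ d) *_) cs ≡ List.map fromInt as)
clear-denominators []       = 1 , [] , _ , refl
clear-denominators (c ∷ cs) with clear-denominators cs
... | d , as , d≢0 , eq = ↧ₙ c ℕ.* d , (+ d ℤ.* ↥ c) ∷ List.map (+ ↧ₙ c ℤ.*_) as
  , ℕP.m*n≢0 (↧ₙ c) d {{_}} {{d≢0}} , cong₂ _∷_ head (tail cs as eq)
  where
  p : ℚ
  p = fromInt (+ ↧ₙ c)
  split : fromInt (+ (↧ₙ c ℕ.* d)) ≡ p * fromInt (+ d)
  split = trans (cong fromInt (ℤP.pos-* (↧ₙ c) d)) (fromInt-* (+ ↧ₙ c) (+ d))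
  head : fromInt (+ (↧ₙ c ℕ.* d)) * c ≡ fromInt (+ d ℤ.* ↥ c)
  head = trans (cong (_* c) split) (trans
    (solve 3 (λ p d c → p :* d :* c := d :* (p :* c)) refl p (fromInt (+ d)) c)
    (trans (cong (fromInt (+ d) *_) (denominator-* c)) (sym (fromInt-* (+ d) (↥ c)))))
  tail : ∀ cs as → List.map (fromInt (+ d) *_) cs ≡ List.map fromInt as →
    List.map (fromInt (+ (↧ₙ c ℕ.* d)) *_) cs ≡ List.map fromInt (List.map (+ ↧ₙ c ℤ.*_) as)
  tail []       []       eq = refl
  tail (x ∷ cs) (a ∷ as) eq = cong₂ _∷_
    (trans (cong (_* x) split) (trans (*-assoc p (fromInt (+ d)) x)
      (trans (cong (p *_) (cong (λ { (y ∷ _) → y ; [] → 0ℚ }) eq)) (sym (fromInt-* (+ ↧ₙ c) a)))))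
    (tail cs as (cong (λ { (_ ∷ ys) → ys ; [] → [] }) eq))

-- Scaling by d turns the leading coefficient 1 into d. Its position is not recorded, since
-- membership is all that `leading∣coefficients` asks for.
monic-∈ : ∀ {d cs as} → 1ℚ ∈ cs → List.map (fromInt (+ d) *_) cs ≡ List.map fromInt as → + d ∈ as
monic-∈ {d} {cs} {as} 1∈cs eq with ∈-map⁻ fromInt (subst (fromInt (+ d) * 1ℚ ∈_) eq (∈-map⁺ (fromInt (+ d) *_) 1∈cs))
... | a , a∈as , d*1≡a = subst (_∈ as)
  (fromInt-injective (trans (sym d*1≡a) (*-identityʳ (fromInt (+ d))))) a∈as

monic-factor-integral : ∀ (f h : List ℚ) (G : ℕ → ℤ) → 1ℚ ∈ f → 1ℚ ∈ h →
  (∀ k → (h ℚ⋆.⋆ ℚ⋆.coeff f) k ≡ fromInt (G k)) → All (λ c → ∃[ i ] c ≡ fromInt i) f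
monic-factor-integral f h G 1∈f 1∈h hf≡G
  with clear-denominators f | clear-denominators h
... | d , A , d≢0 , dfA | e , B , e≢0 , ehB = integral f A dfA
  (leading∣coefficients (PrimeFactorisation.factors pf) (PrimeFactorisation.factorsPrime pf) G
    (PrimeFactorisation.isFactorisation pf) product≡ (monic-∈ 1∈f dfA) (monic-∈ 1∈h ehB))
  where
  pf : PrimeFactorisation (d ℕ.* e)
  pf = factorise (d ℕ.* e) {{ℕP.m*n≢0 d e {{d≢0}} {{e≢0}}}}
  product≡ : ∀ k → (B ℤ⋆.⋆ ℤ⋆.coeff A) k ≡ + (d ℕ.* e) ℤ.* G k
  product≡ k = fromInt-injective (trans (sym (fromInt-⋆ B A k)) (trans
    (cong₂ (λ s t → (s ℚ⋆.⋆ ℚ⋆.coeff t) k) (sym ehB) (sym dfA))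
    (trans (⋆-scale (fromInt (+ e)) (fromInt (+ d)) h f k)
      (trans (cong₂ _*_ (trans (sym (fromInt-* (+ d) (+ e))) (cong fromInt (sym (ℤP.pos-* d e)))) (hf≡G k))
        (sym (fromInt-* (+ (d ℕ.* e)) (G k)))))))
  integral : ∀ cs as → List.map (fromInt (+ d) *_) cs ≡ List.map fromInt as → All (+ d ∣ℤ_) as →
    All (λ c → ∃[ i ] c ≡ fromInt i) cs
  integral []       []       eq []       = []
  integral (c ∷ cs) (a ∷ as) eq (divides q a≡qd ∷ d∣as) =
    (q , *-cancelˡ-≡ (trans (cong (λ { (y ∷ _) → y ; [] → 0ℚ }) eq)
      (trans (cong fromInt (trans a≡qd (ℤP.*-comm q (+ d)))) (fromInt-* (+ d) q))))
    ∷ integral cs as (cong (λ { (_ ∷ ys) → ys ; [] → [] }) eq) d∣as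
    where
    *-cancelˡ-≡ : ∀ {x y} → fromInt (+ d) * x ≡ fromInt (+ d) * y → x ≡ y
    *-cancelˡ-≡ eq = ≤-antisym (cancel (≤-reflexive eq)) (cancel (≤-reflexive (sym eq)))
      where
      cancel : ∀ {x y} → fromInt (+ d) * x ≤ fromInt (+ d) * y → x ≤ y
      cancel = *-cancelˡ-≤-pos (fromInt (+ d)) {{positive (0<fromInt+ d {{d≢0}})}}

open ℚ⋆

-- Minimal polynomials

fromℚᵛ : ∀ {n} → Vec ℚ n → Vec 𝔾 n
fromℚᵛ = Vec.map fromℚᵍ

-- Σ cᵢ zⁱ over the stored coefficients only, without an implicit leading 1.
lin : ∀ {n} → Vec ℚ n → 𝔾 → 𝔾
lin []       z = 0ᵍ
lin (c ∷ cs) z = fromℚᵍ c +ᵍ z *ᵍ lin cs z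

monicList : ∀ {n} → Vec ℚ n → List ℚ
monicList []       = 1ℚ ∷ []
monicList (c ∷ cs) = c ∷ monicList cs

1∈monicList : ∀ {n} (cs : Vec ℚ n) → 1ℚ ∈ monicList cs
1∈monicList []       = here refl
1∈monicList (c ∷ cs) = there (1∈monicList cs)

fromℚᵍ-- : ∀ p q → fromℚᵍ (p - q) ≡ fromℚᵍ p -ᵍ fromℚᵍ q
fromℚᵍ-- p q = cong ⟨ p - q ,_⟩ refl

fromℚᵍ-* : ∀ p q → fromℚᵍ (p * q) ≡ fromℚᵍ p *ᵍ fromℚᵍ q
fromℚᵍ-* p q = cong₂ ⟨_,_⟩
  (solve 2 (λ p q → p :* q := p :* q :+ :- (con 0ℚ :* con 0ℚ)) refl p q)
  (solve 2 (λ p q → con 0ℚ := p :* con 0ℚ :+ con 0ℚ :* q) refl p q)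

lin-zeros : ∀ n z → lin (replicate n 0ℚ) z ≡ 0ᵍ
lin-zeros zero    z = refl
lin-zeros (suc n) z = trans (cong (λ t → 0ᵍ +ᵍ z *ᵍ t) (lin-zeros n z))
  (solveᵍ 1 (λ z → conᵍ 0ᵍ :+ᵍ z :*ᵍ conᵍ 0ᵍ :=ᵍ conᵍ 0ᵍ) refl z)

lin-difference : ∀ {n} (f g : Vec ℚ n) z → lin (zipWith _-_ f g) z ≡ ev (fromℚᵛ f) z -ᵍ ev (fromℚᵛ g) z
lin-difference []      []      z = refl
lin-difference (c ∷ f) (d ∷ g) z = trans
  (cong₂ (λ s t → s +ᵍ z *ᵍ t) (fromℚᵍ-- c d) (lin-difference f g z))
  (solveᵍ 5 (λ c d z p q → (c :-ᵍ d) :+ᵍ z :*ᵍ (p :-ᵍ q) :=ᵍ (c :+ᵍ z :*ᵍ p) :-ᵍ (d :+ᵍ z :*ᵍ q)) refl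
    (fromℚᵍ c) (fromℚᵍ d) z (ev (fromℚᵛ f) z) (ev (fromℚᵛ g) z))

coeff-difference : ∀ {n} (f g : Vec ℚ n) k →
  coeff (monicList f) k ≡ coeff (monicList g) k + coeff (toList (zipWith _-_ f g)) k
coeff-difference []      []      zero    = refl
coeff-difference []      []      (suc k) = refl
coeff-difference (c ∷ f) (d ∷ g) zero    = solve 2 (λ c d → c := d :+ (c :- d)) refl c d
coeff-difference (c ∷ f) (d ∷ g) (suc k) = coeff-difference f g k

-- One step of long division, with t the top coefficient of s. The identity is stated twice: for
-- values, to evaluate at q, and for coefficients, to apply Gauss's lemma.
reduce : ∀ {n} (f : Vec ℚ n) (s : Vec ℚ (suc n)) → ∃[ t ] Σ[ r ∈ Vec ℚ n ]
  ((∀ z → lin s z ≡ fromℚᵍ t *ᵍ ev (fromℚᵛ f) z +ᵍ lin r z) ×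
   (∀ k → coeff (toList s) k ≡ t * coeff (monicList f) k + coeff (toList r) k))
reduce []      (t ∷ []) = t , [] ,
  (λ z → solveᵍ 2 (λ t z → t :+ᵍ z :*ᵍ conᵍ 0ᵍ :=ᵍ
    t :*ᵍ conᵍ 1ᵍ :+ᵍ conᵍ 0ᵍ) refl (fromℚᵍ t) z) , λ { zero → solve 1 (λ t → t := t :* con 1ℚ :+ con 0ℚ) refl t
  ; (suc k) → solve 1 (λ t → con 0ℚ := t :* con 0ℚ :+ con 0ℚ) refl t }
reduce (c ∷ f) (a ∷ s) with reduce f s
... | t , r , lin≡ , coeff≡ = t , (a - t * c) ∷ r ,
  (λ z → trans (cong (λ u → fromℚᵍ a +ᵍ z *ᵍ u) (lin≡ z)) (trans
    (solveᵍ 6 (λ a z t p c r → a :+ᵍ z :*ᵍ (t :*ᵍ p :+ᵍ r) :=ᵍ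
      t :*ᵍ (c :+ᵍ z :*ᵍ p) :+ᵍ ((a :-ᵍ t :*ᵍ c) :+ᵍ z :*ᵍ r))
      refl (fromℚᵍ a) z (fromℚᵍ t) (ev (fromℚᵛ f) z) (fromℚᵍ c) (lin r z))
    (cong (λ u → fromℚᵍ t *ᵍ (fromℚᵍ c +ᵍ z *ᵍ ev (fromℚᵛ f) z) +ᵍ (u +ᵍ z *ᵍ lin r z))
      (trans (cong (fromℚᵍ a -ᵍ_) (sym (fromℚᵍ-* t c))) (sym (fromℚᵍ-- a (t * c))))))) ,
  λ { zero → solve 3 (λ a t c → a := t :* c :+ (a :- t :* c)) refl a t c
  ; (suc k) → coeff≡ k }

-- If F = c + X F₀ and F₀ = f h + r, only c + X r is left to divide, and it needs a single
-- reduction. The quotient t + X h stays monic.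
divide-monic : ∀ {n} (f : Vec ℚ n) e (F : Vec ℚ (e ℕ.+ n)) → Σ[ h ∈ Vec ℚ e ] Σ[ r ∈ Vec ℚ n ]
  ((∀ z → ev (fromℚᵛ F) z ≡ ev (fromℚᵛ f) z *ᵍ ev (fromℚᵛ h) z +ᵍ lin r z) ×
   (∀ k → coeff (monicList F) k ≡ (monicList h ⋆ coeff (monicList f)) k + coeff (toList r) k))
divide-monic f zero F = [] , zipWith _-_ F f
  , (λ z → trans
      (solveᵍ 2 (λ F f → F :=ᵍ f :*ᵍ conᵍ 1ᵍ :+ᵍ (F :-ᵍ f)) refl
        (ev (fromℚᵛ F) z) (ev (fromℚᵛ f) z))
      (cong (ev (fromℚᵛ f) z *ᵍ 1ᵍ +ᵍ_) (sym (lin-difference F f z))))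
  , λ k → trans (coeff-difference F f k)
      (cong (_+ coeff (toList (zipWith _-_ F f)) k) (one-⋆ (coeff (monicList f)) k))
  where
  one-⋆ : ∀ g k → g k ≡ ((1ℚ ∷ []) ⋆ g) k
  one-⋆ g zero    = solve 1 (λ x → x := con 1ℚ :* x :+ con 0ℚ) refl (g zero)
  one-⋆ g (suc k) = solve 1 (λ x → x := con 1ℚ :* x :+ con 0ℚ) refl (g (suc k))
divide-monic f (suc e) (c ∷ F) with divide-monic f e F
... | h , r , ev≡ , coeff≡ with reduce f (c ∷ r)
...   | t , r′ , lin≡ , coeff≡′ = t ∷ h , r′
  , (λ z → trans (cong (λ u → fromℚᵍ c +ᵍ z *ᵍ u) (ev≡ z)) (trans
      (solveᵍ 5 (λ c z f h r → c :+ᵍ z :*ᵍ (f :*ᵍ h :+ᵍ r) :=ᵍ z :*ᵍ (f :*ᵍ h) :+ᵍ (c :+ᵍ z :*ᵍ r)) refl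
        (fromℚᵍ c) z (ev (fromℚᵛ f) z) (ev (fromℚᵛ h) z) (lin r z))
      (trans (cong (z *ᵍ (ev (fromℚᵛ f) z *ᵍ ev (fromℚᵛ h) z) +ᵍ_) (lin≡ z))
        (solveᵍ 5 (λ z f h t r → z :*ᵍ (f :*ᵍ h) :+ᵍ (t :*ᵍ f :+ᵍ r) :=ᵍ f :*ᵍ (t :+ᵍ z :*ᵍ h) :+ᵍ r) refl
          z (ev (fromℚᵛ f) z) (ev (fromℚᵛ h) z) (fromℚᵍ t) (lin r′ z)))))
  , λ { zero → trans (coeff≡′ 0)
      (cong (_+ coeff (toList r′) 0) (sym (+-identityʳ (t * coeff (monicList f) 0))))
    ; (suc k) → trans (coeff≡ k) (trans (cong (λ t → (monicList h ⋆ coeff (monicList f)) k + t) (coeff≡′ (suc k)))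
      (solve 3 (λ a b c → a :+ (b :+ c) := b :+ a :+ c) refl
        ((monicList h ⋆ coeff (monicList f)) k) (t * coeff (monicList f) (suc k)) (coeff (toList r′) (suc k)))) }

-- Drops vanishing top coefficients and scales the rest to be monic, because the minimality
-- condition `least` speaks only of monic polynomials.
normalise : ∀ {n} (r : Vec ℚ n) → r ≡ replicate n 0ℚ ⊎
  ∃[ k ] Σ[ g ∈ Vec ℚ k ] ∃[ c ] (k ℕ.< n × c ≢ 0ℚ × (∀ z → lin r z ≡ fromℚᵍ c *ᵍ ev (fromℚᵛ g) z))
normalise []      = inj₁ refl
normalise {suc n} (c ∷ r) with normalise r
... | inj₂ (k , g , d , k<n , d≢0 , lin≡) = inj₂ (suc k , (c * recip d) ∷ g , d , ℕ.s≤s k<n , d≢0 , λ z →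
  trans (cong₂ (λ s t → s +ᵍ z *ᵍ t) (trans (cong fromℚᵍ (sym (d[c/d]≡c))) (fromℚᵍ-* d (c * recip d))) (lin≡ z))
    (solveᵍ 4 (λ d b z p → d :*ᵍ b :+ᵍ z :*ᵍ (d :*ᵍ p) :=ᵍ
      d :*ᵍ (b :+ᵍ z :*ᵍ p)) refl (fromℚᵍ d) (fromℚᵍ (c * recip d)) z (ev (fromℚᵛ g) z)))
  where
  d[c/d]≡c : d * (c * recip d) ≡ c
  d[c/d]≡c = trans (solve 3 (λ d c i → d :* (c :* i) := c :* (d :* i)) refl d c (recip d))
    (trans (cong (c *_) (*-recip d≢0)) (*-identityʳ c))
... | inj₁ refl with c ≟ 0ℚ
...   | yes refl = inj₁ refl
...   | no c≢0   = inj₂ (0 , [] , c , ℕ.s≤s ℕ.z≤n , c≢0 , λ z →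
  trans (cong (λ t → fromℚᵍ c +ᵍ z *ᵍ t) (lin-zeros n z))
    (solveᵍ 2 (λ c z → c :+ᵍ z :*ᵍ conᵍ 0ᵍ :=ᵍ c :*ᵍ conᵍ 1ᵍ) refl (fromℚᵍ c) z))

-- Formal derivatives

full : ∀ {n} → Vec ℚ n → Vec ℚ (suc n)
full []       = 1ℚ ∷ []
full (c ∷ cs) = c ∷ full cs

-- The product rule (c + X g)′ = g + X g′. The result is not monic in general, so all its
-- coefficients are stored and it is evaluated by `lin`.
derivative : ∀ {n} → Vec ℚ n → Vec ℚ n
derivative []       = []
derivative (c ∷ cs) = zipWith _+_ (full cs) (0ℚ ∷ derivative cs)

lin-full : ∀ {n} (cs : Vec ℚ n) z → lin (full cs) z ≡ ev (fromℚᵛ cs) z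
lin-full []       z = solveᵍ 1 (λ z → conᵍ 1ᵍ :+ᵍ z :*ᵍ conᵍ 0ᵍ :=ᵍ conᵍ 1ᵍ) refl z
lin-full (c ∷ cs) z = cong (λ t → fromℚᵍ c +ᵍ z *ᵍ t) (lin-full cs z)

lin-+ : ∀ {n} (f g : Vec ℚ n) z → lin (zipWith _+_ f g) z ≡ lin f z +ᵍ lin g z
lin-+ []      []      z = refl
lin-+ (c ∷ f) (d ∷ g) z = trans (cong (λ t → fromℚᵍ (c + d) +ᵍ z *ᵍ t) (lin-+ f g z))
  (solveᵍ 5 (λ c d z p q → (c :+ᵍ d) :+ᵍ z :*ᵍ (p :+ᵍ q) :=ᵍ (c :+ᵍ z :*ᵍ p) :+ᵍ (d :+ᵍ z :*ᵍ q)) refl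
    (fromℚᵍ c) (fromℚᵍ d) z (lin f z) (lin g z))

-- The polynomial `quo f z` is the difference quotient (f(x) - f(z)) / (x - z) in x; setting x = z
-- gives the derivative.
lin-derivative : ∀ {n} (f : Vec ℚ (suc n)) z → lin (derivative f) z ≡ ev (quo (fromℚᵛ f) z) z
lin-derivative {zero} (c ∷ []) z = solveᵍ 1 (λ z → conᵍ 1ᵍ :+ᵍ z :*ᵍ conᵍ 0ᵍ :=ᵍ conᵍ 1ᵍ) refl z
lin-derivative {suc n} (c ∷ cs) z = trans (lin-+ (full cs) (0ℚ ∷ derivative cs) z)
  (trans (cong₂ (λ s t → s +ᵍ (0ᵍ +ᵍ z *ᵍ t)) (lin-full cs z) (lin-derivative cs z))
    (solveᵍ 3 (λ p z q → p :+ᵍ (conᵍ 0ᵍ :+ᵍ z :*ᵍ q) :=ᵍ p :+ᵍ z :*ᵍ q) refl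
      (ev (fromℚᵛ cs) z) z (ev (quo (fromℚᵛ cs) z) z)))

last-∷ : ∀ {n} c (cs : Vec ℚ (suc n)) → last (c ∷ cs) ≡ last cs
last-∷ c (d ∷ cs) = refl

last-+ : ∀ {n} (f g : Vec ℚ (suc n)) → last (zipWith _+_ f g) ≡ last f + last g
last-+ (c ∷ [])         (d ∷ [])         = refl
last-+ (c ∷ f@(_ ∷ _)) (d ∷ g@(_ ∷ _)) = trans (last-∷ (c + d) (zipWith _+_ f g))
  (trans (last-+ f g) (sym (cong₂ _+_ (last-∷ c f) (last-∷ d g))))

last-full : ∀ {n} (cs : Vec ℚ n) → last (full cs) ≡ 1ℚ
last-full []       = refl
last-full (c ∷ cs) = trans (last-∷ c (full cs)) (last-full cs)

last-zeros : ∀ n → last (replicate (suc n) 0ℚ) ≡ 0ℚ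
last-zeros zero    = refl
last-zeros (suc n) = trans (last-∷ 0ℚ (replicate (suc n) 0ℚ)) (last-zeros n)

0<last-derivative : ∀ {n} (f : Vec ℚ (suc n)) → 0ℚ < last (derivative f)
0<last-derivative {zero}  (c ∷ [])         = positive⁻¹ (1ℚ + 0ℚ)
0<last-derivative {suc n} (c ∷ cs) = subst (0ℚ <_)
  (sym (trans (last-+ (full cs) (0ℚ ∷ derivative cs))
    (cong₂ _+_ (last-full cs) (last-∷ 0ℚ (derivative cs)))))
  (+-mono-< (positive⁻¹ 1ℚ) (0<last-derivative cs))

derivative≢0 : ∀ {n} (f : Vec ℚ (suc n)) → derivative f ≢ replicate (suc n) 0ℚ
derivative≢0 {n} f eq = <-irrefl {0ℚ} refl (subst (0ℚ <_) (trans (cong last eq) (last-zeros n)) (0<last-derivative f))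

zipWith-zeros : ∀ {n} (f g : Vec ℚ n) → zipWith _-_ f g ≡ replicate n 0ℚ → f ≡ g
zipWith-zeros []      []      eq = refl
zipWith-zeros (c ∷ f) (d ∷ g) eq = cong₂ _∷_
  (trans (solve 2 (λ c d → c := d :+ (c :- d)) refl c d) (trans (cong (λ t → d + t) (cong Vec.head eq)) (+-identityʳ d)))
  (zipWith-zeros f g (cong Vec.tail eq))

-- Complex numbers as sequences of Gaussian rationals

at : ℂ → ℕ → 𝔾
at z k = ⟨ seq (re z) k , seq (im z) k ⟩

eval-at : ∀ {n} (f : Vec ℚ n) z k → at (eval f z) k ≡ ev (fromℚᵛ f) (at z k)
eval-at []       z k = refl
eval-at (c ∷ cs) z k = cong (λ t → fromℚᵍ c +ᵍ at z k *ᵍ t) (eval-at cs z k)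

≃ᶜ⇒null : ∀ {z w} → z ≃ᶜ w → Null (λ k → at z k -ᵍ at w k)
≃ᶜ⇒null {z} {w} (r , i) ε 0<ε = eventually-map
  (λ {k} (p , q) → subst₂ _<_ (sym (∥⟨,⟩∥ (seq (re z) k - seq (re w) k) (seq (im z) k - seq (im w) k))) (half+half ε)
    (+-mono-< p q))
  (eventually-× (r (ε * ½) (half-pos 0<ε)) (i (ε * ½) (half-pos 0<ε)))

null⇒≃ᶜ : ∀ {z w} → Null (λ k → at z k -ᵍ at w k) → z ≃ᶜ w
null⇒≃ᶜ {z} {w} n =
    (λ ε 0<ε → eventually-map (λ {k} → ≤-<-trans (∣Re∣≤∥∥ (at z k -ᵍ at w k))) (n ε 0<ε))
  , (λ ε 0<ε → eventually-map (λ {k} → ≤-<-trans (∣Im∣≤∥∥ (at z k -ᵍ at w k))) (n ε 0<ε))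

root⇒null : ∀ {n} (f : Vec ℚ n) {z} → IsRoot f z → Null (λ k → ev (fromℚᵛ f) (at z k))
root⇒null f {z} r = null-cong {λ k → at (eval f z) k -ᵍ 0ᵍ}
  (λ k → trans (solveᵍ 1 (λ u → u :-ᵍ conᵍ 0ᵍ :=ᵍ u) refl (at (eval f z) k)) (eval-at f z k))
  (≃ᶜ⇒null {eval f z} {fromℝ (fromℚ 0ℚ)} r)

null⇒root : ∀ {n} (f : Vec ℚ n) {z} → Null (λ k → ev (fromℚᵛ f) (at z k)) → IsRoot f z
null⇒root f {z} n = null⇒≃ᶜ {eval f z} {fromℝ (fromℚ 0ℚ)} (null-cong
  (λ k → trans (sym (eval-at f z k)) (solveᵍ 1 (λ u → u :=ᵍ u :-ᵍ conᵍ 0ᵍ) refl (at (eval f z) k))) n)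

at-cauchy : ∀ z → CauchyNorm (at z)
at-cauchy z ε 0<ε =
  let (K , p) = cauchy (re z) (ε * ½) (half-pos 0<ε)
      (L , q) = cauchy (im z) (ε * ½) (half-pos 0<ε)
  in K ℕ.⊔ L , λ k l ≤k ≤l → subst₂ _<_
       (sym (∥⟨,⟩∥ (seq (re z) k - seq (re z) l) (seq (im z) k - seq (im z) l))) (half+half ε)
       (+-mono-< (p k l (ℕP.m⊔n≤o⇒m≤o K L ≤k) (ℕP.m⊔n≤o⇒m≤o K L ≤l))
                 (q k l (ℕP.m⊔n≤o⇒n≤o K L ≤k) (ℕP.m⊔n≤o⇒n≤o K L ≤l)))

at-bounded : ∀ z → Bounded (at z)
at-bounded z =
  let (B , 0<B , p) = cauchy⇒bounded {seq (re z)} (cauchy (re z))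
      (C , 0<C , q) = cauchy⇒bounded {seq (im z)} (cauchy (im z))
  in B + C , +-mono-< 0<B 0<C , eventually-map
       (λ {k} (b , c) → subst (_≤ B + C) (sym (∥⟨,⟩∥ (seq (re z) k) (seq (im z) k))) (+-mono-≤ b c))
       (eventually-× p q)

-- The Cauchy modulus decides at each precision whether z is small or apart
-- from 0.
¬away⇒null : ∀ z → ¬ Away (at z) → Null (at z)
¬away⇒null z ¬away ε 0<ε = decide (∥ at z K ∥ <? ε * ½)
  where
  K : ℕ
  K = proj₁ (at-cauchy z (ε * ½ * ½) (half-pos (half-pos 0<ε)))
  near : ∀ k l → K ℕ.≤ k → K ℕ.≤ l → ∥ at z k -ᵍ at z l ∥ < ε * ½ * ½
  near = proj₂ (at-cauchy z (ε * ½ * ½) (half-pos (half-pos 0<ε)))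
  decide : Dec (∥ at z K ∥ < ε * ½) → Eventually (λ k → ∥ at z k ∥ < ε)
  decide (yes small) = K , λ k K≤k → ≤-<-trans (∥u∥≤∥v∥+∥u-v∥ (at z k) (at z K))
    (<-trans (+-mono-< small (near k K K≤k ℕP.≤-refl))
      (<-cert (ε * ½ * ½) (half-pos (half-pos 0<ε))
        (solve 1 (λ e → e :* con ½ :+ e :* con ½ :* con ½ :+ e :* con ½ :* con ½ := e) refl ε)))
  decide (no large) = ⊥-elim (¬away (ε * ½ * ½ , half-pos (half-pos 0<ε) , K , λ k K≤k → ≮⇒≥ λ small →
    large (≤-<-trans (∥u∥≤∥v∥+∥u-v∥ (at z K) (at z k))
      (subst (∥ at z k ∥ + ∥ at z K -ᵍ at z k ∥ <_) (half+half (ε * ½)) (+-mono-< small (near K k ℕP.≤-refl K≤k))))))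

-- Conjugates of a Pisot number

atℝ : ℝ → ℕ → 𝔾
atℝ q = at (fromℝ q)

away-const : ∀ {c} → c ≢ 0ℚ → Away (λ _ → fromℚᵍ c)
away-const {c} c≢0 = ∣ c ∣ , ≰⇒> (λ c≤0 → c≢0 (∣p∣≡0⇒p≡0 c (≤-antisym c≤0 (0≤∣p∣ c)))) ,
  0 , λ _ _ → ∣Re∣≤∥∥ (fromℚᵍ c)

away-* : ∀ {u v} → Away u → Away v → Away (λ k → u k *ᵍ v k)
away-* {u} {v} (γ , 0<γ , a) (δ , 0<δ , b) = γ * δ * ½ , half-pos (pos-* 0<γ 0<δ) , eventually-map
  (λ {k} (p , q) → *-cancelʳ-≤-pos (1ℚ + 1ℚ) (subst₂ _≤_
    (solve 2 (λ g d → g :* d := g :* d :* con ½ :* con (1ℚ + 1ℚ)) refl γ δ)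
    (solve 1 (λ w → w :+ w := w :* con (1ℚ + 1ℚ)) refl ∥ u k *ᵍ v k ∥)
    (≤-trans (*-mono-nonNeg (<⇒≤ 0<δ) (0≤∥u∥ (u k)) p q) (∥u∥∥v∥≤2∥uv∥ (u k) (v k)))))
  (eventually-× a b)

integer-coefficient : ∀ {n} (F : Vec ℤ n) k → ∃[ i ] coeff (monicList (Vec.map (_/ 1) F)) k ≡ fromInt i
integer-coefficient []      zero    = + 1 , refl
integer-coefficient []      (suc k) = + 0 , refl
integer-coefficient (c ∷ F) zero    = c , refl
integer-coefficient (c ∷ F) (suc k) = integer-coefficient F k

module _ {q : ℝ} {n : ℕ} {f : Vec ℚ n} (min : IsMinimalPolynomial q f) where

  open IsMinimalPolynomial min

  null-f : Null (λ k → ev (fromℚᵛ f) (atℝ q k))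
  null-f = root⇒null f {fromℝ q} root

  vanishing⇒zero : (r : Vec ℚ n) → Null (λ k → lin r (atℝ q k)) → r ≡ replicate n 0ℚ
  vanishing⇒zero r nr with normalise r
  ... | inj₁ r≡0 = r≡0
  ... | inj₂ (k , g , c , k<n , c≢0 , lin≡) = ⊥-elim (ℕP.<⇒≱ k<n (least g (null⇒root g {fromℝ q}
    (away-cancel {λ _ → fromℚᵍ c} (away-const c≢0) (null-cong (λ j → lin≡ (atℝ q j)) nr)))))

  minimal-unique : {g : Vec ℚ n} → IsMinimalPolynomial q g → f ≡ g
  minimal-unique {g} min′ = zipWith-zeros f g (vanishing⇒zero (zipWith _-_ f g)
    (null-cong {λ k → ev (fromℚᵛ f) (atℝ q k) -ᵍ ev (fromℚᵛ g) (atℝ q k)}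
      (λ k → sym (lin-difference f g (atℝ q k)))
      (null-+ null-f (null-neg (root⇒null g {fromℝ q} (IsMinimalPolynomial.root min′))))))

  -- Minimality forces the remainder of an integral polynomial F of q modulo f to be zero, so f is a
  -- monic rational factor of F and Gauss's lemma applies.
  integral : IsAlgebraicInteger q → All (λ c → ∃[ i ] c ≡ fromInt i) (monicList f)
  integral (N , F , rootF) = go N (N ℕ.∸ n) (sym (ℕP.m∸n+n≡m (least (Vec.map (_/ 1) F) rootF))) F rootF
    where
    coeff-zeros : ∀ n k → coeff (toList (replicate n 0ℚ)) k ≡ 0ℚ
    coeff-zeros zero    k       = refl
    coeff-zeros (suc n) zero    = refl
    coeff-zeros (suc n) (suc k) = coeff-zeros n k
    go : ∀ N e → N ≡ e ℕ.+ n → (F : Vec ℤ N) → IsRoot (Vec.map (_/ 1) F) (fromℝ q) →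
      All (λ c → ∃[ i ] c ≡ fromInt i) (monicList f)
    go _ e refl F rootF with divide-monic f e (Vec.map (_/ 1) F)
    ... | h , r , ev≡ , coeff≡ = monic-factor-integral (monicList f) (monicList h)
      (λ k → proj₁ (integer-coefficient F k)) (1∈monicList f) (1∈monicList h)
      (λ k → trans (sym (trans (coeff≡ k) (trans
          (cong (λ s → (monicList h ⋆ coeff (monicList f)) k + coeff (toList s) k) r≡0)
          (trans (cong (λ t → (monicList h ⋆ coeff (monicList f)) k + t) (coeff-zeros n k))
            (+-identityʳ ((monicList h ⋆ coeff (monicList f)) k))))))
        (proj₂ (integer-coefficient F k)))
      where
      r≡0 : r ≡ replicate n 0ℚ
      r≡0 = vanishing⇒zero r (null-cong
        {λ k → ev (fromℚᵛ (Vec.map (_/ 1) F)) (atℝ q k) -ᵍ ev (fromℚᵛ h) (atℝ q k) *ᵍ ev (fromℚᵛ f) (atℝ q k)}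
        (λ k → trans (cong (_-ᵍ ev (fromℚᵛ h) (atℝ q k) *ᵍ ev (fromℚᵛ f) (atℝ q k)) (ev≡ (atℝ q k)))
          (solveᵍ 3 (λ f h r → f :*ᵍ h :+ᵍ r :-ᵍ h :*ᵍ f :=ᵍ r) refl
            (ev (fromℚᵛ f) (atℝ q k)) (ev (fromℚᵛ h) (atℝ q k)) (lin r (atℝ q k))))
        (null-+ (root⇒null (Vec.map (_/ 1) F) {fromℝ q} rootF)
          (null-neg (null-* (bounded-ev (λ _ → fromℚᵛ h) (atℝ q) (coeffSum (fromℚᵛ h) , 0 , λ _ _ → ≤-refl) (at-bounded (fromℝ q)))
            null-f))))

¬constant-minimal : ∀ {q} {f : Vec ℚ 0} → ¬ IsMinimalPolynomial q f
¬constant-minimal {q} {[]} min = constant-not-null (λ _ → []) (atℝ q) (null-f min)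

-- The derivative is nonzero and of lower degree than f, so it cannot vanish at q. It is rewritten
-- as c g with g monic, because `¬away⇒null` is applied to the complex number g(q). The double
-- negation is harmless where a contradiction is the goal.
simple-root : ∀ {q n} {f : Vec ℚ (suc n)} → IsMinimalPolynomial q f →
  ¬ ¬ Away (λ k → ev (quo (fromℚᵛ f) (atℝ q k)) (atℝ q k))
simple-root {q} {n} {f} min ¬away with normalise (derivative f)
... | inj₁ ≡0 = derivative≢0 f ≡0
... | inj₂ (k , g , c , k<n , c≢0 , lin≡) = ℕP.<⇒≱ k<n (IsMinimalPolynomial.least min g (null⇒root g {fromℝ q}
  (null-cong (eval-at g (fromℝ q)) (¬away⇒null (eval g (fromℝ q)) λ a → ¬away (away-cong
    (λ j → trans (cong (fromℚᵍ c *ᵍ_) (eval-at g (fromℝ q) j))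
      (trans (sym (lin≡ (atℝ q j))) (lin-derivative f (atℝ q j))))
    (away-* (away-const c≢0) a))))))

1≤fromInt : ∀ {m} → 1 ℕ.≤ m → 1ℚ ≤ fromInt (+ m)
1≤fromInt {suc m} _ = ≤-cert (fromInt (+ m)) (0≤fromInt+ m) (sym (fromInt-+ (+ 1) (+ m)))

1≤i² : ∀ i → fromInt i ≢ 0ℚ → 1ℚ ≤ fromInt i * fromInt i
1≤i² (+ zero)   i≢0 = ⊥-elim (i≢0 refl)
1≤i² (+ suc i)  i≢0 = *-mono-nonNeg (nonNegative⁻¹ 1ℚ) (0≤fromInt+ (suc i)) 1≤ 1≤
  where
  1≤ : 1ℚ ≤ fromInt (+ suc i)
  1≤ = 1≤fromInt {suc i} (ℕ.s≤s ℕ.z≤n)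
1≤i² ℤ.-[1+ i ] i≢0 = subst (1ℚ ≤_)
  (trans (sym (fromInt-* (+ suc i) (+ suc i))) (fromInt-* ℤ.-[1+ i ] ℤ.-[1+ i ]))
  (1≤i² (+ suc i) λ eq → <-irrefl (sym eq) (0<fromInt+ (suc i)))

-- If the integral constant term were 0, dividing f by X would give a monic polynomial of smaller
-- degree that still vanishes at q, as q is apart from 0.
1≤N-constant : ∀ {q n} {f : Vec ℚ n} → IsMinimalPolynomial q f → IsAlgebraicInteger q → Away (atℝ q) →
  1ℚ ≤ N (ev (fromℚᵛ f) 0ᵍ)
1≤N-constant {f = []}     min ai away = ≤-reflexive (sym (N⟨,⟩ 1ℚ 0ℚ))
1≤N-constant {q} {suc n} {c ∷ cs} min ai away with integral min ai
... | (i , refl) ∷ _ = subst (1ℚ ≤_) (sym (trans (cong N value) (trans (N⟨,⟩ c 0ℚ) (+-identityʳ (c * c)))))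
  (1≤i² i c≢0)
  where
  value : ev (fromℚᵛ (c ∷ cs)) 0ᵍ ≡ fromℚᵍ c
  value = solveᵍ 2 (λ c p → c :+ᵍ conᵍ 0ᵍ :*ᵍ p :=ᵍ c) refl (fromℚᵍ c) (ev (fromℚᵛ cs) 0ᵍ)
  c≢0 : c ≢ 0ℚ
  c≢0 c≡0 = ℕP.1+n≰n (IsMinimalPolynomial.least min cs (null⇒root cs {fromℝ q}
    (away-cancel {atℝ q} away (null-cong
      (λ k → trans (cong (λ t → fromℚᵍ t +ᵍ atℝ q k *ᵍ ev (fromℚᵛ cs) (atℝ q k)) c≡0)
        (solveᵍ 1 (λ p → conᵍ 0ᵍ :+ᵍ p :=ᵍ p) refl (atℝ q k *ᵍ ev (fromℚᵛ cs) (atℝ q k))))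
      (null-f min)))))

N-at : ∀ z k → N (at z k) ≡ seq (re z *ʳ re z +ʳ im z *ʳ im z) k
N-at z k = N⟨,⟩ (seq (re z) k) (seq (im z) k)

-- Bisection yields s with s² ≤ x < (s + v)², where x is N at index k. As soon as v is below the gap
-- ε between s and ρ, s + v ≤ ρ and hence x < ρ².
modulus<⇒N< : ∀ z {ρ} → modulus z <ʳ fromℚ ρ → Eventually (λ k → N (at z k) < ρ * ρ)
modulus<⇒N< z {ρ} (ε , 0<ε , gap) =
  let (B , 0<B , bounded) = cauchy⇒bounded {seq x} (cauchy x)
  in eventually-map
    (λ {k} (s+ε<ρ , x≤B , small) → bound k s+ε<ρ (≤-<-trans
      (*-monoʳ-≤-nonNeg (½^ k) {{nonNegative (<⇒≤ (0<½^ k))}}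
        (+-monoʳ-≤ 1ℚ (⊔-lub (≤-trans (p≤∣p∣ (seq x k)) x≤B) (<⇒≤ 0<B)))) small))
    (eventually-× gap (eventually-× bounded (small½^ {1ℚ + B} (+-mono-< (positive⁻¹ 1ℚ) 0<B) 0<ε)))
  where
  x : ℝ
  x = re z *ʳ re z +ʳ im z *ʳ im z
  bound : ∀ k → seq (modulus z) k + ε < ρ → (1ℚ + (seq x k ⊔ 0ℚ)) * ½^ k < ε → N (at z k) < ρ * ρ
  bound k s+ε<ρ v<ε = ≤-<-trans (≤-trans (≤-reflexive (N-at z k)) (p≤p⊔q (seq x k) 0ℚ))
    (<-≤-trans upper (*-mono-nonNeg 0≤s+v (≤-trans 0≤s+v s+v≤ρ) s+v≤ρ s+v≤ρ))
    where
    open BisectSpec (bisect-spec (seq x k ⊔ 0ℚ) k (p≤q⊔p (seq x k) 0ℚ))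
    s v : ℚ
    s = seq (modulus z) k
    v = (1ℚ + (seq x k ⊔ 0ℚ)) * ½^ k
    0≤s+v : 0ℚ ≤ s + v
    0≤s+v = +-nonneg nonneg (0≤* (+-nonneg (nonNegative⁻¹ 1ℚ) (p≤q⊔p (seq x k) 0ℚ)) (<⇒≤ (0<½^ k)))
    s+v≤ρ : s + v ≤ ρ
    s+v≤ρ = <⇒≤ (<-trans (+-monoʳ-< s v<ε) s+ε<ρ)

⟨Re,Im⟩ : ∀ u → ⟨ Re u , Im u ⟩ ≡ u
⟨Re,Im⟩ ⟨ a , b ⟩ = refl

∣Re∣²≤N : ∀ u → ∣ Re u ∣ * ∣ Re u ∣ ≤ N u
∣Re∣²≤N ⟨ a , b ⟩ = subst₂ _≤_ (sym (∣p∣²≡p² a)) (sym (N⟨,⟩ a b)) (p≤p+q (0≤p² b))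

-- Each conjugate comes with its own minimal polynomial. Their degrees agree by minimality in both
-- directions, and `minimal-unique` then identifies them.
conjugates-share-polynomial : ∀ {q z w} → IsGaloisConjugate q z → IsGaloisConjugate q w →
  ∃[ n ] Σ[ f ∈ Vec ℚ n ] (IsMinimalPolynomial q f × IsRoot f z × IsRoot f w)
conjugates-share-polynomial {q} {z} {w} (n , f , min , rz) (n′ , g , min′ , rw) =
  n , f , min , rz , transfer (ℕP.≤-antisym (least min g (root min′)) (least min′ f (root min))) g min′ rw
  where
  open IsMinimalPolynomial
  transfer : ∀ {n′} → n ≡ n′ → (g : Vec ℚ n′) → IsMinimalPolynomial q g → IsRoot g w → IsRoot f w
  transfer refl g min′ rw = subst (λ h → IsRoot h w) (sym (minimal-unique {q} {n} {f} min min′)) rw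

module _ {q : ℝ} (pisot : IsPisot q) {μ ρ : ℚ} (1≤μ : 1ℚ ≤ μ) (0<ρ : 0ℚ < ρ) (ρ[μ+½]≡1 : ρ * (μ + ½) ≡ 1ℚ)
  (μ≤q : Eventually (λ k → μ ≤ seq q k)) (q≤1+μ : Eventually (λ k → seq q k ≤ 1ℚ + μ)) where

  open IsPisot pisot

  private
    ρ≤⅔ : ρ ≤ + 2 / 3
    ρ≤⅔ = ≤-cert (ρ * (μ - 1ℚ) * (+ 2 / 3)) (0≤* (0≤* (<⇒≤ 0<ρ) (p≤q⇒0≤q-p 1≤μ)) (nonNegative⁻¹ (+ 2 / 3)))
      (trans (solve 2 (λ r m → r :+ r :* (m :- con 1ℚ) :* con (+ 2 / 3) := r :* (m :+ con ½) :* con (+ 2 / 3)) refl ρ μ)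
        (cong (_* (+ 2 / 3)) ρ[μ+½]≡1))

    -- Rests on (8/9)(μ + 1/2)² - (1 + μ) = (μ - 1)(8μ/9 + 7/9), with equality at μ = 1.
    [μ+1]ρ²≤8/9 : (1ℚ + μ) * (ρ * ρ) ≤ + 8 / 9
    [μ+1]ρ²≤8/9 = ≤-cert (ρ * ρ * ((μ - 1ℚ) * (μ * (+ 8 / 9) + + 7 / 9)))
      (0≤* (0≤* (<⇒≤ 0<ρ) (<⇒≤ 0<ρ)) (0≤* (p≤q⇒0≤q-p 1≤μ)
        (+-nonneg (0≤* (≤-trans (nonNegative⁻¹ 1ℚ) 1≤μ) (nonNegative⁻¹ (+ 8 / 9))) (nonNegative⁻¹ (+ 7 / 9)))))
      (trans (solve 2 (λ r m → (con 1ℚ :+ m) :* (r :* r) :+ r :* r :* ((m :- con 1ℚ) :* (m :* con (+ 8 / 9) :+ con (+ 7 / 9)))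
         := r :* (m :+ con ½) :* (r :* (m :+ con ½)) :* con (+ 8 / 9)) refl ρ μ)
        (cong (λ t → t * t * (+ 8 / 9)) ρ[μ+½]≡1))

    qs : ℕ → 𝔾
    qs = atℝ q

    1≤q : Eventually (λ k → 1ℚ ≤ seq q k)
    1≤q = eventually-map (≤-trans 1≤μ) μ≤q

    away-q : Away qs
    away-q = 1ℚ , positive⁻¹ 1ℚ , eventually-map
      (λ {k} 1≤ → ≤-trans 1≤ (≤-trans (p≤∣p∣ (seq q k)) (∣Re∣≤∥∥ (qs k)))) 1≤q

    Small : ℂ → Set
    Small z = Eventually (λ k → N (at z k) < ρ * ρ)

    -- The gap 1/3 is 1 - 2/3: the real part of z is below ρ ≤ 2/3, and q is at least 1.
    away-small-q : ∀ {z} → Small z → Away (λ k → at z k -ᵍ qs k)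
    away-small-q {z} small = + 1 / 3 , positive⁻¹ (+ 1 / 3) , eventually-map
      (λ {k} (N<ρ² , 1≤) →
        let Re<ρ = ²-cancel-< (<⇒≤ 0<ρ) (≤-<-trans (∣Re∣²≤N (at z k)) N<ρ²)
        in ≤-trans
          (≤-cert ((seq q k - 1ℚ) + ((+ 2 / 3 - ρ) + (ρ - seq (re z) k)))
            (+-nonneg (p≤q⇒0≤q-p 1≤) (+-nonneg (p≤q⇒0≤q-p ρ≤⅔)
              (p≤q⇒0≤q-p (≤-trans (p≤∣p∣ (seq (re z) k)) (<⇒≤ Re<ρ)))))
            (solve 3 (λ q r x → con (+ 1 / 3) :+ ((q :- con 1ℚ) :+ ((con (+ 2 / 3) :- r) :+ (r :- x))) := :- (x :- q)) refl
              (seq q k) ρ (seq (re z) k)))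
          (≤-trans (-p≤∣p∣ (seq (re z) k - seq q k)) (∣Re∣≤∥∥ (at z k -ᵍ qs k))))
      (eventually-× small 1≤q)

    product-small : ∀ {z w} → Small z → Small w →
      Eventually (λ k → N (qs k) * (N (at z k) * N (at w k)) ≤ + 64 / 81)
    product-small {z} {w} sz sw = eventually-map
      (λ {k} (1≤ , ≤1+μ , z< , w<) →
        let 0≤q = ≤-trans (nonNegative⁻¹ 1ℚ) 1≤
            0≤1+μ = ≤-trans 0≤q ≤1+μ
            0≤ρ² = 0≤* (<⇒≤ 0<ρ) (<⇒≤ 0<ρ)
            0≤zw = 0≤* (0≤N (at z k)) (0≤N (at w k))
            0≤[1+μ]ρ² = 0≤* 0≤1+μ 0≤ρ²
        in ≤-trans
          (*-mono-nonNeg 0≤zw (0≤* 0≤1+μ 0≤1+μ)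
            (≤-trans (≤-reflexive (trans (N⟨,⟩ (seq q k) 0ℚ) (+-identityʳ (seq q k * seq q k))))
              (*-mono-nonNeg 0≤q 0≤1+μ ≤1+μ ≤1+μ))
            (*-mono-nonNeg (0≤N (at w k)) 0≤ρ² (<⇒≤ z<) (<⇒≤ w<)))
          (≤-trans (≤-reflexive (solve 2 (λ a b → a :* a :* (b :* b) := a :* b :* (a :* b)) refl (1ℚ + μ) (ρ * ρ)))
            (*-mono-nonNeg 0≤[1+μ]ρ² (nonNegative⁻¹ (+ 8 / 9)) [μ+1]ρ²≤8/9 [μ+1]ρ²≤8/9)))
      (eventually-× 1≤q (eventually-× q≤1+μ (eventually-× sz sw)))

    no-outer-root : ∀ {n} {f : Vec ℚ n} → IsMinimalPolynomial q f → ∀ ξ → ¬ IsOuterRoot (fromℚᵛ f) qs ξ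
    no-outer-root {n} {f} min ξ (cRe , cIm , null , outside , apart) =
      outside (eventually-map (λ {k} → subst (λ u → N u < 1ℚ) (⟨Re,Im⟩ (ξ k)))
        (modulus<⇒N< ζ {1ℚ} (conjugates ζ (n , f , min , ζ-root) ζ≄q)))
      where
      ζ : ℂ
      ζ = mkℝ (λ k → Re (ξ k)) cRe +i mkℝ (λ k → Im (ξ k)) cIm
      ζ-root : IsRoot f ζ
      ζ-root = null⇒root f {ζ} (null-cong (λ k → cong (ev (fromℚᵛ f)) (sym (⟨Re,Im⟩ (ξ k)))) null)
      ζ≄q : ¬ (ζ ≃ᶜ fromℝ q)
      ζ≄q eq = apart (null-cong (λ k → cong (_-ᵍ qs k) (⟨Re,Im⟩ (ξ k))) (≃ᶜ⇒null {ζ} {fromℝ q} eq))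

  -- By `¬away⇒null` it suffices to refute that z - w is away from 0. Within this refutation
  -- `simple-root` can be used despite its double negation, and `outer-root` contradicts the Pisot
  -- property.
  small-roots-equal : ∀ {n} {f : Vec ℚ n} → IsMinimalPolynomial q f → ∀ {z w} →
    IsRoot f z → IsRoot f w → Eventually (λ k → N (at z k) < ρ * ρ) → Eventually (λ k → N (at w k) < ρ * ρ) →
    z ≃ᶜ w
  small-roots-equal {zero}      min _ _ _ _ = ⊥-elim (¬constant-minimal min)
  small-roots-equal {suc n} {f} min {z} {w} rz rw sz sw = null⇒≃ᶜ {z} {w} (¬away⇒null z-w λ away-z-w →
    simple-root min λ simple →
      let (ξ , outer) = outer-root (fromℚᵛ f) qs (at w) (at z) (at-cauchy (fromℝ q))
            (at-bounded (fromℝ q)) (at-bounded w) (at-bounded z)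
            (null-f min) (root⇒null f {w} rw) (root⇒null f {z} rz)
            (away-small-q {w} sw) (away-small-q {z} sz) away-z-w simple
            (1≤N-constant min algebraicInteger away-q) (product-small {w} {z} sw sz)
      in no-outer-root min ξ outer)
    where
    z-w : ℂ
    z-w = (re z +ʳ -ʳ re w) +i (im z +ʳ -ʳ im w)

-- Complex conjugation

conjᶜ : ℂ → ℂ
conjᶜ z = re z +i (-ʳ im z)

conj-+ : ∀ u v → conj (u +ᵍ v) ≡ conj u +ᵍ conj v
conj-+ ⟨ a , b ⟩ ⟨ c , d ⟩ = cong ⟨ a + c ,_⟩ (neg-distrib-+ b d)

conj-* : ∀ u v → conj (u *ᵍ v) ≡ conj u *ᵍ conj v
conj-* ⟨ a , b ⟩ ⟨ c , d ⟩ = cong₂ ⟨_,_⟩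
  (solve 4 (λ a b c d → a :* c :+ :- (b :* d) := a :* c :+ :- (:- b :* :- d)) refl a b c d)
  (solve 4 (λ a b c d → :- (a :* d :+ b :* c) := a :* :- d :+ :- b :* c) refl a b c d)

ev-conj : ∀ {n} (f : Vec ℚ n) z → ev (fromℚᵛ f) (conj z) ≡ conj (ev (fromℚᵛ f) z)
ev-conj []       z = refl
ev-conj (c ∷ cs) z = trans (cong (λ t → fromℚᵍ c +ᵍ conj z *ᵍ t) (ev-conj cs z))
  (sym (trans (conj-+ (fromℚᵍ c) (z *ᵍ ev (fromℚᵛ cs) z)) (cong (λ t → fromℚᵍ c +ᵍ t) (conj-* z (ev (fromℚᵛ cs) z)))))

conj-root : ∀ {n} (f : Vec ℚ n) z → IsRoot f z → IsRoot f (conjᶜ z)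
conj-root f z r = null⇒root f {conjᶜ z} λ ε 0<ε → eventually-map
  (λ {k} → subst (_< ε) (trans (sym (∥conj∥ (ev (fromℚᵛ f) (at z k)))) (cong ∥_∥ (sym (ev-conj f (at z k))))))
  (root⇒null f {z} r ε 0<ε)

N-conj : ∀ u → N (conj u) ≡ N u
N-conj ⟨ a , b ⟩ = trans (N⟨,⟩ a (- b)) (trans
  (solve 2 (λ a b → a :* a :+ :- b :* :- b := a :* a :+ b :* b) refl a b) (sym (N⟨,⟩ a b)))

≃conj⇒real : ∀ z → z ≃ᶜ conjᶜ z → IsReal z
≃conj⇒real z (_ , y≃-y) ε 0<ε = eventually-map
  (λ {k} small → ≤-<-trans (y≤ (seq (im z) k)) small) (y≃-y ε 0<ε)
  where
  y≤ : ∀ y → ∣ y - 0ℚ ∣ ≤ ∣ y - - y ∣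
  y≤ y = subst₂ _≤_ (cong ∣_∣ (sym (+-identityʳ y)))
    (trans (solve 1 (λ a → a :+ a := a :* con (1ℚ + 1ℚ)) refl (∣ y ∣))
      (trans (sym (∣p*q∣≡∣p∣*∣q∣ y (1ℚ + 1ℚ)))
        (cong ∣_∣ (solve 1 (λ y → y :* con (1ℚ + 1ℚ) := y :- :- y) refl y))))
    (p≤p+q {∣ y ∣} (0≤∣p∣ y))

theorem2p1 : (m : ℕ) → 1 ℕ.≤ m →
    (q : ℝ) → fromℤ (+ m) <ʳ q → q <ʳ fromℤ (+ suc m) →
    IsPisot q →
    ¬ (∃[ z ] (IsGaloisConjugate q z × ¬ IsReal z × modulus z <ʳ radius m))
    ×
    (∀ z w →
    IsGaloisConjugate q z → IsReal z → modulus z <ʳ radius m →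
    IsGaloisConjugate q w → IsReal w → modulus w <ʳ radius m →
    z ≃ᶜ w)
theorem2p1 m 1≤m q (ε , 0<ε , K , μ+ε<q) (η , 0<η , L , q+η<) pisot =
    (λ (z , (n , f , min , root) , ¬real , small) →
      let Nz<ρ² = modulus<⇒N< z {ρ} small
      in ¬real (≃conj⇒real z (equal min {z} {conjᶜ z} root (conj-root f z root) Nz<ρ²
        (eventually-map (λ {k} → subst (_< ρ * ρ) (sym (N-conj (at z k)))) Nz<ρ²))))
  , λ z w cz _ sz cw _ sw →
      let (n , f , min , rz , rw) = conjugates-share-polynomial {q} {z} {w} cz cw
      in equal min {z} {w} rz rw (modulus<⇒N< z {ρ} sz) (modulus<⇒N< w {ρ} sw)
  where
  μ ρ : ℚ
  μ = + m / 1
  ρ = (1/ (μ + ½)) {{pos⇒nonZero (μ + ½) {{m+½-pos m}}}}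
  equal : ∀ {n} {f : Vec ℚ n} → IsMinimalPolynomial q f → ∀ {z w} → IsRoot f z → IsRoot f w →
    Eventually (λ k → N (at z k) < ρ * ρ) → Eventually (λ k → N (at w k) < ρ * ρ) → z ≃ᶜ w
  equal = small-roots-equal pisot {μ} {ρ} (1≤fromInt {m} 1≤m)
    (positive⁻¹ ρ {{1/pos⇒pos (μ + ½) {{m+½-pos m}}}})
    (*-inverseˡ (μ + ½) {{pos⇒nonZero (μ + ½) {{m+½-pos m}}}})
    (K , λ k K≤k → ≤-trans (p≤p+q {μ} (<⇒≤ 0<ε)) (<⇒≤ (μ+ε<q k K≤k)))
    (L , λ k L≤k → ≤-trans (p≤p+q {seq q k} (<⇒≤ 0<η))
      (≤-trans (<⇒≤ (q+η< k L≤k)) (≤-reflexive (fromInt-+ (+ 1) (+ m)))))
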